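{- There exists an absolute constant $c>0$ such that for every natural number $k$, every non-bipartite $2$-connected graph $G$ with average degree at least $ck$ and girth $g$ contains at least $k^{\lfloor (g-1)/2\rfloor}$ cycles of consecutive odd lengths, i.e., there is an odd integer $m$ such that $G$ contains cycles of each of the lengths $m, m+2, m+4, \ldots, m+2(k^{\lfloor (g-1)/2\rfloor}-1)$.
   Context: All graphs are finite and simple. The girth of a graph is the length of its shortest cycle. The average degree of $G$ is $2|E(G)|/|V(G)|$. -}

module Defs where

open import Data.Nat using (ℕ; zero; suc; _+_; _*_; _<ᵇ_)
open import Data.Fin using (Fin; zero; suc; toℕ; inject₁; fromℕ)
open import Data.Bool using (Bool; true; false; _∧_; if_then_else_)
open import Data.Product using (Σ; _×_; ∃)
open import Relation.Binary.PropositionalEquality using (_≡_; _≢_)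
open import Relation.Nullary using (¬_)
open import Function.Definitions using (Injective)

record Graph (n : ℕ) : Set where
  field
    adj    : Fin n → Fin n → Bool
    sym    : ∀ i j → adj i j ≡ adj j i
    irrefl : ∀ i → adj i i ≡ false

open Graph public

Adj : ∀ {n} → Graph n → Fin n → Fin n → Set
Adj G i j = adj G i j ≡ true

sumFin : ∀ {n} → (Fin n → ℕ) → ℕ
sumFin {zero}  f = 0
sumFin {suc n} f = f zero + sumFin (λ i → f (suc i))

edgeCount : ∀ {n} → Graph n → ℕ
edgeCount G = sumFin λ i → sumFin λ j →
  if (toℕ i <ᵇ toℕ j) ∧ adj G i j then 1 else 0

record Cycle {n : ℕ} (G : Graph n) (m : ℕ) : Set where
  field
    vtx   : Fin (3 + m) → Fin n
    inj   : Injective _≡_ _≡_ vtx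
    step  : ∀ (i : Fin (2 + m)) → Adj G (vtx (inject₁ i)) (vtx (suc i))
    close : Adj G (vtx (fromℕ (2 + m))) (vtx zero)

HasCycle : ∀ {n} → Graph n → ℕ → Set
HasCycle G L = Σ ℕ λ m → (L ≡ 3 + m) × Cycle G m

Girth : ∀ {n} → Graph n → ℕ → Set
Girth G g = HasCycle G g × (∀ L → HasCycle G L → g ≤' L)
  where
  open import Data.Nat using () renaming (_≤_ to _≤'_)

Bipartite : ∀ {n} → Graph n → Set
Bipartite {n} G = Σ (Fin n → Bool) λ col → ∀ i j → Adj G i j → col i ≢ col j

data WalkAvoid {n} (G : Graph n) (bad : Fin n → Set) : Fin n → Fin n → Set where
  here : ∀ {u} → ¬ bad u → WalkAvoid G bad u u
  step : ∀ {u w v} → ¬ bad u → Adj G u w → WalkAvoid G bad w v → WalkAvoid G bad u v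

Connected : ∀ {n} → Graph n → Set
Connected G = ∀ u v → WalkAvoid G (λ _ → Data.Empty.⊥) u v
  where import Data.Empty

ConnectedWithout : ∀ {n} → Graph n → Fin n → Set
ConnectedWithout G x = ∀ u v → u ≢ x → v ≢ x → WalkAvoid G (λ y → y ≡ x) u v

TwoConnected : ∀ {n} → Graph n → Set
TwoConnected {n} G = (3 ≤' n) × Connected G × (∀ x → ConnectedWithout G x)
  where
  open import Data.Nat using () renaming (_≤_ to _≤'_)

Odd : ℕ → Set
Odd m = Σ ℕ λ t → m ≡ 1 + 2 * t

module Submission where

-- Let N = k ^ ⌊(g − 1)/2⌋.  It suffices to find a cycle F with a chord, of length at least 2N + 2, inside one
-- layer or between two consecutive layers of a breadth-first search tree, and to close paths of F through the tree.
--
-- Root: among all roots x take a horizontal edge (both ends at the same distance j from x) with j minimal.  Then the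
-- tree paths to its ends meet only in x and form with it an odd cycle K.
--
-- The edges of G fall into boundedly many classes: horizontal ones, and crossing ones sorted by the parity of the
-- lower level and by whether the lower end hangs off one fixed side of K, apart from at most 2n edges running into K.
-- One class has average degree at least 224k, and a component of it lives in a single pair of layers.
--
-- F: in a critical dense vertex set S the Moore bound forces |X ∪ ∂X| > 7|X| for |X| ≤ 2N.  Depth-first search yields a
-- stack and a set X with N ≤ |X| ≤ 2N whose neighbours outside X all lie on the stack; some vertex of X has two
-- neighbours deeper than 2N + 2 in the stack, which gives a long cycle and its chord.
--
-- Paths: by a lemma of Bondy and Simonovits, if a non-constant 2-colouring of F has no path of length ℓ < |F| with
-- ends of distinct colours, then ℓ is even and the colours alternate along F.
--
-- Let apex be the last common ancestor of the vertices of F on the upper layer and D the union of F and the tree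
-- paths from there to apex.  If F is horizontal, colour F by one branch at apex: odd paths of F close up to odd cycles.
-- Otherwise an ear of D that starts at apex, ends at some other q in D, and has the wrong parity is needed; colouring
-- F by the descendants of q then gives cycles of consecutive odd lengths.  If D meets K in more than apex, it
-- does so in a segment of one side of K starting at apex, and the rest of K contains the ear.  If not, 2-connectivity
-- provides an ear through two vertices of K, which can be rerouted along either arc of K.

open import Defs
open import Data.Nat using (ℕ; _+_; _*_; _∸_; _^_; _≤_; _<_; _/_)
open import Data.Product using (Σ; _×_)
open import Relation.Nullary using (¬_)

open import Data.Bool using (Bool; true; false; T; _∧_; not; _xor_; if_then_else_)
open import Data.Bool.Properties using (¬-not) renaming (_≟_ to _≟ᵇ_)
open import Data.Empty using (⊥; ⊥-elim)
open import Data.Fin as Fin using (Fin; toℕ; fromℕ; inject₁)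
open import Data.Fin.Properties as Finₚ using (any?; all?)
open import Data.List using (List; []; _∷_; _++_; length; [_]; take; drop) renaming (map to mapL)
open import Data.List.Membership.Propositional using (_∈_; _∉_; find; lose)
open import Data.List.Membership.Propositional.Properties using (∈-++⁺ˡ; ∈-++⁺ʳ; ∈-++⁻; ∈-∃++; ∈-insert)
open import Data.List.Properties using (length-++; ++-assoc; take++drop≡id; length-take; drop-all)
open import Data.List.Relation.Binary.Permutation.Propositional using (_↭_; ↭-refl; ↭-trans; ↭-sym; ↭⇒↭ₛ; prep; swap)
open import Data.List.Relation.Binary.Permutation.Propositional.Properties using (∈-resp-↭; ↭-length; ++-comm)
import Data.List.Relation.Binary.Permutation.Setoid.Properties as Permₛ
open import Data.List.Relation.Unary.All.Properties using (¬Any⇒All¬; All¬⇒¬Any)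
open import Data.List.Relation.Unary.AllPairs using ([]; _∷_)
open import Data.List.Relation.Unary.Any using (Any; here; there) renaming (any? to anyL?)
import Data.List.Relation.Unary.Any.Properties as Anyₚ
open import Data.List.Relation.Unary.Unique.Propositional using (Unique)
import Data.List.Relation.Unary.Unique.Propositional.Properties as Uniqueₚ
open import Data.Nat using (zero; suc; z≤n; s≤s; NonZero; >-nonZero; _<ᵇ_)
open import Data.Nat.DivMod using (_%_; m≡m%n+[m/n]*n; m%n<n; [m+kn]%n≡m%n; [m+n]%n≡m%n; m<n⇒m%n≡m; n%n≡0; /-monoˡ-≤; m/n*n≤m)
open import Data.Nat.Divisibility using (_∣_; divides; m∣m*n; ∣m+n∣m⇒∣n; ∣1⇒≡1; ∣⇒≤; ∣-trans)
open import Data.Nat.Induction using (<-wellFounded)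
open import Data.Nat.ListAction using () renaming (sum to sumL)
open import Data.Nat.Properties as ℕₚ hiding (_≟_)
open import Data.Nat.Solver using (module +-*-Solver)
open import Data.Product using (_,_; proj₁; proj₂; ∃)
open import Data.Sum using (_⊎_; inj₁; inj₂; [_,_]′)
open import Data.Unit using (tt)
open import Function using (_∘_; id)
open import Induction.WellFounded using (Acc; acc)
open import Relation.Binary.Definitions using (tri<; tri≈; tri>)
open import Relation.Binary.PropositionalEquality as ≡ using (_≡_; _≢_; refl; cong; cong₂; trans; subst)
open import Relation.Nullary using (Dec; yes; no)
open import Relation.Nullary.Decidable using (⌊_⌋; _×-dec_; _⊎-dec_; _→-dec_; ¬?; map′)
open import Relation.Unary using (Decidable)

-- A path of F of length ℓ with one end among the descendants of q and the other outside closes to a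
-- cycle whose length is ℓ plus a number that depends on q and the ear, but not on the path.
-- Prescribing ℓ = 1, 3, 5, ... or ℓ = 2, 4, 6, ... therefore gives consecutive lengths of one
-- parity, and |F| ≥ 2N + 2 leaves room for N of them. The obstacle is parity. If F lies between two
-- layers, then F and the tree paths together are bipartite, so the odd cycle K has to enter through
-- the ear: the lengths are odd exactly if the ear disagrees with the levels of its ends. K passes
-- through the root because j is minimal over all roots: seen from a nearer common ancestor of its
-- ends, the same edge would be horizontal at a smaller distance. Sorting the crossing edges by one
-- side of K keeps D off the other side, or off that one, except at the root; setting aside the
-- edges that run into K makes D meet K in tree vertices only.

BRel : ℕ → Set
BRel n = Fin n → Fin n → Bool

private variable
  n : ℕ
  A B : BRel n
  P Q : Fin n → Bool
  V : Set

-- Walks and cycles as vertex lists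

Symmetricᵇ : BRel n → Set
Symmetricᵇ A = ∀ {i j} → A i j ≡ true → A j i ≡ true

-- The list holds the first vertex and omits the last one, so its length is the number of edges
-- and a cycle is a Walk A u u xs with Unique xs.
data Walk {n} (A : BRel n) : Fin n → Fin n → List (Fin n) → Set where
  []  : ∀ {u} → Walk A u u []
  _∷_ : ∀ {u w v xs} → A u w ≡ true → Walk A w v xs → Walk A u v (u ∷ xs)

_++ʷ_ : ∀ {u v w xs ys} → Walk A u v xs → Walk A v w ys → Walk A u w (xs ++ ys)
[] ++ʷ q = q
(e ∷ p) ++ʷ q = e ∷ (p ++ʷ q)

mapʷ : (∀ {i j} → A i j ≡ true → B i j ≡ true) → ∀ {u v xs} → Walk A u v xs → Walk B u v xs
mapʷ f [] = []
mapʷ f (e ∷ p) = f e ∷ mapʷ f p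

splitʷ : ∀ {u v} xs {y ys} → Walk A u v (xs ++ y ∷ ys) → Walk A u y xs × Walk A y v (y ∷ ys)
splitʷ [] (e ∷ p) = [] , e ∷ p
splitʷ (x ∷ xs) (e ∷ p) with splitʷ xs p
... | q , r = e ∷ q , r

-- Reversal exchanges the omitted vertex, so the permutation relates the lists completed by their
-- last vertices; it carries uniqueness and membership over.
reverseʷ : Symmetricᵇ A → ∀ {u v xs} → Walk A u v xs →
           Σ (List (Fin _)) λ ys → Walk A v u ys × u ∷ ys ↭ v ∷ xs
reverseʷ s [] = [] , [] , ↭-refl
reverseʷ s {u} {v} (_∷_ {w = w} {xs = xs} e p) with reverseʷ s p
... | ys , q , σ = ys ++ [ w ] , q ++ʷ (s e ∷ []) ,
  ↭-trans (prep u (↭-trans (++-comm ys [ w ]) σ)) (swap u v ↭-refl)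

Unique-resp-↭ : {xs ys : List V} → xs ↭ ys → Unique xs → Unique ys
Unique-resp-↭ {V} σ = Permₛ.Unique-resp-↭ (≡.setoid V) (↭⇒↭ₛ σ)

Unique-∷ : {x : V} {xs : List V} → x ∉ xs → Unique xs → Unique (x ∷ xs)
Unique-∷ x∉ u = ¬Any⇒All¬ _ x∉ ∷ u

Unique-head : {x : V} {xs : List V} → Unique (x ∷ xs) → x ∉ xs
Unique-head (x∉ ∷ _) = All¬⇒¬Any x∉

Unique-tail : {x : V} {xs : List V} → Unique (x ∷ xs) → Unique xs
Unique-tail (_ ∷ u) = u

Unique-++ : {xs ys : List V} → Unique xs → Unique ys → (∀ {v} → v ∈ xs → v ∈ ys → ⊥) → Unique (xs ++ ys)
Unique-++ ux uy d = Uniqueₚ.++⁺ ux uy λ (a , b) → d a b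

Unique-++⁻ : (xs : List V) {ys : List V} → Unique (xs ++ ys) →
             Unique xs × Unique ys × (∀ {v} → v ∈ xs → v ∈ ys → ⊥)
Unique-++⁻ [] u = [] , u , λ ()
Unique-++⁻ (x ∷ xs) (x∉ ∷ u) with Unique-++⁻ xs u
... | ux , uy , d = Unique-∷ (λ m → All¬⇒¬Any x∉ (∈-++⁺ˡ m)) ux , uy ,
  λ { (here refl) m → All¬⇒¬Any x∉ (∈-++⁺ʳ xs m) ; (there k) m → d k m }

infix 4 _∈?_
_∈?_ : (v : Fin n) (xs : List (Fin n)) → Dec (v ∈ xs)
_∈?_ {n} = _∈ᵈ_
  where open import Data.List.Membership.DecPropositional (Fin._≟_ {n}) renaming (_∈?_ to _∈ᵈ_)

-- Uniqueness of `v ∷ ys` covers the omitted end too. If `u` recurs in the simplified rest,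
-- everything before that recurrence is cut off.
simplify : ∀ {u v xs} → Walk A u v xs →
           Σ (List (Fin _)) λ ys → Walk A u v ys × Unique (v ∷ ys) × (∀ {y} → y ∈ ys → y ∈ xs)
simplify [] = [] , [] , Unique-∷ (λ ()) [] , λ ()
simplify {u = u} {v = v} (e ∷ p) with simplify p
... | ys , q , uq , sub with u Fin.≟ v
... | yes refl = [] , [] , Unique-∷ (λ ()) [] , λ ()
... | no u≢v with u ∈? ys
... | no u∉ = u ∷ ys , e ∷ q ,
  Unique-∷ (λ { (here eq) → u≢v (≡.sym eq) ; (there m) → Unique-head uq m }) (Unique-∷ u∉ (Unique-tail uq)) ,
  λ { (here eq) → here eq ; (there m) → there (sub m) }
... | yes u∈ with ∈-∃++ u∈
... | as , bs , refl = u ∷ bs , proj₂ (splitʷ as q) ,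
  Unique-∷ (λ m → Unique-head uq (∈-++⁺ʳ as m)) (proj₁ (proj₂ (Unique-++⁻ as (Unique-tail uq)))) ,
  λ m → there (sub (∈-++⁺ʳ as m))

-- With the end of a walk as default, index `length xs` reads the vertex that the list omits, so
-- `nth-step` also covers the last edge.
nth : V → List V → ℕ → V
nth d [] i = d
nth d (x ∷ xs) zero = x
nth d (x ∷ xs) (suc i) = nth d xs i

nth-last : (d : V) (xs : List V) → nth d xs (length xs) ≡ d
nth-last d [] = refl
nth-last d (x ∷ xs) = nth-last d xs

nth-∈ : (d : V) (xs : List V) {i : ℕ} → i < length xs → nth d xs i ∈ xs
nth-∈ d (x ∷ xs) {zero} _ = here refl
nth-∈ d (x ∷ xs) {suc i} (s≤s l) = there (nth-∈ d xs l)

∈-nth : (d : V) {x : V} {xs : List V} → x ∈ xs → ∃ λ i → i < length xs × nth d xs i ≡ x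
∈-nth d (here refl) = 0 , s≤s z≤n , refl
∈-nth d (there m) with ∈-nth d m
... | i , l , eq = suc i , s≤s l , eq

nth-injective : (d : V) {xs : List V} → Unique xs → ∀ {i j} → i < length xs → j < length xs →
                nth d xs i ≡ nth d xs j → i ≡ j
nth-injective d {x ∷ xs} u {zero} {zero} _ _ _ = refl
nth-injective d {x ∷ xs} u {zero} {suc j} _ (s≤s lj) eq = ⊥-elim (Unique-head u (subst (_∈ xs) (≡.sym eq) (nth-∈ d xs lj)))
nth-injective d {x ∷ xs} u {suc i} {zero} (s≤s li) _ eq = ⊥-elim (Unique-head u (subst (_∈ xs) eq (nth-∈ d xs li)))
nth-injective d {x ∷ xs} u {suc i} {suc j} (s≤s li) (s≤s lj) eq = cong suc (nth-injective d (Unique-tail u) li lj eq)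

nth-step : ∀ {u v xs} → Walk A u v xs → ∀ {i} → i < length xs → A (nth v xs i) (nth v xs (suc i)) ≡ true
nth-step (e ∷ []) {zero} _ = e
nth-step (e ∷ (f ∷ p)) {zero} _ = e
nth-step (e ∷ p) {suc i} (s≤s l) = nth-step p l

nth-head : ∀ {u v xs} → Walk A u v xs → nth v xs 0 ≡ u
nth-head [] = refl
nth-head (_ ∷ _) = refl

cycle : (G : Graph n) → ∀ {u xs} → Walk (adj G) u u xs → Unique xs → 3 ≤ length xs → HasCycle G (length xs)
cycle G {u} {xs@(_ ∷ _ ∷ _ ∷ r)} w uq (s≤s (s≤s (s≤s _))) = length r , refl , record
  { vtx = λ i → nth u xs (toℕ i)
  ; inj = λ {i} {j} eq → Finₚ.toℕ-injective (nth-injective u uq (Finₚ.toℕ<n i) (Finₚ.toℕ<n j) eq)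
  ; step = λ i → subst (λ k → Adj G (nth u xs k) (nth u xs (suc (toℕ i)))) (≡.sym (Finₚ.toℕ-inject₁ i))
             (nth-step w (ℕₚ.m≤n⇒m≤1+n (Finₚ.toℕ<n i)))
  ; close = subst (λ k → Adj G (nth u xs k) (nth u xs 0)) (≡.sym (Finₚ.toℕ-fromℕ (2 + length r)))
             (subst (λ z → Adj G (nth u xs (2 + length r)) z) (trans (nth-last u xs) (≡.sym (nth-head w)))
               (nth-step w ≤-refl)) }

-- Exhaustive search over finite function spaces

module _ {C : Set} (search : ∀ {P : C → Set} → Decidable P → Dec (∃ P)) where
  private
    cons : ∀ {k} → C → (Fin k → C) → Fin (suc k) → C
    cons a f Fin.zero = a
    cons a f (Fin.suc i) = f i

  -- `P` has to respect pointwise equality because, without extensionality, a function reassembled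
  -- from its values need not equal the original.
  anyFunction? : ∀ k {P : (Fin k → C) → Set} → (∀ {f g} → (∀ i → f i ≡ g i) → P f → P g) →
                 Decidable P → Dec (∃ P)
  anyFunction? zero resp P? with P? (λ ())
  ... | yes p = yes (_ , p)
  ... | no ¬p = no λ (f , p) → ¬p (resp (λ ()) p)
  anyFunction? (suc k) {P} resp P? with search (λ a → anyFunction? k {λ f → P (cons a f)}
      (λ eq → resp λ { Fin.zero → refl ; (Fin.suc i) → eq i }) (λ f → P? (cons a f)))
  ... | yes (a , f , p) = yes (_ , p)
  ... | no ¬p = no λ (f , p) → ¬p (f Fin.zero , f ∘ Fin.suc , resp (λ { Fin.zero → refl ; (Fin.suc i) → refl }) p)

module _ (G : Graph n) where
  -- Makes proof by contradiction available: the colouring arguments refute the absence of a cycle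
  -- of a given length.
  hasCycle? : Decidable (HasCycle G)
  hasCycle? (suc (suc (suc m))) = map′
    (λ (f , i , s , c) → m , refl , record { vtx = f ; inj = λ {a} {b} → i a b ; step = s ; close = c })
    (λ { (_ , refl , c) → Cycle.vtx c , (λ a b → Cycle.inj c) , Cycle.step c , Cycle.close c })
    (anyFunction? any? (3 + m)
      (λ eq (i , s , c) → (λ a b e → i a b (trans (eq a) (trans e (≡.sym (eq b))))) ,
        (λ a → ≡.subst₂ (Adj G) (eq _) (eq _) (s a)) , ≡.subst₂ (Adj G) (eq _) (eq _) c)
      (λ f → all? (λ a → all? λ b → (f a Fin.≟ f b) →-dec (a Fin.≟ b)) ×-dec
             (all? λ i → adj G (f (inject₁ i)) (f (Fin.suc i)) ≟ᵇ true) ×-dec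
             (adj G (f (fromℕ (2 + m))) (f Fin.zero) ≟ᵇ true)))
  hasCycle? 0 = no λ ()
  hasCycle? 1 = no λ ()
  hasCycle? 2 = no λ ()

-- Counting

⌊⌋-sound : {P : Set} (d : Dec P) → ⌊ d ⌋ ≡ true → P
⌊⌋-sound (yes p) _ = p

⌊⌋-complete : {P : Set} (d : Dec P) → P → ⌊ d ⌋ ≡ true
⌊⌋-complete (yes _) _ = refl
⌊⌋-complete (no ¬p) p = ⊥-elim (¬p p)

∧-intro : ∀ {a b} → a ≡ true → b ≡ true → a ∧ b ≡ true
∧-intro refl refl = refl

∧-elim : ∀ {a b} → a ∧ b ≡ true → a ≡ true × b ≡ true
∧-elim {true} {true} _ = refl , refl

≢true : ∀ {b} → b ≢ true → b ≡ false
≢true {false} _ = refl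
≢true {true} ne = ⊥-elim (ne refl)

⟦_⟧ : Bool → ℕ
⟦ b ⟧ = if b then 1 else 0

⟦⟧≤1 : ∀ b → ⟦ b ⟧ ≤ 1
⟦⟧≤1 true = ≤-refl
⟦⟧≤1 false = z≤n

⟦⟧-mono : ∀ {a b} → (a ≡ true → b ≡ true) → ⟦ a ⟧ ≤ ⟦ b ⟧
⟦⟧-mono {false} _ = z≤n
⟦⟧-mono {true} f rewrite f refl = ≤-refl

⟦⟧-union : ∀ {a b c} → (a ≡ true → b ≡ true ⊎ c ≡ true) → ⟦ a ⟧ ≤ ⟦ b ⟧ + ⟦ c ⟧
⟦⟧-union {false} _ = z≤n
⟦⟧-union {true} f with f refl
... | inj₁ refl = s≤s z≤n
... | inj₂ refl = m≤n+m _ _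

sum-mono : {f g : Fin n → ℕ} → (∀ i → f i ≤ g i) → sumFin f ≤ sumFin g
sum-mono {zero} _ = z≤n
sum-mono {suc n} h = +-mono-≤ (h Fin.zero) (sum-mono (h ∘ Fin.suc))

sum-+ : (f g : Fin n → ℕ) → sumFin (λ i → f i + g i) ≡ sumFin f + sumFin g
sum-+ {zero} f g = refl
sum-+ {suc n} f g rewrite sum-+ (f ∘ Fin.suc) (g ∘ Fin.suc) =
  solve 4 (λ a b c d → a :+ b :+ (c :+ d) := a :+ c :+ (b :+ d)) refl (f Fin.zero) (g Fin.zero) _ _
  where open +-*-Solver

sum-const : ∀ n c → sumFin {n} (λ _ → c) ≡ c * n
sum-const zero c = ≡.sym (*-zeroʳ c)
sum-const (suc n) c rewrite sum-const n c = ≡.sym (*-suc c n)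

sum-* : (c : ℕ) (f : Fin n → ℕ) → sumFin (λ i → c * f i) ≡ c * sumFin f
sum-* {zero} c f = ≡.sym (*-zeroʳ c)
sum-* {suc n} c f rewrite sum-* c (f ∘ Fin.suc) = ≡.sym (*-distribˡ-+ c _ _)

sum-swap : ∀ {n m} (f : Fin n → Fin m → ℕ) →
           sumFin (λ i → sumFin (f i)) ≡ sumFin (λ j → sumFin (λ i → f i j))
sum-swap {zero} {m} f = ≡.sym (sum-const m 0)
sum-swap {suc n} f rewrite sum-swap (f ∘ Fin.suc) = ≡.sym (sum-+ (f Fin.zero) _)

count : (Fin n → Bool) → ℕ
count P = sumFin λ i → ⟦ P i ⟧

-- Ordered pairs are counted, so `β * count S ≤ count₂ (restrict S A)` bounds the average degree of
-- a graph `A` on `S` below by `β`.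
count₂ : BRel n → ℕ
count₂ R = sumFin λ i → count (R i)

count-mono : (∀ i → P i ≡ true → Q i ≡ true) → count P ≤ count Q
count-mono h = sum-mono λ i → ⟦⟧-mono (h i)

count-union : ∀ {R} → (∀ i → R i ≡ true → P i ≡ true ⊎ Q i ≡ true) → count R ≤ count P + count Q
count-union {P = P} {Q = Q} h = ≤-trans (sum-mono λ i → ⟦⟧-union (h i)) (≤-reflexive (sum-+ (λ i → ⟦ P i ⟧) (λ i → ⟦ Q i ⟧)))

count₂-mono : (∀ i j → A i j ≡ true → B i j ≡ true) → count₂ A ≤ count₂ B
count₂-mono h = sum-mono λ i → count-mono (h i)

count₂-union : ∀ {R} → (∀ i j → R i j ≡ true → A i j ≡ true ⊎ B i j ≡ true) → count₂ R ≤ count₂ A + count₂ B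
count₂-union {A = A} {B = B} h = ≤-trans (sum-mono λ i → count-union (h i)) (≤-reflexive (sum-+ (count ∘ A) (count ∘ B)))

count₂-transpose : (A : BRel n) → count₂ (λ i j → A j i) ≡ count₂ A
count₂-transpose A = ≡.sym (sum-swap λ i j → ⟦ A i j ⟧)

count-none : (∀ i → P i ≢ true) → count P ≡ 0
count-none {zero} _ = refl
count-none {suc n} h rewrite ≢true (h Fin.zero) = count-none (h ∘ Fin.suc)

count-unique : (∀ i j → P i ≡ true → P j ≡ true → i ≡ j) → count P ≤ 1
count-unique {zero} _ = z≤n
count-unique {suc n} {P} h with P Fin.zero ≟ᵇ true
... | yes p rewrite p = s≤s (≤-reflexive (count-none λ i q → case (h Fin.zero (Fin.suc i) p q)))
  where
  case : ∀ {i} → Fin.zero ≡ Fin.suc i → ⊥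
  case ()
... | no ¬p rewrite ≢true ¬p = count-unique λ i j a b → Finₚ.suc-injective (h (Fin.suc i) (Fin.suc j) a b)

count-∈ : (xs : List (Fin n)) → count (λ v → ⌊ v ∈? xs ⌋) ≤ length xs
count-∈ {n} [] = ≤-reflexive (count-none {P = λ v → ⌊ v ∈? [] ⌋} λ v e → case (⌊⌋-sound (v ∈? []) e))
  where
  case : ∀ {v : Fin n} → v ∈ [] → ⊥
  case ()
count-∈ (x ∷ xs) = ≤-trans (count-union {P = λ v → ⌊ v Fin.≟ x ⌋} {Q = λ v → ⌊ v ∈? xs ⌋} split)
  (+-mono-≤ (count-unique λ i j a b → trans (⌊⌋-sound (i Fin.≟ x) a) (≡.sym (⌊⌋-sound (j Fin.≟ x) b))) (count-∈ xs))
  where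
  split : ∀ v → ⌊ v ∈? (x ∷ xs) ⌋ ≡ true → ⌊ v Fin.≟ x ⌋ ≡ true ⊎ ⌊ v ∈? xs ⌋ ≡ true
  split v e with ⌊⌋-sound (v ∈? (x ∷ xs)) e
  ... | here eq = inj₁ (⌊⌋-complete (v Fin.≟ x) eq)
  ... | there m = inj₂ (⌊⌋-complete (v ∈? xs) m)

count-pos : ∀ v → P v ≡ true → 1 ≤ count P
count-pos Fin.zero p rewrite p = s≤s z≤n
count-pos (Fin.suc v) p = ≤-trans (count-pos v p) (m≤n+m _ _)

count-∃ : 1 ≤ count P → ∃ λ v → P v ≡ true
count-∃ {P = P} l with any? (λ v → P v ≟ᵇ true)
... | yes r = r
... | no ¬r = ⊥-elim (<⇒≢ l (≡.sym (count-none λ i p → ¬r (i , p))))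

count-disjoint : ∀ {R} → (∀ i → P i ≡ true → R i ≡ true) → (∀ i → Q i ≡ true → R i ≡ true) →
                 (∀ i → P i ≡ true → Q i ≡ true → ⊥) → count P + count Q ≤ count R
count-disjoint {P = P} {Q = Q} {R} p q d = ≤-trans (≤-reflexive (≡.sym (sum-+ (λ i → ⟦ P i ⟧) (λ i → ⟦ Q i ⟧))))
  (sum-mono λ i → aux (P i) (Q i) (R i) (p i) (q i) (d i))
  where
  aux : ∀ a b c → (a ≡ true → c ≡ true) → (b ≡ true → c ≡ true) → (a ≡ true → b ≡ true → ⊥) → ⟦ a ⟧ + ⟦ b ⟧ ≤ ⟦ c ⟧
  aux true true c _ _ d = ⊥-elim (d refl refl)
  aux true false c p _ _ rewrite p refl = ≤-refl
  aux false true c _ q _ rewrite q refl = ≤-refl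
  aux false false c _ _ _ = z≤n

count-strict : ∀ v → (∀ i → P i ≡ true → Q i ≡ true) → Q v ≡ true → P v ≢ true → count P < count Q
count-strict {P = P} {Q = Q} v sub q ¬p = ≤-trans
  (+-monoˡ-≤ (count P) (count-pos {P = λ i → ⌊ i Fin.≟ v ⌋} v (⌊⌋-complete (v Fin.≟ v) refl)))
  (count-disjoint {P = λ i → ⌊ i Fin.≟ v ⌋}
    (λ i e → subst (λ z → Q z ≡ true) (≡.sym (⌊⌋-sound (i Fin.≟ v) e)) q) sub
    λ i e p → ¬p (subst (λ z → P z ≡ true) (⌊⌋-sound (i Fin.≟ v) e) p))

count≤n : (P : Fin n → Bool) → count P ≤ n
count≤n P = ≤-trans (sum-mono λ i → ⟦⟧≤1 (P i)) (≤-reflexive (trans (sum-const _ 1) (*-identityˡ _)))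

infixl 6 _∖_
_∖_ : (Fin n → Bool) → (Fin n → Bool) → Fin n → Bool
(P ∖ Q) v = P v ∧ not (Q v)

∖-intro : ∀ v → P v ≡ true → Q v ≢ true → (P ∖ Q) v ≡ true
∖-intro v p ¬q rewrite p | ≢true ¬q = refl

∖-elim : ∀ v → (P ∖ Q) v ≡ true → P v ≡ true × Q v ≢ true
∖-elim {P = P} {Q = Q} v e with P v | Q v
... | true | false = refl , λ ()

restrict : (Fin n → Bool) → BRel n → BRel n
restrict S A i j = S i ∧ (S j ∧ A i j)

restrict-intro : ∀ S (A : BRel n) {i j} → S i ≡ true → S j ≡ true → A i j ≡ true → restrict S A i j ≡ true
restrict-intro S A a b c = ∧-intro a (∧-intro b c)

restrict-elim : ∀ S (A : BRel n) {i j} → restrict S A i j ≡ true → S i ≡ true × S j ≡ true × A i j ≡ true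
restrict-elim S A e with ∧-elim e
... | a , e' with ∧-elim e'
... | b , c = a , b , c

restrict-sym : Symmetricᵇ A → ∀ S → Symmetricᵇ (restrict S A)
restrict-sym {A = A} s S e with restrict-elim S A e
... | a , b , c = restrict-intro S A b a (s c)

anySet? : {P : (Fin n → Bool) → Set} → (∀ {f g} → (∀ i → f i ≡ g i) → P f → P g) → Decidable P → Dec (∃ P)
anySet? = anyFunction? search _
  where
  search : ∀ {P : Bool → Set} → Decidable P → Dec (∃ P)
  search P? with P? true | P? false
  ... | yes p | _ = yes (true , p)
  ... | no _ | yes p = yes (false , p)
  ... | no ¬p | no ¬q = no λ { (true , p) → ¬p p ; (false , q) → ¬q q }

Nonempty : (Fin n → Bool) → Set
Nonempty S = ∃ λ v → S v ≡ true

-- At least `β * count X` ordered edges inside `S` have an end in `X`; the sum avoids a truncated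
-- difference.
Critical : BRel n → ℕ → (Fin n → Bool) → Set
Critical A β S = ∀ X → Nonempty X → (∀ v → X v ≡ true → S v ≡ true) →
  β * count X + count₂ (restrict (S ∖ X) A) ≤ count₂ (restrict S A)

-- A vertex set that is minimal among those of (ordered) edge density at least β is critical.
critical-subset : (A : BRel n) (β : ℕ) (W : Fin n → Bool) → Nonempty W →
  β * count W ≤ count₂ (restrict W A) →
  Σ (Fin n → Bool) λ S → (∀ v → S v ≡ true → W v ≡ true) × Nonempty S × Critical A β S
critical-subset {n} A β W = go W (<-wellFounded (count W))
  where
  Smaller : (Fin n → Bool) → (Fin n → Bool) → Set
  Smaller W T = (∀ v → T v ≡ true → W v ≡ true) × Nonempty T × (∃ λ v → W v ≡ true × T v ≢ true) ×
    β * count T ≤ count₂ (restrict T A)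
  smaller? : ∀ W → Decidable (Smaller W)
  smaller? W T = (all? λ v → (T v ≟ᵇ true) →-dec (W v ≟ᵇ true)) ×-dec (any? λ v → T v ≟ᵇ true) ×-dec
    (any? λ v → (W v ≟ᵇ true) ×-dec ¬? (T v ≟ᵇ true)) ×-dec (β * count T ≤? count₂ (restrict T A))
  resp : ∀ {W f g} → (∀ i → f i ≡ g i) → Smaller W f → Smaller W g
  resp {W} {f} {g} eq (s , (u , fu) , (v , wv , fv) , d) =
    (λ w e → s w (trans (eq w) e)) , (u , trans (≡.sym (eq u)) fu) , (v , wv , λ e → fv (trans (eq v) e)) ,
    ≤-trans (*-monoʳ-≤ β (count-mono λ i e → trans (eq i) e))
      (≤-trans d (count₂-mono λ i j e → case i j (restrict-elim f A e)))
    where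
    case : ∀ i j → f i ≡ true × f j ≡ true × A i j ≡ true → restrict g A i j ≡ true
    case i j (a , b , c) = restrict-intro g A (trans (≡.sym (eq i)) a) (trans (≡.sym (eq j)) b) c
  go : ∀ W → Acc _<_ (count W) → Nonempty W → β * count W ≤ count₂ (restrict W A) →
    Σ (Fin n → Bool) λ S → (∀ v → S v ≡ true → W v ≡ true) × Nonempty S × Critical A β S
  go W (acc rec) ne dense with anySet? {P = Smaller W} resp (smaller? W)
  ... | yes (T , sub , neT , (v , wv , tv) , dT) with go T (rec (count-strict v sub wv tv)) neT dT
  ...  | S , sub' , r = S , (λ u e → sub u (sub' u e)) , r
  -- By minimality `W ∖ X` has density at most `β`, also when it is empty, so at least `β * count X`
  -- ordered edges are lost with `X`.
  go W (acc rec) ne dense | no none = W , (λ _ e → e) , ne , λ X (x , Xx) sub → begin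
      β * count X + count₂ (restrict (W ∖ X) A) ≤⟨ +-monoʳ-≤ (β * count X) (sparse X x (sub x Xx) Xx) ⟩
      β * count X + β * count (W ∖ X)  ≡⟨ *-distribˡ-+ β (count X) (count (W ∖ X)) ⟨
      β * (count X + count (W ∖ X))  ≤⟨ *-monoʳ-≤ β (count-disjoint sub (λ i e → proj₁ (out X i e)) (λ i a b → proj₂ (out X i b) a)) ⟩
      β * count W  ≤⟨ dense ⟩
      count₂ (restrict W A)  ∎
    where
    open ≤-Reasoning
    out : ∀ X v → (W ∖ X) v ≡ true → W v ≡ true × X v ≢ true
    out X = ∖-elim {P = W} {Q = X}
    sparse : ∀ X x → W x ≡ true → X x ≡ true → count₂ (restrict (W ∖ X) A) ≤ β * count (W ∖ X)
    sparse X x Wx Xx with β * count (W ∖ X) ≤? count₂ (restrict (W ∖ X) A) | any? (λ v → (W ∖ X) v ≟ᵇ true)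
    ... | no ¬d | _ = <⇒≤ (≰⇒> ¬d)
    ... | yes d | yes neT = ⊥-elim (none (W ∖ X , (λ v e → proj₁ (out X v e)) , neT ,
                                          (x , Wx , λ e → proj₂ (out X x e) Xx) , d))
    ... | yes d | no empty = ≤-trans (sum-mono λ i → ≤-reflexive (count-none {P = restrict (W ∖ X) A i} λ j e →
      empty (i , proj₁ (restrict-elim (W ∖ X) A {i} {j} e)))) (≤-trans (≤-reflexive (sum-const n 0)) z≤n)

-- Breadth-first search trees

least : {P : ℕ → Set} → Decidable P → ∀ {m} → P m → ∃ λ k → k ≤ m × P k × (∀ {j} → j < k → ¬ P j)
least P? {m} p with P? 0
... | yes p₀ = 0 , z≤n , p₀ , λ ()
least P? {zero} p | no ¬p₀ = ⊥-elim (¬p₀ p)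
least {P} P? {suc m} p | no ¬p₀ with least (P? ∘ suc) p
... | k , k≤m , pk , min = suc k , s≤s k≤m , pk , λ { {zero} _ q → ¬p₀ q ; {suc j} (s≤s l) q → min l q }

component : (A : BRel n) (x : Fin n) → Σ (Fin n → Bool) λ Z → Z x ≡ true ×
  (∀ {u v} → Z u ≡ true → A u v ≡ true → Z v ≡ true) ×
  (∀ v → Z v ≡ true → Σ (List (Fin n)) λ xs → Walk A x v xs)
component {n} A x = go (λ v → ⌊ v Fin.≟ x ⌋) (<-wellFounded _) (⌊⌋-complete (x Fin.≟ x) refl)
    λ v e → [] , subst (λ z → Walk A x z []) (≡.sym (⌊⌋-sound (v Fin.≟ x) e)) []
  where
  go : ∀ Z → Acc _<_ (n ∸ count Z) → Z x ≡ true → (∀ v → Z v ≡ true → Σ (List (Fin n)) λ xs → Walk A x v xs) →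
    Σ (Fin n → Bool) λ Z → Z x ≡ true × (∀ {u v} → Z u ≡ true → A u v ≡ true → Z v ≡ true) ×
    (∀ v → Z v ≡ true → Σ (List (Fin n)) λ xs → Walk A x v xs)
  go Z (acc rec) Zx sound
    with any? (λ u → any? λ v → (Z u ≟ᵇ true) ×-dec (A u v ≟ᵇ true) ×-dec ¬? (Z v ≟ᵇ true))
  ... | no closed = Z , Zx , (λ {u} {v} Zu e → [ id , (λ ¬Zv → ⊥-elim (closed (u , v , Zu , e , ¬Zv))) ]′ (dec v)) , sound
    where
    dec : ∀ v → Z v ≡ true ⊎ Z v ≢ true
    dec v with Z v ≟ᵇ true
    ... | yes p = inj₁ p
    ... | no ¬p = inj₂ ¬p
  ... | yes (u , v , Zu , e , ¬Zv) = go Z′ (rec (∸-monoʳ-< (count-strict {P = Z} {Q = Z′} v (λ i p → ⌊⌋-complete (Z′? i) (inj₁ p)) (⌊⌋-complete (Z′? v) (inj₂ refl)) ¬Zv) (count≤n Z′)))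
      (⌊⌋-complete (Z′? x) (inj₁ Zx)) λ w p → sound′ w (⌊⌋-sound (Z′? w) p)
    where
    Z′? : ∀ w → Dec (Z w ≡ true ⊎ w ≡ v)
    Z′? w = (Z w ≟ᵇ true) ⊎-dec (w Fin.≟ v)
    Z′ : Fin n → Bool
    Z′ w = ⌊ Z′? w ⌋
    sound′ : ∀ w → Z w ≡ true ⊎ w ≡ v → Σ (List (Fin n)) λ xs → Walk A x w xs
    sound′ w (inj₁ p) = sound w p
    sound′ w (inj₂ refl) = _ , proj₂ (sound u Zu) ++ʷ (e ∷ [])

-- Vertices outside Z are given level 0, so that only lev-zero needs to mention Z.
record BFS {n} (A : BRel n) (Z : Fin n → Bool) (x : Fin n) : Set where
  field
    lev  : Fin n → ℕ
    par  : Fin n → Fin n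
    lip  : ∀ {u v} → A u v ≡ true → lev v ≤ suc (lev u)
    par-adj  : ∀ {v m} → lev v ≡ suc m → A v (par v) ≡ true
    par-lev  : ∀ {v m} → lev v ≡ suc m → lev (par v) ≡ m
    lev-root : lev x ≡ 0
    lev-zero : ∀ {v} → Z v ≡ true → lev v ≡ 0 → v ≡ x
    closed  : ∀ {u v} → Z u ≡ true → A u v ≡ true → Z v ≡ true

bfs : Symmetricᵇ A → (Z : Fin n → Bool) (x : Fin n) →
      (∀ {u v} → Z u ≡ true → A u v ≡ true → Z v ≡ true) →
      (∀ v → Z v ≡ true → Σ (List (Fin n)) λ xs → Walk A v x xs) → Z x ≡ true → BFS A Z x
bfs {n = n} {A = A} sy Z x closed reach Zx = record
  { lev = λ v → lev v (info v) ; par = λ v → par v (info v)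
  ; lip = λ {u} {v} → lip u v (info u) (info v)
  ; par-adj = λ {v} → par-adj v (info v)
  ; par-lev = λ {v} → par-lev v (info v)
  ; lev-root = lev-root (info x)
  ; lev-zero = λ {v} → lev-zero v (info v)
  ; closed = closed }
  where
  -- `R L v`: a walk of exactly `L` edges leads from `v` to `x`. The parent is the first step of a
  -- shortest one.
  R : ℕ → Fin n → Set
  R zero v = v ≡ x
  R (suc L) v = ∃ λ u → A v u ≡ true × R L u
  R? : ∀ v → Decidable (λ L → R L v)
  R? v zero = v Fin.≟ x
  R? v (suc L) = any? λ u → (A v u ≟ᵇ true) ×-dec R? u L
  walkR : ∀ {v xs} → Walk A v x xs → R (length xs) v
  walkR [] = refl
  walkR (e ∷ p) = _ , e , walkR p
  Info : Fin n → Set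
  Info v = (Z v ≡ true × ∃ λ L → R L v × (∀ {j} → j < L → ¬ R j v)) ⊎ (Z v ≢ true)
  info : ∀ v → Info v
  info v with Z v ≟ᵇ true
  ... | no ¬z = inj₂ ¬z
  ... | yes z with least (R? v) (walkR (proj₂ (reach v z)))
  ...  | L , _ , r , m = inj₁ (z , L , r , m)
  lev : ∀ v → Info v → ℕ
  lev v (inj₁ (_ , L , _)) = L
  lev v (inj₂ _) = 0
  par : ∀ v → Info v → Fin n
  par v (inj₁ (_ , suc L , (u , _) , _)) = u
  par v _ = v
  lip : ∀ u v (a : Info u) (b : Info v) → A u v ≡ true → lev v b ≤ suc (lev u a)
  lip u v (inj₁ (zu , L , r , _)) (inj₁ (zv , M , _ , m)) e = ≮⇒≥ λ l → m l (u , sy e , r)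
  lip u v _ (inj₂ _) e = z≤n
  lip u v (inj₂ ¬zu) (inj₁ (zv , _)) e = ⊥-elim (¬zu (closed zv (sy e)))
  par-adj : ∀ v (a : Info v) {m} → lev v a ≡ suc m → A v (par v a) ≡ true
  par-adj v (inj₁ (_ , suc L , (u , e , _) , _)) _ = e
  par-lev : ∀ v (a : Info v) {m} → lev v a ≡ suc m → lev (par v a) (info (par v a)) ≡ m
  par-lev v (inj₁ (z , suc L , (u , e , r) , min)) refl = ≤-antisym (below (info u)) (≤-pred (lip u v (info u) (inj₁ (z , suc L , (u , e , r) , min)) (sy e)))
    where
    below : (b : Info u) → lev u b ≤ L
    below (inj₁ (_ , _ , _ , m)) = ≮⇒≥ λ l → m l r
    below (inj₂ _) = z≤n
  lev-root : (a : Info x) → lev x a ≡ 0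
  lev-root (inj₁ (_ , zero , _)) = refl
  lev-root (inj₁ (_ , suc L , _ , m)) = ⊥-elim (m (s≤s z≤n) refl)
  lev-root (inj₂ _) = refl
  lev-zero : ∀ v (a : Info v) → Z v ≡ true → lev v a ≡ 0 → v ≡ x
  lev-zero v (inj₁ (_ , zero , r , _)) _ _ = r
  lev-zero v (inj₂ ¬z) z _ = ⊥-elim (¬z z)

module Tree {n} {A : BRel n} {Z x} (sy : Symmetricᵇ A) (T : BFS A Z x) where
  open BFS T public

  anc : ℕ → Fin n → Fin n
  anc zero v = v
  anc (suc t) v = anc t (par v)

  anc-+ : ∀ s t v → anc (s + t) v ≡ anc t (anc s v)
  anc-+ zero t v = refl
  anc-+ (suc s) t v = anc-+ s t (par v)

  anc-suc : ∀ t v → anc (suc t) v ≡ par (anc t v)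
  anc-suc zero v = refl
  anc-suc (suc t) v = anc-suc t (par v)

  lev-anc : ∀ t {v m} → lev v ≡ t + m → lev (anc t v) ≡ m
  lev-anc zero e = e
  lev-anc (suc t) e = lev-anc t (par-lev e)

  lev-anc≤ : ∀ {t v} → t ≤ lev v → lev (anc t v) ≡ lev v ∸ t
  lev-anc≤ {t} l = lev-anc t (≡.sym (m+[n∸m]≡n l))

  lev-anc+ : ∀ {t v} → t ≤ lev v → lev (anc t v) + t ≡ lev v
  lev-anc+ {t} {v} l = trans (cong (_+ t) (lev-anc≤ l)) (m∸n+n≡m l)

  anc-root : ∀ i {v} → Z v ≡ true → lev v ≡ i → anc i v ≡ x
  anc-root zero z e = lev-zero z e
  anc-root (suc i) z e = anc-root i (closed z (par-adj e)) (par-lev e)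

  anc-level : ∀ {s t u v} → s ≤ lev u → t ≤ lev v → lev u ≡ lev v → anc s u ≡ anc t v → s ≡ t
  anc-level {s} {t} {u} {v} s≤ t≤ l e = +-cancelˡ-≡ (lev (anc t v)) s t
    (trans (cong (λ z → lev z + s) (≡.sym e)) (trans (lev-anc+ s≤) (trans l (≡.sym (lev-anc+ t≤)))))

  -- Both follow the list convention of `Walk`: `up` omits the ancestor at which it ends, `down`
  -- begins with the ancestor and omits `v`.
  up : ℕ → Fin n → List (Fin n)
  up zero v = []
  up (suc t) v = v ∷ up t (par v)

  down : ℕ → Fin n → List (Fin n)
  down zero v = []
  down (suc t) v = down t (par v) ++ [ par v ]

  length-up : ∀ t v → length (up t v) ≡ t
  length-up zero v = refl
  length-up (suc t) v = cong suc (length-up t (par v))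

  length-down : ∀ t v → length (down t v) ≡ t
  length-down zero v = refl
  length-down (suc t) v = trans (length-++ (down t (par v))) (trans (+-comm _ 1) (cong suc (length-down t (par v))))

  upʷ : ∀ t {v} → t ≤ lev v → Walk A v (anc t v) (up t v)
  upʷ zero _ = []
  upʷ (suc t) {v} l with lev v in e
  ... | suc m = par-adj e ∷ upʷ t (subst (t ≤_) (≡.sym (par-lev e)) (≤-pred l))

  downʷ : ∀ t {v} → t ≤ lev v → Walk A (anc t v) v (down t v)
  downʷ zero _ = []
  downʷ (suc t) {v} l with lev v in e
  ... | suc m = downʷ t (subst (t ≤_) (≡.sym (par-lev e)) (≤-pred l)) ++ʷ (sy (par-adj e) ∷ [])

  ∈-up : ∀ t {v y} → y ∈ up t v → ∃ λ s → s < t × y ≡ anc s v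
  ∈-up (suc t) (here e) = 0 , s≤s z≤n , e
  ∈-up (suc t) (there m) with ∈-up t m
  ... | s , l , e = suc s , s≤s l , e

  ∈-down : ∀ t {v y} → y ∈ down t v → ∃ λ s → s < t × y ≡ anc (suc s) v
  ∈-down (suc t) {v} m with ∈-++⁻ (down t (par v)) m
  ... | inj₂ (here e) = 0 , s≤s z≤n , e
  ... | inj₁ m′ with ∈-down t m′
  ...  | s , l , e = suc s , s≤s l , e

  up-Unique : ∀ t {v} → t ≤ lev v → Unique (up t v)
  up-Unique zero _ = []
  up-Unique (suc t) {v} l = Unique-∷ fresh (up-Unique t l′)
    where
    l′ : t ≤ lev (par v)
    l′ = subst (t ≤_) (≡.sym (lev-anc≤ {1} (≤-trans (s≤s z≤n) l))) (∸-monoˡ-≤ 1 l)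
    fresh : v ∉ up t (par v)
    fresh m with ∈-up t m
    ... | s , s<t , e with anc-level {0} {suc s} z≤n (≤-trans (m≤n⇒m≤1+n s<t) l) refl e
    ...  | ()

  down-Unique : ∀ t {v} → t ≤ lev v → Unique (down t v)
  down-Unique zero _ = []
  down-Unique (suc t) {v} l = Unique-++ (down-Unique t l′) (Unique-∷ (λ ()) []) λ { m (here refl) → fresh m }
    where
    l′ : t ≤ lev (par v)
    l′ = subst (t ≤_) (≡.sym (lev-anc≤ {1} (≤-trans (s≤s z≤n) l))) (∸-monoˡ-≤ 1 l)
    fresh : par v ∉ down t (par v)
    fresh m with ∈-down t m
    ... | s , s<t , e with anc-level {0} {suc s} z≤n (≤-trans s<t l′) refl e
    ...  | ()

  -- The tree paths to the first common ancestor use levels up to `i` only, where `rs` has no vertex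
  -- but `u`; the least height `h` makes them disjoint. This turns a horizontal edge or a second
  -- parent near the root into a short cycle.
  tree-cycle : ∀ {u v i rs} → Z u ≡ true → Z v ≡ true → u ≢ v → lev u ≡ i → lev v ≡ i →
    Walk A u v rs → Unique rs → (∀ {y} → y ∈ rs → y ≡ u ⊎ i < lev y) →
    Σ (List (Fin n)) λ xs → Walk A v v xs × Unique xs × 3 ≤ length xs × length xs ≤ i + i + length rs
  tree-cycle _ _ u≢v _ _ [] _ _ = ⊥-elim (u≢v refl)
  tree-cycle {u} {v} {i} {rs@(_ ∷ _)} zu zv u≢v lu lv w uq out
    with least {λ h → anc h u ≡ anc h v} (λ h → anc h u Fin.≟ anc h v) {i} (trans (anc-root i zu lu) (≡.sym (anc-root i zv lv)))
  ... | zero , _ , e , _ = ⊥-elim (u≢v e)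
  ... | h@(suc h′) , h≤i , e , min =
    up h v ++ down h u ++ rs ,
    upʷ h hv ++ʷ (subst (λ z → Walk A z u (down h u)) e (downʷ h hu) ++ʷ w) ,
    Unique-++ (up-Unique h hv) (Unique-++ (down-Unique h hu) uq down-rs) (λ m k → [ up-down m , up-rs m ]′ (∈-++⁻ (down h u) k)) ,
    subst (3 ≤_) (≡.sym len) (+-mono-≤ {1} {h} (s≤s z≤n) (+-mono-≤ {1} {h} (s≤s z≤n) (s≤s z≤n))) ,
    subst (_≤ i + i + length rs) (≡.sym (trans len (≡.sym (+-assoc h h _)))) (+-monoˡ-≤ (length rs) (+-mono-≤ h≤i h≤i))
    where
    hu : h ≤ lev u
    hu = subst (h ≤_) (≡.sym lu) h≤i
    hv : h ≤ lev v
    hv = subst (h ≤_) (≡.sym lv) h≤i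
    len : length (up h v ++ down h u ++ rs) ≡ h + (h + length rs)
    len = trans (length-++ (up h v)) (cong₂ _+_ (length-up h v) (trans (length-++ (down h u)) (cong (_+ length rs) (length-down h u))))
    up-down : ∀ {y} → y ∈ up h v → y ∈ down h u → ⊥
    up-down m k with ∈-up h m | ∈-down h k
    ... | s , s<h , e₁ | t , t<h , e₂ with anc-level {s} {suc t} (≤-trans (<⇒≤ s<h) hv) (≤-trans t<h hu) (trans lv (≡.sym lu)) (trans (≡.sym e₁) e₂)
    ...  | refl = min s<h (trans (≡.sym e₂) e₁)
    up-rs : ∀ {y} → y ∈ up h v → y ∈ rs → ⊥
    up-rs m k with ∈-up h m | out k
    ... | s , s<h , e₁ | inj₂ l = <⇒≱ l (≤-trans (≤-reflexive (cong lev e₁)) (≤-trans (m≤m+n (lev (anc s v)) s) (≤-reflexive (trans (lev-anc+ (≤-trans (<⇒≤ s<h) hv)) lv))))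
    ... | s , s<h , e₁ | inj₁ refl with anc-level {0} {s} z≤n (≤-trans (<⇒≤ s<h) hv) (trans lu (≡.sym lv)) e₁
    ...  | refl = u≢v e₁
    down-rs : ∀ {y} → y ∈ down h u → y ∈ rs → ⊥
    down-rs m k with ∈-down h m | out k
    ... | s , s<h , e₁ | inj₂ l = <⇒≱ l (≤-trans (≤-reflexive (cong lev e₁)) (≤-trans (m≤m+n _ (suc s)) (≤-reflexive (trans (lev-anc+ (≤-trans s<h hu)) lu))))
    ... | s , s<h , e₁ | inj₁ refl with anc-level {0} {suc s} z≤n (≤-trans s<h hu) refl e₁
    ...  | ()

-- The Moore bound

count-unique-in : {P : Fin n → Bool} (b : Bool) → (∀ i → P i ≡ true → b ≡ true) →
                  (∀ i j → P i ≡ true → P j ≡ true → i ≡ j) → count P ≤ ⟦ b ⟧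
count-unique-in true _ u = count-unique u
count-unique-in false h _ = ≤-reflexive (count-none λ i p → case (h i p))
  where
  case : false ≡ true → ⊥
  case ()

row-sum : (v : Fin n) (P : Fin n → Bool) → count₂ (λ i j → ⌊ i Fin.≟ v ⌋ ∧ P j) ≤ count P
row-sum v P = begin
  count₂ (λ i j → ⌊ i Fin.≟ v ⌋ ∧ P j)  ≡⟨ sum-swap (λ i j → ⟦ ⌊ i Fin.≟ v ⌋ ∧ P j ⟧) ⟩
  sumFin (λ j → count (λ i → ⌊ i Fin.≟ v ⌋ ∧ P j))  ≤⟨ sum-mono (λ j → count-unique-in (P j) (λ i e → proj₂ (∧-elim e))
    λ i i′ a b → trans (⌊⌋-sound (i Fin.≟ v) (proj₁ (∧-elim a))) (≡.sym (⌊⌋-sound (i′ Fin.≟ v) (proj₁ (∧-elim b))))) ⟩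
  count P  ∎
  where open ≤-Reasoning

-- Criticality for the single vertex `v`: deleting it loses only its row and its column of ordered
-- pairs, each as large as its degree in `S`.
critical-degree : Symmetricᵇ A → ∀ {β S} → Critical A β S → ∀ v → S v ≡ true → β ≤ 2 * count (restrict S A v)
critical-degree {n} {A} sy {β} {S} crit v Sv = +-cancelʳ-≤ rest β _ (begin
  β + rest  ≤⟨ +-monoˡ-≤ rest (≤-trans (≤-reflexive (≡.sym (*-identityʳ β))) (*-monoʳ-≤ β (count-pos {P = X} v Xv))) ⟩
  β * count X + rest  ≤⟨ crit X (v , Xv) (λ i e → subst (λ z → S z ≡ true) (≡.sym (⌊⌋-sound (i Fin.≟ v) e)) Sv) ⟩
  count₂ (restrict S A)  ≤⟨ count₂-union {A = R} {B = R′} cover ⟩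
  count₂ R + count₂ R′  ≤⟨ +-monoʳ-≤ (count₂ R) (count₂-union {A = λ i j → R j i} {B = restrict (S ∖ X) A} λ i j e → ⌊⌋-sound (R′? i j) e) ⟩
  count₂ R + (count₂ (λ i j → R j i) + rest)
                                          ≤⟨ +-mono-≤ row (+-monoˡ-≤ rest (≤-trans (≤-reflexive (count₂-transpose R)) row)) ⟩
  deg + (deg + rest)  ≡⟨ solve 2 (λ d r → d :+ (d :+ r) := con 2 :* d :+ r) refl deg rest ⟩
  2 * deg + rest  ∎)
  where
  open ≤-Reasoning
  open +-*-Solver
  X : Fin n → Bool
  X i = ⌊ i Fin.≟ v ⌋
  Xv : X v ≡ true
  Xv = ⌊⌋-complete (v Fin.≟ v) refl
  deg rest : ℕ
  deg = count (restrict S A v)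
  rest = count₂ (restrict (S ∖ X) A)
  R : BRel n
  R i j = X i ∧ restrict S A v j
  row : count₂ R ≤ deg
  row = row-sum v (restrict S A v)
  R′? : ∀ i j → Dec (R j i ≡ true ⊎ restrict (S ∖ X) A i j ≡ true)
  R′? i j = (R j i ≟ᵇ true) ⊎-dec (restrict (S ∖ X) A i j ≟ᵇ true)
  R′ : BRel n
  R′ i j = ⌊ R′? i j ⌋
  cover : ∀ i j → restrict S A i j ≡ true → R i j ≡ true ⊎ R′ i j ≡ true
  cover i j e = aux (i Fin.≟ v) (j Fin.≟ v)
    where
    S∖X : ∀ k → S k ≡ true → k ≢ v → (S ∖ X) k ≡ true
    S∖X k Sk k≢v = ∖-intro {P = S} {Q = X} k Sk λ e → k≢v (⌊⌋-sound (k Fin.≟ v) e)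
    aux : Dec (i ≡ v) → Dec (j ≡ v) → R i j ≡ true ⊎ R′ i j ≡ true
    aux (yes refl) _ = inj₁ (∧-intro Xv e)
    aux (no _) (yes refl) = inj₂ (⌊⌋-complete (R′? i j) (inj₁ (∧-intro Xv (restrict-sym sy S e))))
    aux (no i≢v) (no j≢v) with restrict-elim S A e
    ... | Si , Sj , a = inj₂ (⌊⌋-complete (R′? i j) (inj₂ (restrict-intro (S ∖ X) A (S∖X i Si i≢v) (S∖X j Sj j≢v) a)))

GirthAtLeast : ℕ → BRel n → Set
GirthAtLeast g A = ∀ {u xs} → Walk A u u xs → Unique xs → 3 ≤ length xs → g ≤ length xs

-- In a critical subset every degree is at least 16k. A horizontal edge before level `d`, or a
-- second parent at a level up to `d`, would close a cycle of length at most `2 * d < g`. So each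
-- vertex before level `d` has at least 16k - 1 ≥ 15k neighbours on the next level, and shares none
-- of them with another vertex of its own level.
moore : ∀ {n} {A₀ : BRel n} → Symmetricᵇ A₀ → (∀ {u v} → A₀ u v ≡ true → u ≢ v) →
        ∀ {g d k} → GirthAtLeast g A₀ → 2 * d < g → 1 ≤ k →
        (W : Fin n → Bool) → Nonempty W → 32 * k * count W ≤ count₂ (restrict W A₀) → (15 * k) ^ d ≤ count W
moore {n} {A₀} sy₀ irr₀ {g} {d} {k} girth 2d<g 1≤k W neW dense
  with critical-subset A₀ (32 * k) W neW dense
... | S , S⊆W , (x , Sx) , crit with component (restrict S A₀) x
... | Z , Zx , closed , walk = ≤-trans (layer-size d ≤-refl) (count-mono λ v e → S⊆W v (Z⊆S v (proj₁ (∧-elim e))))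
  where
  H : BRel n
  H = restrict S A₀
  sy : Symmetricᵇ H
  sy = restrict-sym sy₀ S
  Z⊆S : ∀ v → Z v ≡ true → S v ≡ true
  Z⊆S v z with walk v z
  ... | xs , w with reverseʷ sy w
  ...  | _ , [] , _ = Sx
  ...  | _ , (e ∷ _) , _ = proj₁ (restrict-elim S A₀ e)
  open Tree sy (bfs sy Z x closed (λ v z → _ , proj₁ (proj₂ (reverseʷ sy (proj₂ (walk v z))))) Zx) hiding (closed)
  short : ∀ {u xs m} → Walk H u u xs → Unique xs → 3 ≤ length xs → length xs ≤ m → m < g → ⊥
  short {xs = xs} w uq l3 lm mg = <⇒≱ mg (≤-trans (girth (mapʷ (λ e → proj₂ (proj₂ (restrict-elim S A₀ e))) w) uq l3) lm)
  2*≡ : ∀ i → i + i ≡ 2 * i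
  2*≡ i = cong (i +_) (≡.sym (+-identityʳ i))
  no-horizontal : ∀ {u v} → Z u ≡ true → H u v ≡ true → lev u < d → lev u ≢ lev v
  no-horizontal {u} {v} zu e l eq
    with tree-cycle zu (closed zu e) (irr₀ (proj₂ (proj₂ (restrict-elim S A₀ e)))) refl (≡.sym eq) (e ∷ [])
           (Unique-∷ (λ ()) []) (λ { (here p) → inj₁ p })
  ... | xs , w , uq , l3 , lm = short w uq l3 (≤-trans lm (≤-trans (≤-reflexive (trans (+-comm _ 1) (cong suc (2*≡ (lev u))))) (≤-trans (n≤1+n _) (≤-trans (≤-reflexive (≡.sym (*-suc 2 (lev u)))) (*-monoʳ-≤ 2 l))))) 2d<g
  one-parent : ∀ {w u v} → Z w ≡ true → H w u ≡ true → H w v ≡ true → lev w ≤ d → lev w ≡ suc (lev u) → lev w ≡ suc (lev v) → u ≡ v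
  one-parent {w} {u} {v} zw eu ev l lu lv with u Fin.≟ v
  ... | yes p = p
  ... | no u≢v with tree-cycle (closed zw eu) (closed zw ev) u≢v refl (suc-injective (trans (≡.sym lv) lu)) (sy eu ∷ (ev ∷ []))
           (Unique-∷ (λ { (here p) → irr₀ (proj₂ (proj₂ (restrict-elim S A₀ eu))) (≡.sym p) }) (Unique-∷ (λ ()) []))
           (λ { (here p) → inj₁ p ; (there (here refl)) → inj₂ (≤-reflexive (≡.sym lu)) })
  ...  | xs , c , uq , l3 , lm = ⊥-elim (short c uq l3 (≤-trans lm (≤-trans (≤-reflexive (trans (+-comm _ 2) (trans (cong (2 +_) (2*≡ (lev u))) (≡.sym (*-suc 2 (lev u)))))) (*-monoʳ-≤ 2 (≤-trans (≤-reflexive (≡.sym lu)) l)))) 2d<g)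
  layer : ℕ → Fin n → Bool
  layer i v = Z v ∧ ⌊ lev v ℕₚ.≟ i ⌋
  layer-elim : ∀ {i v} → layer i v ≡ true → Z v ≡ true × lev v ≡ i
  layer-elim {i} {v} e with ∧-elim e
  ... | z , l = z , ⌊⌋-sound (lev v ℕₚ.≟ i) l
  upper : BRel n
  upper v w = H v w ∧ ⌊ lev w ℕₚ.≟ suc (lev v) ⌋
  upper-elim : ∀ {v w} → upper v w ≡ true → H v w ≡ true × lev w ≡ suc (lev v)
  upper-elim {v} {w} e with ∧-elim e
  ... | a , l = a , ⌊⌋-sound (lev w ℕₚ.≟ suc (lev v)) l
  many-upper : ∀ {v} → Z v ≡ true → lev v < d → 15 * k ≤ count (upper v)
  many-upper {v} z l = ≤-pred (begin
    1 + 15 * k  ≤⟨ +-monoˡ-≤ (15 * k) 1≤k ⟩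
    16 * k  ≤⟨ *-cancelˡ-≤ 2 (≤-trans (≤-reflexive (≡.sym (*-assoc 2 16 k))) (critical-degree sy₀ crit v (Z⊆S v z))) ⟩
    count (H v)  ≤⟨ count-union {P = λ w → H v w ∧ ⌊ lev v ℕₚ.≟ suc (lev w) ⌋} {Q = upper v} cover ⟩
    count (λ w → H v w ∧ ⌊ lev v ℕₚ.≟ suc (lev w) ⌋) + count (upper v)
                                     ≤⟨ +-monoˡ-≤ _ (count-unique λ a b p q → one-parent z (proj₁ (∧-elim p)) (proj₁ (∧-elim q)) (<⇒≤ l) (⌊⌋-sound (_ ℕₚ.≟ _) (proj₂ (∧-elim p))) (⌊⌋-sound (_ ℕₚ.≟ _) (proj₂ (∧-elim q)))) ⟩
    1 + count (upper v)  ∎)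
    where
    open ≤-Reasoning
    cover : ∀ w → H v w ≡ true → H v w ∧ ⌊ lev v ℕₚ.≟ suc (lev w) ⌋ ≡ true ⊎ upper v w ≡ true
    cover w e with <-cmp (lev v) (lev w)
    ... | tri≈ _ eq _ = ⊥-elim (no-horizontal z e l eq)
    ... | tri< lt _ _ = inj₂ (∧-intro e (⌊⌋-complete (lev w ℕₚ.≟ suc (lev v)) (≤-antisym (lip e) lt)))
    ... | tri> _ _ gt = inj₁ (∧-intro e (⌊⌋-complete (lev v ℕₚ.≟ suc (lev w)) (≤-antisym (lip (sy e)) gt)))
  layer-growth : ∀ i → i < d → 15 * k * count (layer i) ≤ count (layer (suc i))
  layer-growth i i<d = begin
    15 * k * count (layer i)  ≡⟨ sum-* (15 * k) (λ v → ⟦ layer i v ⟧) ⟨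
    sumFin (λ v → 15 * k * ⟦ layer i v ⟧)  ≤⟨ sum-mono (λ v → row v (layer i v ≟ᵇ true)) ⟩
    count₂ (λ v w → layer i v ∧ upper v w)  ≡⟨ count₂-transpose (λ v w → layer i v ∧ upper v w) ⟨
    count₂ (λ w v → layer i v ∧ upper v w)  ≤⟨ sum-mono (λ w → count-unique-in (layer (suc i) w) (into w) (uniq w)) ⟩
    count (layer (suc i))  ∎
    where
    open ≤-Reasoning
    row : ∀ v → Dec (layer i v ≡ true) → 15 * k * ⟦ layer i v ⟧ ≤ count (λ w → layer i v ∧ upper v w)
    row v (no ¬p) rewrite ≢true ¬p = ≤-trans (≤-reflexive (*-zeroʳ (15 * k))) z≤n
    row v (yes p) with layer-elim {i} p
    ... | z , l rewrite p = ≤-trans (≤-reflexive (*-identityʳ (15 * k))) (many-upper z (subst (_< d) (≡.sym l) i<d))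
    elim : ∀ w v → layer i v ∧ upper v w ≡ true → Z v ≡ true × lev v ≡ i × H v w ≡ true × lev w ≡ suc (lev v)
    elim w v e with ∧-elim e
    ... | a , b with layer-elim {i} a | upper-elim {v} b
    ...  | z , l | e′ , l′ = z , l , e′ , l′
    into : ∀ w v → layer i v ∧ upper v w ≡ true → layer (suc i) w ≡ true
    into w v e with elim w v e
    ... | z , l , e′ , l′ = ∧-intro (closed z e′) (⌊⌋-complete (lev w ℕₚ.≟ suc i) (trans l′ (cong suc l)))
    uniq : ∀ w v v′ → layer i v ∧ upper v w ≡ true → layer i v′ ∧ upper v′ w ≡ true → v ≡ v′
    uniq w v v′ p q with elim w v p | elim w v′ q
    ... | z , l , e , m | z′ , l′ , e′ , m′ = one-parent (closed z e) (sy e) (sy e′) (≤-trans (≤-reflexive (trans m (cong suc l))) i<d) m m′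
  layer-size : ∀ i → i ≤ d → (15 * k) ^ i ≤ count (layer i)
  layer-size zero _ = count-pos {P = layer 0} x (∧-intro Zx (⌊⌋-complete (lev x ℕₚ.≟ 0) lev-root))
  layer-size (suc i) i<d = ≤-trans (*-monoʳ-≤ (15 * k) (layer-size i (<⇒≤ i<d))) (layer-growth i i<d)

-- Long cycles with a chord

-- Indices run over all of ℕ with period `ν`, so that paths may wrap around. The cycle is rotated to
-- let the chord start at index 0, and the bounds on `r` keep its ends from being consecutive.
record ChordedCycle {n} (A : BRel n) (ν : ℕ) : Set where
  field
    c  : ℕ → Fin n
    per  : ∀ x → c (x + ν) ≡ c x
    inj  : ∀ {x y} → x < ν → y < ν → c x ≡ c y → x ≡ y
    edge  : ∀ x → A (c x) (c (suc x)) ≡ true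
    r  : ℕ
    2≤r  : 2 ≤ r
    r+2≤ν : r + 2 ≤ ν
    chord : A (c 0) (c r) ≡ true

chordedCycle : ∀ {y L r} → Walk A y y L → Unique L → 2 ≤ r → r + 2 ≤ length L → A y (nth y L r) ≡ true →
               ChordedCycle A (length L)
chordedCycle {L = []} {r} _ _ _ l _ with ≤-trans (m≤n+m 2 r) l
... | ()
chordedCycle {A = A} {y = y} {L = L@(_ ∷ ls)} {r = r} w uq 2≤r l e = record
  { c = c
  ; per = λ x → cong (nth y L) ([m+n]%n≡m%n x ν)
  ; inj = λ x< y< eq → nth-injective y uq x< y<
      (trans (cong (nth y L) (≡.sym (m<n⇒m%n≡m x<))) (trans eq (cong (nth y L) (m<n⇒m%n≡m y<))))
  ; edge = λ x → subst (λ z → A (c x) z ≡ true) (next x) (nth-step w (m%n<n x ν))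
  ; r = r ; 2≤r = 2≤r ; r+2≤ν = l
  ; chord = ≡.subst₂ (λ a b → A a b ≡ true) (≡.sym (nth-head w))
      (cong (nth y L) (≡.sym (m<n⇒m%n≡m (≤-trans (≤-reflexive (+-comm 1 r)) (≤-trans (+-monoʳ-≤ r (s≤s z≤n)) l))))) e }
  where
  ν = length L
  c : ℕ → Fin _
  c x = nth y L (x % ν)
  next : ∀ x → nth y L (suc (x % ν)) ≡ c (suc x)
  next x with m≤n⇒m<n∨m≡n (m%n<n x ν)
  ... | inj₁ lt = cong (nth y L) (≡.sym (trans (cong (_% ν) (cong suc (m≡m%n+[m/n]*n x ν))) (trans ([m+kn]%n≡m%n (suc (x % ν)) (x / ν) ν) (m<n⇒m%n≡m lt))))
  ... | inj₂ eq = trans (trans (cong (nth y L) eq) (trans (nth-last y L) (≡.sym (nth-head w))))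
    (cong (nth y L) (≡.sym (trans (cong (_% ν) (cong suc (m≡m%n+[m/n]*n x ν))) (trans ([m+kn]%n≡m%n (suc (x % ν)) (x / ν) ν) (trans (cong (_% ν) eq) (n%n≡0 ν))))))

nth-++ : {V : Set} (d : V) (xs : List V) {z : V} {ys : List V} → nth d (xs ++ z ∷ ys) (length xs) ≡ z
nth-++ d [] = refl
nth-++ d (x ∷ xs) = nth-++ d xs

walk-∈-restrict : ∀ {S} {u v xs y} → Walk (restrict S A) u v xs → y ∈ xs → S y ≡ true
walk-∈-restrict {A = A} {S = S} (e ∷ p) (here refl) = proj₁ (restrict-elim S A e)
walk-∈-restrict {A = A} {S = S} (e ∷ p) (there m) = walk-∈-restrict {A = A} {S = S} p m

-- A state of a depth-first search: the stack runs from v along ws to the root z (which ws omits), and Y is a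
-- union of unexplored pieces, each attached to v.
record Stack {n} (A : BRel n) (z : Fin n) (Y : Fin n → Bool) : Set where
  field
    v  : Fin n
    ws  : List (Fin n)
    walk  : Walk A v z ws
    unique : Unique ws
    off  : ∀ {y} → Y y ≡ true → y ∉ ws
    closed : ∀ {u y} → Y u ≡ true → A u y ≡ true → Y y ≡ true ⊎ y ∈ ws ⊎ y ≡ z
    attach : ∀ {y} → Y y ≡ true → ∃ λ y′ → Y y′ ≡ true × A y′ v ≡ true × ∃ λ xs → Walk (restrict Y A) y′ y xs

singleton : Fin n → Fin n → Bool
singleton w v = ⌊ v Fin.≟ w ⌋

count-remove : (Z : Fin n → Bool) (w : Fin n) → count Z ≤ suc (count (Z ∖ singleton w))
count-remove Z w = ≤-trans (count-union {P = singleton w} {Q = Z ∖ singleton w} cover)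
  (+-monoˡ-≤ _ (count-unique λ i j a b → trans (⌊⌋-sound (i Fin.≟ w) a) (≡.sym (⌊⌋-sound (j Fin.≟ w) b))))
  where
  cover : ∀ i → Z i ≡ true → singleton w i ≡ true ⊎ (Z ∖ singleton w) i ≡ true
  cover i z with singleton w i ≟ᵇ true
  ... | yes p = inj₁ p
  ... | no ¬p = inj₂ (∖-intro {P = Z} {Q = singleton w} i z ¬p)

module _ {A : BRel n} (sy : Symmetricᵇ A) (Y : Fin n → Bool) (w : Fin n) (Z : Fin n → Bool)
         (closedZ : ∀ {u v} → Z u ≡ true → restrict Y A u v ≡ true → Z v ≡ true)
         (reach : ∀ v → Z v ≡ true → Σ (List (Fin n)) λ xs → Walk (restrict Y A) w v xs) (Zw : Z w ≡ true) where
  private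
    Y′ : Fin n → Bool
    Y′ = Z ∖ singleton w
    in-Y′ : ∀ {y} → Z y ≡ true → w ≢ y → Y′ y ≡ true
    in-Y′ {y} z w≢y = ∖-intro {P = Z} {Q = singleton w} y z λ e → w≢y (≡.sym (⌊⌋-sound (y Fin.≟ w) e))
    start-∈ : ∀ {t v xs} → Walk (restrict Y A) t v xs → t ∈ v ∷ xs
    start-∈ [] = here refl
    start-∈ (_ ∷ _) = there (here refl)
    stay : ∀ {u v xs} → Walk (restrict Y A) u v xs → Z u ≡ true → w ∉ v ∷ xs → Walk (restrict Y′ A) u v xs
    stay [] _ _ = []
    stay {u} {v} {_ ∷ xs} (e ∷ p) zu w∉ = restrict-intro Y′ A (in-Y′ zu λ eq → w∉ (there (here eq)))
        (in-Y′ (closedZ zu e) λ eq → w∉′ (subst (_∈ v ∷ xs) (≡.sym eq) (start-∈ p)))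
        (proj₂ (proj₂ (restrict-elim Y A e))) ∷ stay p (closedZ zu e) w∉′
      where
      w∉′ : w ∉ v ∷ xs
      w∉′ (here eq) = w∉ (here eq)
      w∉′ (there m) = w∉ (there (there m))

  -- A simple walk from `w` to `y` in the piece, with its first vertex removed, keeps `y` attached
  -- to `w` once `w` itself is on the stack.
  component-attach : ∀ {y} → Y′ y ≡ true → ∃ λ y′ → Y′ y′ ≡ true × A y′ w ≡ true × ∃ λ xs → Walk (restrict Y′ A) y′ y xs
  component-attach {y} y∈ with ∖-elim {P = Z} {Q = singleton w} y y∈
  ... | zy , y≢ with simplify (proj₂ (reach y zy))
  ...  | [] , [] , _ = ⊥-elim (y≢ (⌊⌋-complete (w Fin.≟ w) refl))
  ...  | _ ∷ xs , _∷_ {w = t} e p , uq , _ = t , in-Y′ (closedZ Zw e) (λ eq → w∉ (subst (_∈ y ∷ xs) (≡.sym eq) (start-∈ p))) ,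
    sy (proj₂ (proj₂ (restrict-elim Y A e))) , xs , stay p (closedZ Zw e) w∉
    where
    w∉ : w ∉ y ∷ xs
    w∉ (here eq) = Unique-head uq (here (≡.sym eq))
    w∉ (there m) = Unique-head (Unique-tail uq) m

-- While `Y` has more than `2 * N` vertices, let `Z` be the piece of `Y` around a neighbour `w` of
-- the top of the stack. If `Z` has more than `N` vertices, push `w` and keep the rest of `Z`; if
-- not, discard `Z`. Either way at least `N` vertices remain, so the size cannot jump over the range
-- from `N` to `2 * N`.
dfs : {A : BRel n} → Symmetricᵇ A → ∀ {z} N → 1 ≤ N → (Y : Fin n → Bool) → N ≤ count Y → Stack A z Y →
      Σ (Fin n → Bool) λ X → Stack A z X × N ≤ count X × count X ≤ 2 * N × (∀ v → X v ≡ true → Y v ≡ true)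
dfs {n} {A} sy {z} N 1≤N Y = go Y (<-wellFounded (count Y))
  where
  go : ∀ Y → Acc _<_ (count Y) → N ≤ count Y → Stack A z Y →
    Σ (Fin n → Bool) λ X → Stack A z X × N ≤ count X × count X ≤ 2 * N × (∀ v → X v ≡ true → Y v ≡ true)
  go Y (acc rec) N≤ st with count Y ≤? 2 * N
  ... | yes small = Y , st , N≤ , small , λ _ e → e
  ... | no big with count-∃ {P = Y} (≤-trans 1≤N N≤)
  ... | y , Yy with Stack.attach st Yy
  ... | w , Yw , wv , _ with component (restrict Y A) w
  ... | Z , Zw , closedZ , reach = proceed (suc N ≤? count Z)
    where
    open Stack st
    Z⊆Y : ∀ v → Z v ≡ true → Y v ≡ true
    Z⊆Y v zv with reverseʷ (restrict-sym sy Y) (proj₂ (reach v zv))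
    ... | _ , [] , _ = Yw
    ... | _ , (e ∷ _) , _ = proj₁ (restrict-elim Y A e)
    Y₁ Y₂ : Fin n → Bool
    Y₁ = Z ∖ singleton w
    Y₂ = Y ∖ Z
    Y₁⊆ : ∀ v → Y₁ v ≡ true → Z v ≡ true × v ≢ w
    Y₁⊆ v e with ∖-elim {P = Z} {Q = singleton w} v e
    ... | zv , ne = zv , λ eq → ne (⌊⌋-complete (v Fin.≟ w) eq)
    Y₂⊆ : ∀ v → Y₂ v ≡ true → Y v ≡ true × Z v ≢ true
    Y₂⊆ v e = ∖-elim {P = Y} {Q = Z} v e
    stack₁ : Stack A z Y₁
    stack₁ = record
      { v = w ; ws = w ∷ ws ; walk = wv ∷ walk ; unique = Unique-∷ (off Yw) unique
      ; off = λ {y} e → λ { (here eq) → proj₂ (Y₁⊆ y e) eq ; (there m) → off (Z⊆Y y (proj₁ (Y₁⊆ y e))) m }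
      ; closed = λ {u} {y} e a → closed₁ u y (proj₁ (Y₁⊆ u e)) a (closed (Z⊆Y u (proj₁ (Y₁⊆ u e))) a) (y Fin.≟ w)
      ; attach = component-attach sy Y w Z closedZ reach Zw }
      where
      closed₁ : ∀ u y → Z u ≡ true → A u y ≡ true → Y y ≡ true ⊎ y ∈ ws ⊎ y ≡ z → Dec (y ≡ w) →
                Y₁ y ≡ true ⊎ y ∈ w ∷ ws ⊎ y ≡ z
      closed₁ u y zu a _ (yes eq) = inj₂ (inj₁ (here eq))
      closed₁ u y zu a (inj₁ Yy) (no ne) = inj₁ (∖-intro {P = Z} {Q = singleton w} y
        (closedZ zu (restrict-intro Y A (Z⊆Y u zu) Yy a)) λ e → ne (⌊⌋-sound (y Fin.≟ w) e))
      closed₁ u y zu a (inj₂ (inj₁ m)) (no _) = inj₂ (inj₁ (there m))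
      closed₁ u y zu a (inj₂ (inj₂ eq)) (no _) = inj₂ (inj₂ eq)
    stack₂ : Stack A z Y₂
    stack₂ = record
      { v = v ; ws = ws ; walk = walk ; unique = unique
      ; off = λ {y} e → off (proj₁ (Y₂⊆ y e))
      ; closed = λ {u} {y} e a → closed₂ u y (Y₂⊆ u e) a (closed (proj₁ (Y₂⊆ u e)) a)
      ; attach = λ {y} e → attach₂ y (Y₂⊆ y e) }
      where
      closed₂ : ∀ u y → Y u ≡ true × Z u ≢ true → A u y ≡ true → Y y ≡ true ⊎ y ∈ ws ⊎ y ≡ z → Y₂ y ≡ true ⊎ y ∈ ws ⊎ y ≡ z
      closed₂ u y (yu , ¬zu) a (inj₁ yy) = inj₁ (∖-intro {P = Y} {Q = Z} y yy λ zy → ¬zu (closedZ zy (restrict-intro Y A yy yu (sy a))))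
      closed₂ u y _ a (inj₂ s) = inj₂ s
      avoid : ∀ {s t xs} → Walk (restrict Y A) s t xs → Z t ≢ true → Z s ≢ true × Walk (restrict Y₂ A) s t xs
      avoid [] ¬z = ¬z , []
      avoid (e ∷ p) ¬z with avoid p ¬z | restrict-elim Y A e
      ... | ¬z′ , q | ys , yt , a = ¬zs , restrict-intro Y₂ A (∖-intro {P = Y} {Q = Z} _ ys ¬zs) (∖-intro {P = Y} {Q = Z} _ yt ¬z′) a ∷ q
        where
        ¬zs : Z _ ≢ true
        ¬zs zs = ¬z′ (closedZ zs e)
      attach₂ : ∀ y → Y y ≡ true × Z y ≢ true → ∃ λ y′ → Y₂ y′ ≡ true × A y′ v ≡ true × ∃ λ xs → Walk (restrict Y₂ A) y′ y xs
      attach₂ y (yy , ¬zy) with attach yy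
      ... | y′ , yy′ , a , xs , p with avoid p ¬zy
      ...  | ¬zy′ , q = y′ , ∖-intro {P = Y} {Q = Z} y′ yy′ ¬zy′ , a , xs , q
    proceed : Dec (suc N ≤ count Z) → _
    proceed (yes large) with go Y₁ (rec (count-strict {P = Y₁} {Q = Y} w (λ i e → Z⊆Y i (proj₁ (Y₁⊆ i e))) Yw (λ e → proj₂ (Y₁⊆ w e) refl)))
                                   (≤-pred (≤-trans large (count-remove Z w))) stack₁
    ... | X , s , l , u , sub = X , s , l , u , λ i e → Z⊆Y i (proj₁ (Y₁⊆ i (sub i e)))
    proceed (no small) with go Y₂ (rec (count-strict {P = Y₂} {Q = Y} w (λ i e → proj₁ (Y₂⊆ i e)) Yw (λ e → proj₂ (Y₂⊆ w e) Zw)))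
                                  (+-cancelˡ-≤ N N (count Y₂) (≤-trans (≤-trans (≤-reflexive (cong (N +_) (≡.sym (+-identityʳ N)))) (<⇒≤ (≰⇒> big)))
                                    (≤-trans (count-union {P = Z} {Q = Y₂} cover) (+-monoˡ-≤ (count Y₂) (≤-pred (≰⇒> small)))))) stack₂
      where
      cover : ∀ i → Y i ≡ true → Z i ≡ true ⊎ Y₂ i ≡ true
      cover i yi with Z i ≟ᵇ true
      ... | yes zi = inj₁ zi
      ... | no ¬zi = inj₂ (∖-intro {P = Y} {Q = Z} i yi ¬zi)
    ... | X , s , l , u , sub = X , s , l , u , λ i e → proj₁ (Y₂⊆ i (sub i e))

nbhd? : (A : BRel n) (S X : Fin n → Bool) (v : Fin n) → Dec (S v ≡ true × (X v ≡ true ⊎ ∃ λ u → X u ≡ true × A u v ≡ true))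
nbhd? A S X v = (S v ≟ᵇ true) ×-dec ((X v ≟ᵇ true) ⊎-dec any? λ u → (X u ≟ᵇ true) ×-dec (A u v ≟ᵇ true))

nbhd : BRel n → (Fin n → Bool) → (Fin n → Bool) → Fin n → Bool
nbhd A S X v = ⌊ nbhd? A S X v ⌋

-- By the Moore bound, few vertices cannot span the many edges that a critical set forces at X.
expansion : ∀ {n} {A : BRel n} → Symmetricᵇ A → (∀ {u v} → A u v ≡ true → u ≢ v) → ∀ {g d k S} →
  GirthAtLeast g A → 2 * d < g → 1 ≤ k → Critical A (224 * k) S →
  ∀ X → Nonempty X → (∀ v → X v ≡ true → S v ≡ true) → 7 * count X < (15 * k) ^ d → 7 * count X < count (nbhd A S X)
expansion {n} {A} sy irr {g} {d} {k} {S} girth 2d<g 1≤k crit X neX X⊆S small = ≰⇒> λ few →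
  <⇒≱ small (≤-trans (moore sy irr {d = d} girth 2d<g 1≤k Y (proj₁ neX , X⊆Y _ (proj₂ neX)) (begin
    32 * k * count Y  ≤⟨ *-monoʳ-≤ (32 * k) few ⟩
    -- Here 224 = 32 · 7: the density 224k at `X` becomes density 32k on a neighbourhood at most
    -- seven times as large.
    32 * k * (7 * count X)  ≡⟨ solve 2 (λ k x → con 32 :* k :* (con 7 :* x) := con 224 :* k :* x) refl k (count X) ⟩
    224 * k * count X  ≤⟨ +-cancelʳ-≤ (count₂ (restrict (S ∖ X) A)) _ _ (≤-trans (crit X neX X⊆S)
                                    (count₂-union {A = restrict Y A} {B = restrict (S ∖ X) A} cover)) ⟩
    count₂ (restrict Y A)  ∎)) few)
  where
  open ≤-Reasoning
  open +-*-Solver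
  Y : Fin n → Bool
  Y = nbhd A S X
  X⊆Y : ∀ v → X v ≡ true → Y v ≡ true
  X⊆Y v e = ⌊⌋-complete (nbhd? A S X v) (X⊆S v e , inj₁ e)
  cover : ∀ i j → restrict S A i j ≡ true → restrict Y A i j ≡ true ⊎ restrict (S ∖ X) A i j ≡ true
  cover i j e with restrict-elim S A e
  ... | Si , Sj , a = decide (X i ≟ᵇ true) (X j ≟ᵇ true)
    where
    decide : Dec (X i ≡ true) → Dec (X j ≡ true) → restrict Y A i j ≡ true ⊎ restrict (S ∖ X) A i j ≡ true
    decide (yes Xi) _ = inj₁ (restrict-intro Y A (X⊆Y i Xi) (⌊⌋-complete (nbhd? A S X j) (Sj , inj₂ (i , Xi , a))) a)
    decide (no _) (yes Xj) = inj₁ (restrict-intro Y A (⌊⌋-complete (nbhd? A S X i) (Si , inj₂ (j , Xj , sy a))) (X⊆Y j Xj) a)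
    decide (no ¬Xi) (no ¬Xj) = inj₂ (restrict-intro (S ∖ X) A (∖-intro {P = S} {Q = X} i Si ¬Xi) (∖-intro {P = S} {Q = X} j Sj ¬Xj) a)

-- A vertex of X with two neighbours far down the stack closes a long cycle through one of them and sees the other as a chord.
stack-chord : ∀ {n} {A : BRel n} → Symmetricᵇ A → ∀ {z X} t (st : Stack A z X) → 1 ≤ t → let open Stack st in
  ∀ {y u₁ u₂} → X y ≡ true → u₁ ∈ drop t ws → u₂ ∈ drop t ws → u₁ ≢ u₂ → A y u₁ ≡ true → A y u₂ ≡ true →
  Σ ℕ λ ν → t ≤ ν × ChordedCycle A ν
stack-chord {n} {A} sy {z} {X} t st 1≤t {y} {u₁} {u₂} Xy m₁ m₂ u₁≢u₂ a₁ a₂ = split (∈-∃++ m₂)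
  where
  open Stack st
  go : ∀ {a b} as bs cs → drop t ws ≡ as ++ b ∷ bs ++ a ∷ cs → A y a ≡ true → A y b ≡ true → Σ ℕ λ ν → t ≤ ν × ChordedCycle A ν
  go {a} {b} as bs cs eq ya yb with attach Xy
  ... | y′ , Xy′ , y′v , xs , p with simplify p
  ... | ys , q , uq , _ with reverseʷ (restrict-sym sy X) q
  ... | qs , q′ , σ = length L , t≤ν , chordedCycle walkL uniqueL 2≤r r+2≤ (subst (λ w → A y w ≡ true) (≡.sym at-r) yb)
    where
    -- The cycle runs from `y` inside `X` to `y′`, enters the stack at its top, passes `b` and
    -- returns to `y` from the deeper `a`. So `b` has index `length pre`, beyond the top `t`
    -- entries, and `a` separates it from the return to `y`.
    pre : List (Fin n)
    pre = qs ++ y′ ∷ take t ws ++ as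
    L : List (Fin n)
    L = pre ++ b ∷ bs ++ [ a ]
    ws≡ : ws ≡ ((take t ws ++ as) ++ b ∷ bs) ++ a ∷ cs
    ws≡ = trans (≡.sym (take++drop≡id t ws)) (trans (cong (take t ws ++_) eq)
      (trans (≡.sym (++-assoc (take t ws) as _)) (≡.sym (++-assoc (take t ws ++ as) (b ∷ bs) (a ∷ cs)))))
    L≡ : L ≡ qs ++ y′ ∷ ((take t ws ++ as) ++ b ∷ bs) ++ [ a ]
    L≡ = trans (++-assoc qs _ _) (cong (λ l → qs ++ y′ ∷ l) (≡.sym (++-assoc (take t ws ++ as) (b ∷ bs) [ a ])))
    stack-part : Walk A v a ((take t ws ++ as) ++ b ∷ bs)
    stack-part = proj₁ (splitʷ ((take t ws ++ as) ++ b ∷ bs) (subst (Walk A v z) ws≡ walk))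
    walkL : Walk A y y L
    walkL = subst (Walk A y y) (≡.sym L≡) (mapʷ (λ e → proj₂ (proj₂ (restrict-elim X A e))) q′ ++ʷ (y′v ∷ (stack-part ++ʷ (sy ya ∷ []))))
    uniqueX : Unique (y′ ∷ qs)
    uniqueX = Unique-resp-↭ (↭-sym σ) uq
    inX : ∀ {w} → w ∈ y′ ∷ qs → X w ≡ true
    inX (here refl) = Xy′
    inX (there m) = walk-∈-restrict {A = A} {S = X} q′ m
    shorter : ((take t ws ++ as) ++ b ∷ bs) ++ [ a ] ++ cs ≡ (((take t ws ++ as) ++ b ∷ bs) ++ [ a ]) ++ cs
    shorter = ≡.sym (++-assoc ((take t ws ++ as) ++ b ∷ bs) [ a ] cs)
    unique-stack : Unique (((take t ws ++ as) ++ b ∷ bs) ++ [ a ])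
    unique-stack = proj₁ (Unique-++⁻ _ (subst Unique (trans ws≡ shorter) unique))
    in-ws : ∀ {w} → w ∈ ((take t ws ++ as) ++ b ∷ bs) ++ [ a ] → w ∈ ws
    in-ws m = subst (_ ∈_) (≡.sym (trans ws≡ shorter)) (∈-++⁺ˡ m)
    uniqueL : Unique L
    uniqueL = subst Unique (≡.sym L≡) (Unique-++ (Unique-tail uniqueX)
      (Unique-∷ (λ m → off Xy′ (in-ws m)) unique-stack)
      λ { m (here refl) → Unique-head uniqueX m ; m (there k) → off (inX (there m)) (in-ws k) })
    t≤take : t ≤ length (take t ws)
    t≤take with t ≤? length ws
    ... | yes l = ≤-reflexive (≡.sym (trans (length-take t ws) (m≤n⇒m⊓n≡m l)))
    ... | no ¬l = ⊥-elim (nope (subst (b ∈_) (drop-all t ws (<⇒≤ (≰⇒> ¬l))) (subst (b ∈_) (≡.sym eq) (∈-insert as))))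
      where
      nope : b ∉ []
      nope ()
    length-pre : suc t ≤ length pre
    length-pre = begin
      suc t  ≤⟨ s≤s t≤take ⟩
      suc (length (take t ws))  ≤⟨ s≤s (m≤m+n _ (length as)) ⟩
      suc (length (take t ws) + length as)  ≡⟨ cong suc (length-++ (take t ws)) ⟨
      length (y′ ∷ take t ws ++ as)  ≤⟨ m≤n+m _ (length qs) ⟩
      length qs + length (y′ ∷ take t ws ++ as)  ≡⟨ length-++ qs ⟨
      length pre  ∎
      where open ≤-Reasoning
    length-L : length L ≡ length pre + suc (length bs + 1)
    length-L = trans (length-++ pre) (cong (λ l → length pre + suc l) (length-++ bs))
    t≤ν : t ≤ length L
    t≤ν = ≤-trans (≤-trans (n≤1+n t) length-pre) (≤-trans (m≤m+n _ _) (≤-reflexive (≡.sym length-L)))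
    at-r : nth y L (length pre) ≡ b
    at-r = nth-++ y pre
    2≤r : 2 ≤ length pre
    2≤r = ≤-trans (s≤s 1≤t) length-pre
    r+2≤ : length pre + 2 ≤ length L
    r+2≤ = ≤-trans (+-monoʳ-≤ (length pre) (s≤s (m≤n+m 1 (length bs)))) (≤-reflexive (≡.sym length-L))
  split : ∃ (λ as → ∃ λ bs → drop t ws ≡ as ++ u₂ ∷ bs) → _
  split (as , bs , eq) with ∈-++⁻ as (subst (u₁ ∈_) eq m₁)
  ... | inj₁ m with ∈-∃++ m
  ...  | as₁ , as₂ , refl = go as₁ as₂ bs (trans eq (++-assoc as₁ (u₁ ∷ as₂) (u₂ ∷ bs))) a₂ a₁
  split (as , bs , eq) | inj₂ (here e) = ⊥-elim (u₁≢u₂ e)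
  split (as , bs , eq) | inj₂ (there m) with ∈-∃++ m
  ...  | bs₁ , bs₂ , refl = go as bs₁ bs₂ eq a₁ a₂

-- The bound counts X, the top t stack vertices, the stack root, and one deep neighbour per vertex of X.
nbhd-stack : ∀ {n} {A : BRel n} → Symmetricᵇ A → ∀ {S z X} t (st : Stack (restrict S A) z X) → 1 ≤ t →
  (∀ v → X v ≡ true → S v ≡ true) →
  (Σ ℕ λ ν → t ≤ ν × ChordedCycle A ν) ⊎ count (nbhd A S X) ≤ count X + (t + (1 + count X))
nbhd-stack {n} {A} sy {S} {z} {X} t st 1≤t X⊆S
  with any? (λ y → any? λ u₁ → any? λ u₂ → (X y ≟ᵇ true) ×-dec (u₁ ∈? drop t (Stack.ws st)) ×-dec (u₂ ∈? drop t (Stack.ws st))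
         ×-dec ¬? (u₁ Fin.≟ u₂) ×-dec (restrict S A y u₁ ≟ᵇ true) ×-dec (restrict S A y u₂ ≟ᵇ true))
... | yes (y , u₁ , u₂ , Xy , m₁ , m₂ , ne , a₁ , a₂) with stack-chord (restrict-sym sy S) t st 1≤t Xy m₁ m₂ ne a₁ a₂
...  | ν , l , C = inj₁ (ν , l , record { c = c ; per = per ; inj = inj ; edge = λ x → weaken (edge x) ; r = r ; 2≤r = 2≤r ; r+2≤ν = r+2≤ν ; chord = weaken chord })
  where
  open ChordedCycle C
  weaken : ∀ {i j} → restrict S A i j ≡ true → A i j ≡ true
  weaken e = proj₂ (proj₂ (restrict-elim S A e))
nbhd-stack {n} {A} sy {S} {z} {X} t st 1≤t X⊆S | no none = inj₂ (begin
  count (nbhd A S X)  ≤⟨ count-union {P = X} {Q = λ v → ⌊ rest₁? v ⌋} (λ v e → cover₁ v (⌊⌋-sound (nbhd? A S X v) e)) ⟩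
  count X + count (λ v → ⌊ rest₁? v ⌋)  ≤⟨ +-monoʳ-≤ (count X) (count-union {P = λ v → ⌊ v ∈? take t ws ⌋} {Q = λ v → ⌊ rest₂? v ⌋} λ v e → cover₂ v (⌊⌋-sound (rest₁? v) e)) ⟩
  count X + (count (λ v → ⌊ v ∈? take t ws ⌋) + count (λ v → ⌊ rest₂? v ⌋))
                                                           ≤⟨ +-monoʳ-≤ (count X) (+-mono-≤ (≤-trans (count-∈ (take t ws)) (≤-trans (≤-reflexive (length-take t ws)) (m⊓n≤m t _)))
                                                                (count-union {P = singleton z} {Q = λ v → ⌊ deep? v ⌋} λ v e → cover₃ v (⌊⌋-sound (rest₂? v) e))) ⟩
  count X + (t + (count (singleton z) + count (λ v → ⌊ deep? v ⌋)))
                                                           ≤⟨ +-monoʳ-≤ (count X) (+-monoʳ-≤ t (+-mono-≤ (count-unique λ i j a b → trans (⌊⌋-sound (i Fin.≟ z) a) (≡.sym (⌊⌋-sound (j Fin.≟ z) b))) deep-count)) ⟩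
  count X + (t + (1 + count X))  ∎)
  where
  open ≤-Reasoning
  open Stack st
  A′ : BRel n
  A′ = restrict S A
  deep? : ∀ v → Dec (v ∈ drop t ws × ∃ λ y → X y ≡ true × A′ y v ≡ true)
  deep? v = (v ∈? drop t ws) ×-dec any? λ y → (X y ≟ᵇ true) ×-dec (A′ y v ≟ᵇ true)
  rest₂? : ∀ v → Dec (v ≡ z ⊎ (v ∈ drop t ws × ∃ λ y → X y ≡ true × A′ y v ≡ true))
  rest₂? v = (v Fin.≟ z) ⊎-dec deep? v
  rest₁? : ∀ v → Dec (v ∈ take t ws ⊎ v ≡ z ⊎ (v ∈ drop t ws × ∃ λ y → X y ≡ true × A′ y v ≡ true))
  rest₁? v = (v ∈? take t ws) ⊎-dec rest₂? v
  cover₁ : ∀ v → S v ≡ true × (X v ≡ true ⊎ ∃ λ u → X u ≡ true × A u v ≡ true) → X v ≡ true ⊎ ⌊ rest₁? v ⌋ ≡ true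
  cover₁ v (_ , inj₁ e) = inj₁ e
  cover₁ v (Sv , inj₂ (u , Xu , a)) with closed Xu (restrict-intro S A (X⊆S u Xu) Sv a)
  ... | inj₁ e = inj₁ e
  ... | inj₂ (inj₂ eq) = inj₂ (⌊⌋-complete (rest₁? v) (inj₂ (inj₁ eq)))
  ... | inj₂ (inj₁ m) with ∈-++⁻ (take t ws) (subst (v ∈_) (≡.sym (take++drop≡id t ws)) m)
  ...  | inj₁ m′ = inj₂ (⌊⌋-complete (rest₁? v) (inj₁ m′))
  ...  | inj₂ m′ = inj₂ (⌊⌋-complete (rest₁? v) (inj₂ (inj₂ (m′ , u , Xu , restrict-intro S A (X⊆S u Xu) Sv a))))
  cover₂ : ∀ v → v ∈ take t ws ⊎ v ≡ z ⊎ (v ∈ drop t ws × ∃ λ y → X y ≡ true × A′ y v ≡ true) → ⌊ v ∈? take t ws ⌋ ≡ true ⊎ ⌊ rest₂? v ⌋ ≡ true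
  cover₂ v (inj₁ m) = inj₁ (⌊⌋-complete (v ∈? take t ws) m)
  cover₂ v (inj₂ s) = inj₂ (⌊⌋-complete (rest₂? v) s)
  cover₃ : ∀ v → v ≡ z ⊎ (v ∈ drop t ws × ∃ λ y → X y ≡ true × A′ y v ≡ true) → singleton z v ≡ true ⊎ ⌊ deep? v ⌋ ≡ true
  cover₃ v (inj₁ eq) = inj₁ (⌊⌋-complete (v Fin.≟ z) eq)
  cover₃ v (inj₂ s) = inj₂ (⌊⌋-complete (deep? v) s)
  D? : ∀ v y → Dec (v ∈ drop t ws × X y ≡ true × A′ y v ≡ true)
  D? v y = (v ∈? drop t ws) ×-dec (X y ≟ᵇ true) ×-dec (A′ y v ≟ᵇ true)
  D : BRel n
  D v y = ⌊ D? v y ⌋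
  -- Every deep vertex has a neighbour in `X`, while `none` allows each vertex of `X` only one deep
  -- neighbour; the pairs in `D` are counted both ways.
  deep-count : count (λ v → ⌊ deep? v ⌋) ≤ count X
  deep-count = begin
    count (λ v → ⌊ deep? v ⌋)  ≤⟨ sum-mono (λ v → row v (deep? v)) ⟩
    count₂ D  ≡⟨ count₂-transpose D ⟨
    count₂ (λ y v → D v y)  ≤⟨ sum-mono (λ y → count-unique-in (X y) (λ v e → proj₁ (proj₂ (⌊⌋-sound (D? v y) e))) (uniq y)) ⟩
    count X  ∎
    where
    row : ∀ v (d : Dec (v ∈ drop t ws × ∃ λ y → X y ≡ true × A′ y v ≡ true)) → ⟦ ⌊ d ⌋ ⟧ ≤ count (D v)
    row v (no _) = z≤n
    row v (yes (m , y , Xy , a)) = count-pos {P = D v} y (⌊⌋-complete (D? v y) (m , Xy , a))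
    uniq : ∀ y v v′ → D v y ≡ true → D v′ y ≡ true → v ≡ v′
    uniq y v v′ e e′ with ⌊⌋-sound (D? v y) e | ⌊⌋-sound (D? v′ y) e′ | v Fin.≟ v′
    ... | _ | _ | yes eq = eq
    ... | m , Xy , a | m′ , _ , a′ | no ne = ⊥-elim (none (y , v , v′ , Xy , m , m′ , ne , a , a′))

-- Origin of the factor 7: with `t = 2 * N + 2` the bound of `nbhd-stack` is 2x + 2N + 3, where N ≤
-- x and 1 ≤ x.
few-neighbours : ∀ N x b → 1 ≤ N → N ≤ x → b ≤ x + (2 * N + 2 + (1 + x)) → b ≤ 7 * x
few-neighbours N x b 1≤N N≤x few = begin
  b  ≤⟨ few ⟩
  x + (2 * N + 2 + (1 + x))  ≡⟨ solve 2 (λ x m → x :+ (con 2 :* m :+ con 2 :+ (con 1 :+ x)) := con 2 :* x :+ con 2 :* m :+ con 3) refl x N ⟩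
  2 * x + 2 * N + 3  ≤⟨ +-mono-≤ (+-monoʳ-≤ (2 * x) (*-monoʳ-≤ 2 N≤x)) (*-monoʳ-≤ 3 (≤-trans 1≤N N≤x)) ⟩
  2 * x + 2 * x + 3 * x  ≡⟨ solve 1 (λ x → con 2 :* x :+ con 2 :* x :+ con 3 :* x := con 7 :* x) refl x ⟩
  7 * x  ∎
  where
  open ≤-Reasoning
  open +-*-Solver

-- The component of `z` contains its own neighbourhood, hence does not expand and has more than
-- `2 * N` vertices. This lets the search start from `z` alone; the set that it returns contradicts
-- expansion unless it yields a long chorded cycle.
expanding⇒chorded-cycle : ∀ {n} {A₀ : BRel n} → Symmetricᵇ A₀ → ∀ {S z} N → 1 ≤ N → S z ≡ true →
  (∀ X → 1 ≤ count X → (∀ v → X v ≡ true → S v ≡ true) → count X ≤ 2 * N → 7 * count X < count (nbhd A₀ S X)) →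
  Σ ℕ λ ν → 2 * N + 2 ≤ ν × ChordedCycle A₀ ν
expanding⇒chorded-cycle {n} {A₀} sy₀ {S} {z} N 1≤N Sz expand with component (restrict S A₀) z
... | Z , Zz , closedZ , reach = result
  where
  H : BRel n
  H = restrict S A₀
  sy : Symmetricᵇ H
  sy = restrict-sym sy₀ S
  Z⊆S : ∀ v → Z v ≡ true → S v ≡ true
  Z⊆S v e with reverseʷ sy (proj₂ (reach v e))
  ... | _ , [] , _ = Sz
  ... | _ , (a ∷ _) , _ = proj₁ (restrict-elim S A₀ a)
  Z-large : 2 * N < count Z
  Z-large = ≰⇒> λ l → <⇒≱ (expand Z (count-pos {P = Z} z Zz) Z⊆S l)
    (≤-trans (count-mono λ v e → into v (⌊⌋-sound (nbhd? A₀ S Z v) e)) (m≤n*m (count Z) 7))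
    where
    into : ∀ v → S v ≡ true × (Z v ≡ true ⊎ ∃ λ u → Z u ≡ true × A₀ u v ≡ true) → Z v ≡ true
    into v (_ , inj₁ e) = e
    into v (Sv , inj₂ (u , Zu , a)) = closedZ Zu (restrict-intro S A₀ (Z⊆S u Zu) Sv a)
  Y : Fin n → Bool
  Y = Z ∖ singleton z
  Y⊆Z : ∀ v → Y v ≡ true → Z v ≡ true
  Y⊆Z v e = proj₁ (∖-elim {P = Z} {Q = singleton z} v e)
  into-S : ∀ {u v} → H u v ≡ true → restrict S H u v ≡ true
  into-S e with restrict-elim S A₀ e
  ... | a , b , _ = restrict-intro S H a b e
  stack : Stack H z Y
  stack = record
    { v = z ; ws = [] ; walk = [] ; unique = [] ; off = λ _ ()
    ; closed = λ {u} {y} e a → closed₀ y (closedZ (Y⊆Z u e) a) (y Fin.≟ z)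
    ; attach = component-attach sy S z Z (λ zu e → closedZ zu (proj₂ (proj₂ (restrict-elim S H e))))
                 (λ v e → _ , mapʷ into-S (proj₂ (reach v e))) Zz }
    where
    closed₀ : ∀ y → Z y ≡ true → Dec (y ≡ z) → Y y ≡ true ⊎ y ∈ [] ⊎ y ≡ z
    closed₀ y _ (yes eq) = inj₂ (inj₂ eq)
    closed₀ y zy (no ne) = inj₁ (∖-intro {P = Z} {Q = singleton z} y zy λ e → ne (⌊⌋-sound (y Fin.≟ z) e))
  t : ℕ
  t = 2 * N + 2
  result : Σ ℕ λ ν → t ≤ ν × ChordedCycle A₀ ν
  result with dfs sy N 1≤N Y (≤-trans (m≤m+n N (N + 0)) (≤-pred (≤-trans Z-large (count-remove Z z)))) stack
  ... | X , st , N≤X , X≤2N , X⊆Y with nbhd-stack sy₀ t st (≤-trans (s≤s z≤n) (m≤n+m 2 (2 * N))) (λ v e → Z⊆S v (Y⊆Z v (X⊆Y v e)))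
  ...  | inj₁ r = r
  ...  | inj₂ few = ⊥-elim (<⇒≱ (expand X (≤-trans 1≤N N≤X) (λ v e → Z⊆S v (Y⊆Z v (X⊆Y v e))) X≤2N)
            (few-neighbours N (count X) _ 1≤N N≤X few))

long-chorded-cycle : ∀ {n} {A : BRel n} → Symmetricᵇ A → (∀ {u v} → A u v ≡ true → u ≢ v) → Fin n →
  ∀ {g d k} → GirthAtLeast g A → 2 * suc d < g → 1 ≤ k → 224 * k * n ≤ count₂ A →
  Σ ℕ λ ν → 2 * k ^ suc d + 2 ≤ ν × ChordedCycle A ν
long-chorded-cycle {n} {A} sy irr v₀ {g} {d} {k} girth 2d<g 1≤k dense
  with critical-subset A (224 * k) (λ _ → true) (v₀ , refl)
         (≤-trans (≤-reflexive (cong (224 * k *_) (trans (sum-const n 1) (*-identityˡ n)))) dense)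
... | S , _ , (z , Sz) , crit = expanding⇒chorded-cycle sy (k ^ suc d) 1≤N Sz λ X ne X⊆S l →
        expansion sy irr {d = suc d} girth 2d<g 1≤k crit X (count-∃ {P = X} ne) X⊆S (small 1≤N l 15N≤)
  where
  1≤N : 1 ≤ k ^ suc d
  1≤N = ≤-trans (≤-reflexive (≡.sym (^-zeroˡ (suc d)))) (^-monoˡ-≤ (suc d) 1≤k)
  -- The exponent is positive, so one factor 15 survives. It beats the 7 · 2 = 14 that sets of size
  -- up to `2 * N` produce.
  15N≤ : 15 * k ^ suc d ≤ (15 * k) ^ suc d
  15N≤ = ≤-trans (≤-reflexive (≡.sym (*-assoc 15 k (k ^ d)))) (*-monoʳ-≤ (15 * k) (^-monoˡ-≤ d (m≤n*m k 15)))
  small : ∀ {N m M} → 1 ≤ N → m ≤ 2 * N → 15 * N ≤ M → 7 * m < M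
  small {N} {m} {M} 1≤N l h = begin-strict
    7 * m  ≤⟨ *-monoʳ-≤ 7 l ⟩
    7 * (2 * N)  ≡⟨ *-assoc 7 2 N ⟨
    14 * N  <⟨ m<n+m (14 * N) 1≤N ⟩
    15 * N  ≤⟨ h ⟩
    M  ∎
    where open ≤-Reasoning

-- Paths in a cycle with a chord

∸-+-≤ : ∀ x y {m z} → m ≤ z → x + m ≤ z + y → (x ∸ y) + m ≤ z
∸-+-≤ x y {m} {z} m≤z h with ≤-total x y
... | inj₁ x≤y rewrite m≤n⇒m∸n≡0 x≤y = m≤z
... | inj₂ y≤x = +-cancelʳ-≤ y _ z (≤-trans (≤-reflexive (trans (+-assoc (x ∸ y) m y) (trans (cong ((x ∸ y) +_) (+-comm m y))
  (trans (≡.sym (+-assoc (x ∸ y) y m)) (cong (_+ m) (m∸n+n≡m y≤x)))))) h)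

infix 4 _≈[_]_
-- Congruence modulo `m` over ℕ, with multiples added on both sides to avoid subtraction.
_≈[_]_ : ℕ → ℕ → ℕ → Set
x ≈[ m ] y = ∃ λ s → ∃ λ t → x + s * m ≡ y + t * m

module Congruence (m : ℕ) where
  open +-*-Solver
  ≈-refl : ∀ {x y} → x ≡ y → x ≈[ m ] y
  ≈-refl e = 0 , 0 , cong (_+ 0) e

  ≈-sym : ∀ {x y} → x ≈[ m ] y → y ≈[ m ] x
  ≈-sym (s , t , e) = t , s , ≡.sym e

  ≈-+ : ∀ {x y z w} → x ≈[ m ] y → z ≈[ m ] w → x + z ≈[ m ] y + w
  ≈-+ {x} {y} {z} {w} (s , t , e) (s′ , t′ , e′) = s + s′ , t + t′ , trans (shuffle x z s s′) (trans (cong₂ _+_ e e′) (≡.sym (shuffle y w t t′)))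
    where
    shuffle : ∀ x z s s′ → x + z + (s + s′) * m ≡ x + s * m + (z + s′ * m)
    shuffle x z s s′ = solve 5 (λ x z s s′ m → x :+ z :+ (s :+ s′) :* m := x :+ s :* m :+ (z :+ s′ :* m)) refl x z s s′ m

  ≈-cancel : ∀ z {x y} → x + z ≈[ m ] y + z → x ≈[ m ] y
  ≈-cancel z {x} {y} (s , t , e) = s , t , +-cancelʳ-≡ z _ _ (trans (shuffle x s) (trans e (≡.sym (shuffle y t))))
    where
    shuffle : ∀ x s → x + s * m + z ≡ x + z + s * m
    shuffle x s = solve 3 (λ x z sm → x :+ sm :+ z := x :+ z :+ sm) refl x z (s * m)

  ≈-trans : ∀ {x y z} → x ≈[ m ] y → y ≈[ m ] z → x ≈[ m ] z
  ≈-trans {x} {y} {z} p q = ≈-cancel y (≈-trans′ (≈-+ p q))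
    where
    ≈-trans′ : x + y ≈[ m ] y + z → x + y ≈[ m ] z + y
    ≈-trans′ (s , t , e) = s , t , trans e (cong (_+ t * m) (+-comm y z))

  multiple : ∀ {x} → m ∣ x → x ≈[ m ] 0
  multiple (divides q e) = 0 , q , trans (+-identityʳ _) e

  complement : ∀ {x} y → x ≈[ m ] 0 → x + y ≈[ m ] y
  complement y p = ≈-+ p (≈-refl {y} refl)

-- A window of `suc m₀` consecutive numbers contains the residue -u: raise `a₀` until its sum with
-- `u` is divisible.
hit : ∀ m₀ a₀ u → ∃ λ a → a₀ ≤ a × a < a₀ + suc m₀ × a + u ≈[ suc m₀ ] 0
hit m₀ a₀ u = a₀ + s , m≤m+n a₀ s , +-monoʳ-< a₀ (s≤s (m∸n≤m m₀ ρ)) , 1 , suc q , eq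
  where
  open +-*-Solver
  m = suc m₀
  v = a₀ + (u + m₀)
  ρ = v % m
  q = v / m
  s = m₀ ∸ ρ
  eq : a₀ + s + u + 1 * m ≡ 0 + suc q * m
  eq = trans (solve 4 (λ a s u n → a :+ s :+ u :+ con 1 :* (con 1 :+ n) := a :+ (u :+ n) :+ s :+ con 1) refl a₀ s u m₀)
    (trans (cong (λ z → z + s + 1) (m≡m%n+[m/n]*n v m))
    (trans (solve 3 (λ r w s → r :+ w :+ s :+ con 1 := con 1 :+ (r :+ s) :+ w) refl ρ (q * m) s)
    (cong (λ z → suc z + q * m) (m+[n∸m]≡n (≤-pred (m%n<n v m))))))

module ChordPaths {n} {A : BRel n} (sy : Symmetricᵇ A) {ν} (C : ChordedCycle A ν) where
  open ChordedCycle C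

  private instance
    ν-nonZero : NonZero ν
    ν-nonZero = >-nonZero (≤-trans (s≤s z≤n) (≤-trans (m≤n+m 2 r) r+2≤ν))

  per* : ∀ k x → c (x + k * ν) ≡ c x
  per* zero x = cong c (+-identityʳ x)
  per* (suc k) x = trans (cong c (trans (cong (x +_) (+-comm ν (k * ν))) (≡.sym (+-assoc x (k * ν) ν)))) (trans (per (x + k * ν)) (per* k x))

  c-mod : ∀ x → c x ≡ c (x % ν)
  c-mod x = trans (cong c (m≡m%n+[m/n]*n x ν)) (per* (x / ν) (x % ν))

  private
    inj-≤ : ∀ {i j} → i ≤ j → j < i + ν → c i ≡ c j → i ≡ j
    inj-≤ {i} {j} i≤j j< e with inj (m%n<n i ν) (m%n<n j ν) (trans (≡.sym (c-mod i)) (trans e (c-mod j))) | i / ν ℕₚ.≟ j / ν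
    ... | eq | yes q = trans (m≡m%n+[m/n]*n i ν) (trans (cong₂ _+_ eq (cong (_* ν) q)) (≡.sym (m≡m%n+[m/n]*n j ν)))
    ... | eq | no q = ⊥-elim (<⇒≱ j< (begin
        i + ν  ≡⟨ cong (_+ ν) (m≡m%n+[m/n]*n i ν) ⟩
        i % ν + i / ν * ν + ν  ≡⟨ trans (+-assoc (i % ν) _ ν) (cong (i % ν +_) (+-comm _ ν)) ⟩
        i % ν + suc (i / ν) * ν  ≤⟨ +-mono-≤ (≤-reflexive eq) (*-monoˡ-≤ ν (≤∧≢⇒< (/-monoˡ-≤ ν i≤j) q)) ⟩
        j % ν + j / ν * ν  ≡⟨ m≡m%n+[m/n]*n j ν ⟨
        j  ∎))
      where open ≤-Reasoning

  Interval : ℕ → ℕ → Fin n → Set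
  Interval x l v = ∃ λ s → s < l × v ≡ c (s + x)

  -- The free parameter `z` starts a window of `ν` consecutive indices that contains both intervals
  -- and on which `c` is injective.
  disjoint : ∀ z {x l y m v} → z ≤ x → x + l ≤ y → y + m ≤ z + ν → Interval x l v → Interval y m v → ⊥
  disjoint z {x} {l} {y} {m} z≤x xl ym (s , s<l , e) (t , t<m , e′) = <⇒≢ lt (inj-≤ (<⇒≤ lt) close (trans (≡.sym e) e′))
    where
    lt : s + x < t + y
    lt = ≤-trans (≤-trans (+-monoˡ-≤ x s<l) (≤-trans (≤-reflexive (+-comm l x)) xl)) (m≤n+m y t)
    close : t + y < s + x + ν
    close = ≤-trans (+-monoˡ-≤ y t<m) (≤-trans (≤-reflexive (+-comm m y)) (≤-trans ym (+-monoˡ-≤ ν (≤-trans z≤x (m≤n+m x s)))))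

  asc dsc : ℕ → ℕ → List (Fin n)
  asc zero x = []
  asc (suc l) x = asc l x ++ [ c (l + x) ]
  dsc zero x = []
  dsc (suc l) x = c (l + x) ∷ dsc l x

  ascʷ : ∀ l x → Walk A (c x) (c (l + x)) (asc l x)
  ascʷ zero x = []
  ascʷ (suc l) x = ascʷ l x ++ʷ (edge (l + x) ∷ [])

  ascʷ-to : ∀ l x {w} → A (c (l + x)) w ≡ true → Walk A (c x) w (asc (suc l) x)
  ascʷ-to l x e = ascʷ l x ++ʷ (e ∷ [])

  dscʷ : ∀ l x → Walk A (c (l + x)) (c x) (dsc l (suc x))
  dscʷ zero x = []
  dscʷ (suc l) x = subst (λ i → Walk A (c (suc (l + x))) (c x) (c i ∷ dsc l (suc x))) (≡.sym (+-suc l x)) (sy (edge (l + x)) ∷ dscʷ l x)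

  dscʷ-to : ∀ l x {w} → A (c x) w ≡ true → Walk A (c (l + x)) w (dsc (suc l) x)
  dscʷ-to zero x e = e ∷ []
  dscʷ-to (suc l) x e = sy (edge (l + x)) ∷ dscʷ-to l x e

  ∈-asc : ∀ l x {v} → v ∈ asc l x → Interval x l v
  ∈-asc (suc l) x m with ∈-++⁻ (asc l x) m
  ... | inj₂ (here e) = l , ≤-refl , e
  ... | inj₁ m′ with ∈-asc l x m′
  ...  | s , s<l , e = s , m≤n⇒m≤1+n s<l , e

  ∈-dsc : ∀ l x {v} → v ∈ dsc l x → Interval x l v
  ∈-dsc (suc l) x (here e) = l , ≤-refl , e
  ∈-dsc (suc l) x (there m′) with ∈-dsc l x m′
  ... | s , s<l , e = s , m≤n⇒m≤1+n s<l , e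

  private
    next : ∀ l x {v} → l < ν → v ≡ c (l + x) → Interval x l v → ⊥
    next l x l<ν e i = disjoint x {x} {l} {l + x} {1} ≤-refl (≤-reflexive (+-comm x l))
      (≤-trans (≤-reflexive (+-comm (l + x) 1)) (≤-trans (≤-reflexive (+-comm (suc l) x)) (+-monoʳ-≤ x l<ν))) i (0 , s≤s z≤n , e)

  asc-Unique : ∀ l x → l ≤ ν → Unique (asc l x)
  asc-Unique zero x _ = []
  asc-Unique (suc l) x h = Unique-++ (asc-Unique l x (<⇒≤ h)) (Unique-∷ (λ ()) []) λ { m (here e) → next l x h e (∈-asc l x m) }

  dsc-Unique : ∀ l x → l ≤ ν → Unique (dsc l x)
  dsc-Unique zero x _ = []
  dsc-Unique (suc l) x h = Unique-∷ (λ m → next l x h refl (∈-dsc l x m)) (dsc-Unique l x (<⇒≤ h))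

  length-asc : ∀ l x → length (asc l x) ≡ l
  length-asc zero x = refl
  length-asc (suc l) x = trans (length-++ (asc l x)) (trans (+-comm _ 1) (cong suc (length-asc l x)))

  length-dsc : ∀ l x → length (dsc l x) ≡ l
  length-dsc zero x = refl
  length-dsc (suc l) x = cong suc (length-dsc l x)

  record ChordPath (x y ℓ : ℕ) : Set where
    field
      fs  : List (Fin n)
      walk  : Walk A (c x) (c y) fs
      unique : Unique fs
      end∉  : c y ∉ fs
      range  : ∀ {v} → v ∈ fs → ∃ λ i → v ≡ c i
      len  : length fs ≡ ℓ

  along : ∀ ℓ x → ℓ < ν → ChordPath x (ℓ + x) ℓ
  along ℓ x ℓ<ν = record
    { fs = asc ℓ x ; walk = ascʷ ℓ x ; unique = asc-Unique ℓ x (<⇒≤ ℓ<ν)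
    ; end∉ = λ m → next ℓ x ℓ<ν refl (∈-asc ℓ x m)
    ; range = λ m → let s , _ , e = ∈-asc ℓ x m in s + x , e
    ; len = length-asc ℓ x }

  private
    two-pieces : ∀ {x y i k j l} fs gs → Walk A (c x) (c y) (fs ++ gs) → Unique fs → Unique gs →
      (∀ {v} → v ∈ fs → Interval i k v) → (∀ {v} → v ∈ gs → Interval j l v) → length fs ≡ k → length gs ≡ l →
      (∀ {v} → Interval i k v → Interval j l v → ⊥) → (∀ {v} → Interval i k v → Interval y 1 v → ⊥) →
      (∀ {v} → Interval j l v → Interval y 1 v → ⊥) → ChordPath x y (k + l)
    two-pieces fs gs w uf ug If Ig lf lg d d₁ d₂ = record
      { fs = fs ++ gs ; walk = w ; unique = Unique-++ uf ug λ m m′ → d (If m) (Ig m′)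
      ; end∉ = λ m → [ (λ k → d₁ (If k) (0 , s≤s z≤n , refl)) , (λ k → d₂ (Ig k) (0 , s≤s z≤n , refl)) ]′ (∈-++⁻ fs m)
      ; range = λ m → [ (λ k → let s , _ , e = If k in _ , e) , (λ k → let s , _ , e = Ig k in _ , e) ]′ (∈-++⁻ fs m)
      ; len = trans (length-++ fs) (cong₂ _+_ lf lg) }

    from-left : ∀ {a a′} → a + a′ ≡ ν → A (c (a + a′)) (c r) ≡ true
    from-left e = subst (λ z → A z (c r) ≡ true) (≡.sym (trans (cong c e) (per 0))) chord

  -- The four ways through the chord: reach vertex 0 from below (index a′ = ν − a) or from above (index a),
  -- and leave r downwards (to b′ = r − b) or upwards (to b + r).
  left-down : ∀ {a a′ b b′} → a + a′ ≡ ν → b + b′ ≡ r → r < a′ → 1 ≤ b′ → ChordPath a′ b′ (suc a + b)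
  left-down {a} {a′} {b} {b′} ea eb r<a′ 1≤b′ = two-pieces {i = a′} {j = suc b′} (asc (suc a) a′) (dsc b (suc b′))
    (ascʷ-to a a′ (from-left {a} {a′} ea) ++ʷ subst (λ z → Walk A (c z) (c b′) (dsc b (suc b′))) eb (dscʷ b b′))
    (asc-Unique (suc a) a′ a<ν) (dsc-Unique b (suc b′) b≤ν) (∈-asc (suc a) a′) (∈-dsc b (suc b′)) (length-asc (suc a) a′) (length-dsc b (suc b′))
    (λ p q → disjoint 1 {suc b′} {b} {a′} {suc a} (s≤s z≤n) (≤-trans (≤-reflexive (cong suc (trans (+-comm b′ b) eb))) r<a′) top q p)
    (λ p q → disjoint 1 {b′} {1} {a′} {suc a} 1≤b′ (≤-trans (≤-reflexive (+-comm b′ 1)) (≤-trans (s≤s (≤-trans (m≤n+m b′ b) (≤-reflexive eb))) r<a′)) top q p)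
    (λ p q → disjoint 1 {b′} {1} {suc b′} {b} 1≤b′ (≤-reflexive (+-comm b′ 1))
       (s≤s (≤-trans (≤-reflexive (trans (+-comm b′ b) eb)) (≤-trans (m≤m+n r 2) r+2≤ν))) q p)
    where
    a<ν : suc a ≤ ν
    a<ν = ≤-trans (≤-trans (≤-reflexive (+-comm 1 a)) (+-monoʳ-≤ a (≤-trans (s≤s z≤n) r<a′))) (≤-reflexive ea)
    b≤ν : b ≤ ν
    b≤ν = ≤-trans (≤-trans (m≤m+n b b′) (≤-reflexive eb)) (≤-trans (m≤m+n r 2) r+2≤ν)
    top : a′ + suc a ≤ 1 + ν
    top = ≤-reflexive (trans (+-suc a′ a) (cong suc (trans (+-comm a′ a) ea)))

  right-up : ∀ {a b} → a < r → b + r < ν → ChordPath a (b + r) (suc a + b)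
  right-up {a} {b} a<r br<ν = two-pieces {i = 0} {j = r} (dsc (suc a) 0) (asc b r)
    (subst (λ z → Walk A (c z) (c r) (dsc (suc a) 0)) (+-identityʳ a) (dscʷ-to a 0 chord) ++ʷ ascʷ b r)
    (dsc-Unique (suc a) 0 (≤-trans a<r r≤ν)) (asc-Unique b r (≤-trans (m≤m+n b r) (<⇒≤ br<ν)))
    (∈-dsc (suc a) 0) (∈-asc b r) (length-dsc (suc a) 0) (length-asc b r)
    (λ p q → disjoint 0 {0} {suc a} {r} {b} z≤n a<r (≤-trans (≤-reflexive (+-comm r b)) (<⇒≤ br<ν)) p q)
    (λ p q → disjoint 0 {0} {suc a} {b + r} {1} z≤n (≤-trans a<r (m≤n+m r b)) (≤-trans (≤-reflexive (+-comm _ 1)) br<ν) p q)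
    (λ p q → disjoint 0 {r} {b} {b + r} {1} z≤n (≤-reflexive (+-comm r b)) (≤-trans (≤-reflexive (+-comm _ 1)) br<ν) p q)
    where
    r≤ν : r ≤ ν
    r≤ν = ≤-trans (m≤m+n r 2) r+2≤ν

  left-up : ∀ {a a′ b} → a + a′ ≡ ν → b + r < a′ → ChordPath a′ (b + r) (suc a + b)
  left-up {a} {a′} {b} ea br<a′ = two-pieces {i = a′} {j = r} (asc (suc a) a′) (asc b r)
    (ascʷ-to a a′ (from-left {a} {a′} ea) ++ʷ ascʷ b r)
    (asc-Unique (suc a) a′ a<ν) (asc-Unique b r (≤-trans (≤-trans (m≤m+n b r) (<⇒≤ br<a′)) a′≤ν))
    (∈-asc (suc a) a′) (∈-asc b r) (length-asc (suc a) a′) (length-asc b r)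
    (λ p q → disjoint r {r} {b} {a′} {suc a} ≤-refl (≤-trans (≤-reflexive (+-comm r b)) (<⇒≤ br<a′)) top q p)
    (λ p q → disjoint r {b + r} {1} {a′} {suc a} (m≤n+m r b) (≤-trans (≤-reflexive (+-comm _ 1)) br<a′) top q p)
    (λ p q → disjoint r {r} {b} {b + r} {1} ≤-refl (≤-reflexive (+-comm r b)) (≤-trans (≤-reflexive (+-comm _ 1)) (≤-trans br<a′ (≤-trans a′≤ν (m≤n+m ν r)))) p q)
    where
    a′≤ν : a′ ≤ ν
    a′≤ν = ≤-trans (m≤n+m a′ a) (≤-reflexive ea)
    a<ν : suc a ≤ ν
    a<ν = ≤-trans (≤-trans (≤-reflexive (+-comm 1 a)) (+-monoʳ-≤ a (≤-trans (s≤s z≤n) br<a′))) (≤-reflexive ea)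
    top : a′ + suc a ≤ r + ν
    top = ≤-trans (≤-reflexive (trans (+-suc a′ a) (cong suc (trans (+-comm a′ a) ea)))) (+-monoˡ-≤ ν (≤-trans (s≤s z≤n) 2≤r))

  right-down : ∀ {a b b′} → b + b′ ≡ r → a < b′ → ChordPath a b′ (suc a + b)
  right-down {a} {b} {b′} eb a<b′ = two-pieces {i = 0} {j = suc b′} (dsc (suc a) 0) (dsc b (suc b′))
    (subst (λ z → Walk A (c z) (c r) (dsc (suc a) 0)) (+-identityʳ a) (dscʷ-to a 0 chord) ++ʷ
      subst (λ z → Walk A (c z) (c b′) (dsc b (suc b′))) eb (dscʷ b b′))
    (dsc-Unique (suc a) 0 (≤-trans a<b′ b′≤ν)) (dsc-Unique b (suc b′) (≤-trans (≤-trans (m≤m+n b b′) (≤-reflexive eb)) r≤ν))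
    (∈-dsc (suc a) 0) (∈-dsc b (suc b′)) (length-dsc (suc a) 0) (length-dsc b (suc b′))
    (λ p q → disjoint 0 {0} {suc a} {suc b′} {b} z≤n (m≤n⇒m≤1+n a<b′) top p q)
    (λ p q → disjoint 0 {0} {suc a} {b′} {1} z≤n a<b′ (≤-trans (≤-reflexive (+-comm b′ 1)) (≤-trans (s≤s b′≤r) r<ν)) p q)
    (λ p q → disjoint 0 {b′} {1} {suc b′} {b} z≤n (≤-reflexive (+-comm b′ 1)) top q p)
    where
    r≤ν : r ≤ ν
    r≤ν = ≤-trans (m≤m+n r 2) r+2≤ν
    r<ν : suc r ≤ ν
    r<ν = ≤-trans (≤-trans (≤-reflexive (+-comm 1 r)) (+-monoʳ-≤ r (s≤s z≤n))) r+2≤ν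
    b′≤r : b′ ≤ r
    b′≤r = ≤-trans (m≤n+m b′ b) (≤-reflexive eb)
    b′≤ν : b′ ≤ ν
    b′≤ν = ≤-trans b′≤r r≤ν
    top : suc b′ + b ≤ ν
    top = ≤-trans (≤-reflexive (cong suc (trans (+-comm b′ b) eb))) r<ν

-- Bondy–Simonovits: a colouring of a cycle with a chord for which no path of length ℓ joins distinct colours
-- has its least period m dividing ν and ℓ.  If the chord cuts off fewer than m vertices it yields a shorter period;
-- otherwise paths through the chord give two reflections whose composition is translation by 2.
module PathColours {n} {A : BRel n} (sy : Symmetricᵇ A) {ν} (C : ChordedCycle A ν)
  (χ : ℕ → Bool) (χ-per : ∀ x → χ (x + ν) ≡ χ x) {ℓ} (1≤ℓ : 1 ≤ ℓ) (ℓ<ν : ℓ < ν)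
  (same : ∀ {x y} → ChordPaths.ChordPath sy C x y ℓ → χ x ≡ χ y) where
  open ChordedCycle C using (r; 2≤r; r+2≤ν)
  open ChordPaths sy C
  open +-*-Solver

  Period : ℕ → Set
  Period m = ∀ x → χ (x + m) ≡ χ x

  private
    instance
      ν-nonZero : NonZero ν
      ν-nonZero = >-nonZero (≤-trans (s≤s z≤n) (≤-trans (m≤n+m 2 r) r+2≤ν))

    multiples : ∀ {m} → Period m → ∀ k x → χ (x + k * m) ≡ χ x
    multiples p zero x = cong χ (+-identityʳ x)
    multiples {m} p (suc k) x = trans (cong χ (trans (cong (x +_) (+-comm m (k * m))) (≡.sym (+-assoc x (k * m) m)))) (trans (p (x + k * m)) (multiples p k x))

    period? : ∀ m → Dec (Period m)
    period? m = map′ (λ h x → trans (reduce x m) (trans (reindex h x) (≡.sym (mod x)))) (λ p x → p (toℕ x))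
      (all? {n = ν} λ x → χ (toℕ x + m) ≟ᵇ χ (toℕ x))
      where
      mod : ∀ x → χ x ≡ χ (x % ν)
      mod x = trans (cong χ (m≡m%n+[m/n]*n x ν)) (multiples χ-per (x / ν) (x % ν))
      reduce : ∀ x m → χ (x + m) ≡ χ (x % ν + m)
      reduce x m = trans (cong χ (trans (cong (_+ m) (m≡m%n+[m/n]*n x ν))
        (solve 3 (λ a b c → a :+ b :+ c := a :+ c :+ b) refl (x % ν) (x / ν * ν) m))) (multiples χ-per (x / ν) (x % ν + m))
      reindex : (∀ (x : Fin ν) → χ (toℕ x + m) ≡ χ (toℕ x)) → ∀ x → χ (x % ν + m) ≡ χ (x % ν)
      reindex h x = subst (λ i → χ (i + m) ≡ χ i) (Finₚ.toℕ-fromℕ< (m%n<n x ν)) (h (Fin.fromℕ< (m%n<n x ν)))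

    minimal : ∃ λ m₀ → Period (suc m₀) × (∀ {j} → j < m₀ → ¬ Period (suc j))
    minimal with least (period? ∘ suc) {ν ∸ 1} (subst Period (≡.sym (m+[n∸m]≡n {1} {ν} (≤-trans (s≤s z≤n) (≤-trans (m≤n+m 2 r) r+2≤ν)))) χ-per)
    ... | m₀ , _ , p , min = m₀ , p , min

  module _ (m₀ : ℕ) (per-m : Period (suc m₀)) (min : ∀ {j} → j < m₀ → ¬ Period (suc j)) where
   private
    m : ℕ
    m = suc m₀

    no-smaller : ∀ {p} → 1 ≤ p → p < m → ¬ Period p
    no-smaller {suc p} _ (s≤s l) = min l

    -- The remainder of a period modulo the least one is again a period, hence zero.
    m∣period : ∀ p → Period p → m ∣ p
    m∣period p per with p % m in eq
    ... | zero = divides (p / m) (trans (m≡m%n+[m/n]*n p m) (cong (_+ p / m * m) eq))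
    ... | suc q = ⊥-elim (no-smaller {p % m} (subst (1 ≤_) (≡.sym eq) (s≤s z≤n)) (m%n<n p m) λ x →
      trans (≡.sym (multiples per-m (p / m) (x + p % m))) (trans (cong χ (trans (+-assoc x _ _) (cong (x +_) (≡.sym (m≡m%n+[m/n]*n p m))))) (per x)))

    open Congruence m

    resp : ∀ {x y} → x ≈[ m ] y → χ x ≡ χ y
    resp {x} {y} (s , t , e) = trans (≡.sym (multiples per-m s x)) (trans (cong χ e) (multiples per-m t y))

    m∣ν : m ∣ ν
    m∣ν = m∣period ν χ-per

    -- Paths along the cycle itself, without the chord, make `ℓ` a period.
    m∣ℓ : m ∣ ℓ
    m∣ℓ = m∣period ℓ λ x → trans (cong χ (+-comm x ℓ)) (≡.sym (same (along ℓ x ℓ<ν)))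

    ν≈0 : ν ≈[ m ] 0
    ν≈0 = multiple m∣ν
    ℓ≈0 : ℓ ≈[ m ] 0
    ℓ≈0 = multiple m∣ℓ

    m≤ℓ : m ≤ ℓ
    m≤ℓ = ∣⇒≤ {{>-nonZero 1≤ℓ}} m∣ℓ

    ℓ+m≤ν : ℓ + m ≤ ν
    ℓ+m≤ν with m∣ν | m∣ℓ
    ... | divides μ eν | divides κ eℓ = ≡.subst₂ _≤_ (trans (+-comm m (κ * m)) (cong (_+ m) (≡.sym eℓ))) (≡.sym eν)
      (*-monoˡ-≤ m (*-cancelʳ-< m κ μ (≡.subst₂ _<_ eℓ eν ℓ<ν)))

    opposite : ∀ a₀ u → ∃ λ a → a₀ ≤ a × a < a₀ + m × a + u ≈[ m ] 0
    opposite = hit m₀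

    equal : ∀ a₀ u → ∃ λ a → a₀ ≤ a × a < a₀ + m × a ≈[ m ] u
    equal a₀ u with hit m₀ a₀ (u * m₀)
    ... | a , lo , hi , e = a , lo , hi , ≈-cancel (u * m₀) (≈-trans e (≈-sym (multiple (divides u (solve 2 (λ u n → u :+ u :* n := u :* (con 1 :+ n)) refl u m₀)))))

    complement-ν : ∀ {a a′ u} → a + a′ ≡ ν → a + u ≈[ m ] 0 → a′ ≈[ m ] u
    complement-ν {a} {a′} {u} ea h = ≈-cancel a (≈-trans (≈-refl (trans (+-comm a′ a) ea)) (≈-trans ν≈0 (≈-sym (≈-trans (≈-refl (+-comm u a)) h))))

    ∃∸ : ∀ {a b} → a ≤ b → ∃ λ d → a + d ≡ b
    ∃∸ {a} {b} l = b ∸ a , m+[n∸m]≡n l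

    -- For a ≡ -u, the path from index ν - a up to 0, over the chord and up from `r` joins the
    -- residues u and u + r - 1. So `r ∸ 1` would be a positive period below the least one.
    short-left : r < m → ⊥
    short-left r<m = no-smaller {r ∸ 1} (∸-monoˡ-≤ 1 2≤r) (≤-trans (s≤s (m∸n≤m r 1)) r<m) (λ u → choose u (opposite 0 u))
      where
      er : 1 + (r ∸ 1) ≡ r
      er = m+[n∸m]≡n {1} {r} (≤-trans (s≤s z≤n) 2≤r)
      transfer : ∀ u {a b a′} → a + u ≈[ m ] 0 → suc a + b ≡ ℓ → a + a′ ≡ ν → χ (u + (r ∸ 1)) ≡ χ u
      transfer u {a} {b} {a′} h eb ea = trans (≡.sym (resp target))
          (trans (≡.sym (same (subst (ChordPath a′ (b + r)) eb (left-up ea b+r<a′)))) (resp (complement-ν ea h)))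
        where
        b+r<a′ : b + r < a′
        b+r<a′ = +-cancelˡ-≤ a (suc (b + r)) a′ (≤-trans (≤-reflexive (solve 3 (λ a b r → a :+ (con 1 :+ (b :+ r)) := con 1 :+ a :+ b :+ r) refl a b r))
          (≤-trans (≤-reflexive (cong (_+ r) eb)) (≤-trans (+-monoʳ-≤ ℓ (<⇒≤ r<m)) (≤-trans ℓ+m≤ν (≤-reflexive (≡.sym ea))))))
        target : b + r ≈[ m ] u + (r ∸ 1)
        target = ≈-cancel a (≈-trans (≈-refl (trans (cong (λ z → b + z + a) (≡.sym er)) (solve 3 (λ a b p → b :+ (con 1 :+ p) :+ a := con 1 :+ a :+ b :+ p) refl a b (r ∸ 1))))
          (≈-trans (≈-refl (cong (_+ (r ∸ 1)) eb)) (≈-trans (complement (r ∸ 1) ℓ≈0)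
          (≈-trans (≈-sym (complement (r ∸ 1) h)) (≈-refl (solve 3 (λ a u p → a :+ u :+ p := u :+ p :+ a) refl a u (r ∸ 1)))))))
      choose : ∀ u → (∃ λ a → 0 ≤ a × a < 0 + m × a + u ≈[ m ] 0) → χ (u + (r ∸ 1)) ≡ χ u
      choose u (a , _ , a<m , h) = transfer u h (proj₂ (∃∸ (≤-trans a<m m≤ℓ))) (proj₂ (∃∸ (≤-trans (<⇒≤ a<m) (≤-trans m≤ℓ (<⇒≤ ℓ<ν)))))

    -- For a ≡ u, the path down to 0, over the chord and down from `r` ends at the residue u + r +
    -- 1. So `r + 1` is a period, and with it ν - r - 1, which is positive and less than `m`.
    short-right : ν < r + m → ⊥
    short-right ν<r+m = no-smaller {ρ} 1≤ρ ρ<m λ x → trans (≡.sym (per-r+1 (x + ρ)))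
        (trans (cong χ (trans (+-assoc x ρ (r + 1)) (cong (x +_) (trans (+-comm ρ (r + 1)) eρ)))) (χ-per x))
      where
      ρ : ℕ
      ρ = ν ∸ (r + 1)
      eρ : r + 1 + ρ ≡ ν
      eρ = m+[n∸m]≡n (≤-trans (+-monoʳ-≤ r (s≤s z≤n)) r+2≤ν)
      1≤ρ : 1 ≤ ρ
      1≤ρ = +-cancelˡ-≤ (r + 1) 1 ρ (≤-trans (≤-reflexive (+-assoc r 1 1)) (≤-trans r+2≤ν (≤-reflexive (≡.sym eρ))))
      ρ<m : ρ < m
      ρ<m = +-cancelˡ-≤ r (suc ρ) m (≤-trans (≤-trans (≤-reflexive (≡.sym (+-assoc r 1 ρ))) (≤-reflexive eρ)) (<⇒≤ ν<r+m))
      ℓ<r : ℓ < r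
      ℓ<r = +-cancelʳ-< m ℓ r (≤-trans (s≤s ℓ+m≤ν) ν<r+m)
      transfer : ∀ u {a b b′} → a ≈[ m ] u → suc a + b ≡ ℓ → b + b′ ≡ r → χ (u + (r + 1)) ≡ χ u
      transfer u {a} {b} {b′} h eb eb′ = trans (≡.sym (resp target)) (trans (≡.sym (same (subst (ChordPath a b′) eb (right-down eb′ a<b′)))) (resp h))
        where
        a<b′ : a < b′
        a<b′ = +-cancelʳ-≤ b (suc a) b′ (≤-trans (≤-reflexive eb) (≤-trans (<⇒≤ ℓ<r) (≤-reflexive (trans (≡.sym eb′) (+-comm b b′)))))
        target : b′ ≈[ m ] u + (r + 1)
        target = ≈-trans (≈-sym (complement b′ ℓ≈0)) (≈-trans (≈-refl (cong (_+ b′) (≡.sym eb)))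
          (≈-trans (≈-refl (trans (solve 3 (λ a b b′ → con 1 :+ a :+ b :+ b′ := a :+ (b :+ b′ :+ con 1)) refl a b b′) (cong (λ z → a + (z + 1)) eb′)))
            (≈-+ h (≈-refl {r + 1} refl))))
      choose : ∀ u → (∃ λ a → 0 ≤ a × a < 0 + m × a ≈[ m ] u) → χ (u + (r + 1)) ≡ χ u
      choose u (a , _ , a<m , h) with ∃∸ (≤-trans a<m m≤ℓ)
      ... | b , eb = transfer u h eb (proj₂ (∃∸ (≤-trans (≤-trans (m≤n+m b (suc a)) (≤-reflexive eb)) (<⇒≤ ℓ<r))))
      per-r+1 : Period (r + 1)
      per-r+1 u = choose u (equal 0 u)

    module Long (m≤r : m ≤ r) (r+m≤ν : r + m ≤ ν) where
      r≤ν : r ≤ ν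
      r≤ν = ≤-trans (m≤m+n r m) r+m≤ν

      -- Going up to 0, over the chord and down from `r` sends the residue u to r + 1 - u. Starting
      -- the window for `a` at `ℓ ∸ r` keeps the descent shorter than `r`; its end keeps the ascent
      -- clear of `r`.
      reflect₁ : ∀ {u w} → u + w ≈[ m ] r + 1 → χ u ≡ χ w
      reflect₁ {u} {w} huw = choose (opposite lo u)
        where
        lo : ℕ
        lo = ℓ ∸ r
        lo+m≤ℓ : lo + m ≤ ℓ
        lo+m≤ℓ = ∸-+-≤ ℓ r m≤ℓ (+-monoʳ-≤ ℓ m≤r)
        lo+m+r≤ν : lo + m + r ≤ ν
        lo+m+r≤ν = ≤-trans (+-monoˡ-≤ r (∸-+-≤ ℓ r {m} {ν ∸ r} (≤-trans (≤-reflexive (≡.sym (m+n∸m≡n r m))) (∸-monoˡ-≤ r r+m≤ν))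
          (≤-trans ℓ+m≤ν (≤-reflexive (≡.sym (m∸n+n≡m r≤ν)))))) (≤-reflexive (m∸n+n≡m r≤ν))
        transfer : ∀ {a b a′ b′} → a + u ≈[ m ] 0 → suc a + b ≡ ℓ → a + a′ ≡ ν → b + b′ ≡ r → a + r < ν → b < r → χ u ≡ χ w
        transfer {a} {b} {a′} {b′} h eb ea eb′ a+r<ν b<r =
            trans (≡.sym (resp (complement-ν ea h))) (trans (same (subst (ChordPath a′ b′) eb (left-down ea eb′ r<a′ 1≤b′))) (resp target))
          where
          r<a′ : r < a′
          r<a′ = +-cancelˡ-≤ a (suc r) a′ (≤-trans (≤-reflexive (+-suc a r)) (≤-trans a+r<ν (≤-reflexive (≡.sym ea))))
          1≤b′ : 1 ≤ b′
          1≤b′ = +-cancelˡ-≤ b 1 b′ (≤-trans (≤-reflexive (+-comm b 1)) (≤-trans b<r (≤-reflexive (≡.sym eb′))))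
          target : b′ ≈[ m ] w
          target = ≈-cancel (u + a) (≈-trans (≈-+ (≈-refl {b′} refl) (≈-trans (≈-refl (+-comm u a)) (≈-trans h (≈-sym ℓ≈0))))
            (≈-trans (≈-refl (trans (cong (b′ +_) (≡.sym eb)) (trans (solve 3 (λ a b b′ → b′ :+ (con 1 :+ a :+ b) := b :+ b′ :+ con 1 :+ a) refl a b b′) (cong (λ z → z + 1 + a) eb′))))
            (≈-trans (≈-+ (≈-sym huw) (≈-refl {a} refl)) (≈-refl (solve 3 (λ u w a → u :+ w :+ a := w :+ (u :+ a)) refl u w a)))))
        choose : (∃ λ a → lo ≤ a × a < lo + m × a + u ≈[ m ] 0) → χ u ≡ χ w
        choose (a , lo≤a , a< , h) with ∃∸ (≤-trans a< lo+m≤ℓ)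
        ... | b , eb = transfer h eb (proj₂ (∃∸ (≤-trans (m≤m+n a r) (<⇒≤ a+r<ν)))) (proj₂ (∃∸ (<⇒≤ b<r))) a+r<ν b<r
          where
          a+r<ν : a + r < ν
          a+r<ν = ≤-trans (+-monoˡ-≤ r a<) lo+m+r≤ν
          b<r : b < r
          b<r = +-cancelˡ-≤ a (suc b) r (≤-trans (≤-reflexive (trans (+-suc a b) eb)) (≤-trans (m≤n+m∸n ℓ r) (≤-trans (+-monoʳ-≤ r lo≤a) (≤-reflexive (+-comm r a)))))

      -- Going down to 0, over the chord and up from `r` sends the residue u to r - 1 - u. Starting
      -- the window at `(ℓ + r) ∸ ν` stops the ascent before `ν`; its end keeps `a` below `r`.
      reflect₂ : ∀ {u w} → u + w + 1 ≈[ m ] r → χ u ≡ χ w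
      reflect₂ {u} {w} huw = choose (equal lo u)
        where
        lo : ℕ
        lo = (ℓ + r) ∸ ν
        lo+m≤ℓ : lo + m ≤ ℓ
        lo+m≤ℓ = ∸-+-≤ (ℓ + r) ν m≤ℓ (≤-trans (≤-reflexive (+-assoc ℓ r m)) (+-monoʳ-≤ ℓ r+m≤ν))
        lo+m≤r : lo + m ≤ r
        lo+m≤r = ∸-+-≤ (ℓ + r) ν m≤r (≤-trans (≤-reflexive (solve 3 (λ l r m → l :+ r :+ m := r :+ (l :+ m)) refl ℓ r m)) (+-monoʳ-≤ r ℓ+m≤ν))
        transfer : ∀ {a b} → lo ≤ a → a < lo + m → a ≈[ m ] u → suc a + b ≡ ℓ → χ u ≡ χ w
        transfer {a} {b} lo≤a a< h eb =
            trans (≡.sym (resp h)) (trans (same (subst (ChordPath a (b + r)) eb (right-up (≤-trans a< lo+m≤r) b+r<ν))) (resp target))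
          where
          b+r<ν : b + r < ν
          b+r<ν = +-cancelˡ-≤ a (suc (b + r)) ν (≤-trans (≤-reflexive (solve 3 (λ a b r → a :+ (con 1 :+ (b :+ r)) := con 1 :+ a :+ b :+ r) refl a b r))
            (≤-trans (≤-reflexive (cong (_+ r) eb)) (≤-trans (m≤n+m∸n (ℓ + r) ν) (≤-trans (+-monoʳ-≤ ν lo≤a) (≤-reflexive (+-comm ν a))))))
          target : b + r ≈[ m ] w
          target = ≈-cancel (a + 1) (≈-trans (≈-refl (trans (solve 3 (λ a b r → b :+ r :+ (a :+ con 1) := con 1 :+ a :+ b :+ r) refl a b r) (cong (_+ r) eb)))
            (≈-trans (complement r ℓ≈0) (≈-trans (≈-sym huw) (≈-trans (≈-refl (solve 2 (λ u w → u :+ w :+ con 1 := w :+ (u :+ con 1)) refl u w))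
              (≈-+ (≈-refl {w} refl) (≈-+ (≈-sym h) (≈-refl {1} refl)))))))
        choose : (∃ λ a → lo ≤ a × a < lo + m × a ≈[ m ] u) → χ u ≡ χ w
        choose (a , lo≤a , a< , h) = transfer lo≤a a< h (proj₂ (∃∸ (≤-trans a< lo+m≤ℓ)))

      period-2 : Period 2
      period-2 u = trans (reflect₁ {u + 2} {w} (≈-trans (≈-refl (solve 2 (λ u w → u :+ con 2 :+ w := u :+ w :+ con 1 :+ con 1) refl u w)) (≈-+ hw (≈-refl {1} refl))))
          (≡.sym (reflect₂ {u} {w} hw))
        where
        w : ℕ
        -- A representative of r - 1 - u, because `(u + 1) * m₀` is congruent to -(u + 1) modulo
        -- `suc m₀`.
        w = r + (u + 1) * m₀
        hw : u + w + 1 ≈[ m ] r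
        hw = ≈-trans (≈-refl (solve 3 (λ u r n → u :+ (r :+ (u :+ con 1) :* n) :+ con 1 := (u :+ con 1) :* (con 1 :+ n) :+ r) refl u r m₀))
          (complement r (multiple (divides (u + 1) refl)))

   periods : Period 2 × (Odd ℓ → Period 1)
   -- For odd `ℓ` the least period divides both 2 and `ℓ`, hence 1.
   periods = period-2 , λ (t , e) → subst Period (∣1⇒≡1 (∣m+n∣m⇒∣n
       (subst (m ∣_) (trans e (+-comm 1 (2 * t))) m∣ℓ) (∣-trans (m∣period 2 period-2) (m∣m*n t)))) per-m
     where
     period-2 : Period 2
     period-2 with m ≤? r | r + m ≤? ν
     ... | no ¬l | _ = ⊥-elim (short-left (≰⇒> ¬l))
     ... | yes _ | no ¬l = ⊥-elim (short-right (≰⇒> ¬l))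
     ... | yes l | yes l′ = Long.period-2 l l′

  colour-periods : Period 2 × (Odd ℓ → Period 1)
  colour-periods = periods (proj₁ minimal) (proj₁ (proj₂ minimal)) (proj₂ (proj₂ minimal))

-- Cycles through the last common ancestor

odd? : ℕ → Bool
odd? zero = false
odd? (suc k) = not (odd? k)

not-not : ∀ b → not (not b) ≡ b
not-not true = refl
not-not false = refl

odd?-double : ∀ t → odd? (2 * t) ≡ false
odd?-double zero = refl
odd?-double (suc t) = trans (cong odd? (*-suc 2 t)) (trans (not-not _) (odd?-double t))

odd?⇒Odd : ∀ k → odd? k ≡ true → Odd k
odd?⇒Odd (suc zero) _ = 0 , refl
odd?⇒Odd (suc (suc k)) e with odd?⇒Odd k (trans (≡.sym (not-not (odd? k))) e)
... | t , eq = suc t , trans (cong (2 +_) eq) (cong suc (≡.sym (*-suc 2 t)))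

odd?-+ : ∀ a b → odd? (a + b) ≡ odd? a xor odd? b
odd?-+ zero b = refl
odd?-+ (suc a) b = trans (cong not (odd?-+ a b)) (aux (odd? a) (odd? b))
  where
  aux : ∀ x y → not (x xor y) ≡ not x xor y
  aux true y = not-not y
  aux false y = refl

odd?-shift : ∀ a t → odd? (a + 2 * t) ≡ odd? a
odd?-shift a t = trans (odd?-+ a (2 * t)) (trans (cong (odd? a xor_) (odd?-double t)) (aux (odd? a)))
  where
  aux : ∀ x → x xor false ≡ x
  aux true = refl
  aux false = refl

-- `zs` omits `q`, so for `q` in `D` other than `a` the ear meets `D` in its two ends only. A single
-- edge is allowed, even one between neighbours in the tree.
record EarAt {n} (G : Graph n) (D : Fin n → Set) (a q : Fin n) : Set where
  field
    zs  : List (Fin n)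
    walk  : Walk (adj G) a q zs
    unique : Unique zs
    inner  : ∀ {v} → v ∈ zs → D v → v ≡ a

-- c is a chorded cycle on levels i and i + 1 of the BFS tree, and apex is the last common ancestor of its
-- vertices at level i, h levels above them.
module Apex {n} (G : Graph n) (asym : Symmetricᵇ (adj G)) {x₀} (T : BFS (adj G) (λ _ → true) x₀)
  {H : BRel n} (sy : Symmetricᵇ H) (H⊆G : ∀ {u v} → H u v ≡ true → adj G u v ≡ true)
  {ν} (C : ChordedCycle H ν) {i}
  (levels : ∀ x → BFS.lev T (ChordedCycle.c C x) ≡ i ⊎ BFS.lev T (ChordedCycle.c C x) ≡ suc i)
  {h} (h≤i : h ≤ i) {apex : Fin n}
  (common : ∀ x → BFS.lev T (ChordedCycle.c C x) ≡ i → Tree.anc asym T h (ChordedCycle.c C x) ≡ apex)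
  (last : ∀ {t} → t < h → ∀ q → ∃ λ y → BFS.lev T (ChordedCycle.c C y) ≡ i × Tree.anc asym T t (ChordedCycle.c C y) ≢ q)
  (base : ∃ λ x → BFS.lev T (ChordedCycle.c C x) ≡ i) where
  open ChordedCycle C
  open ChordPaths sy C
  open Tree asym T

  lev-apex : lev apex + h ≡ i
  lev-apex = subst (λ v → lev v + h ≡ i) (common x l) (trans (lev-anc+ (subst (h ≤_) (≡.sym l) h≤i)) l)
    where
    x = proj₁ base
    l = proj₂ base

  OnTree InD : Fin n → Set
  OnTree v = ∃ λ x → ∃ λ t → lev (c x) ≡ i × t ≤ h × v ≡ anc t (c x)
  InD v = (∃ λ x → v ≡ c x) ⊎ OnTree v

  Ear : Fin n → Set
  Ear = EarAt G InD apex
  module Ear = EarAt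

  lev-c≥ : ∀ x → i ≤ lev (c x)
  lev-c≥ x with levels x
  ... | inj₁ e = ≤-reflexive (≡.sym e)
  ... | inj₂ e = ≤-trans (n≤1+n i) (≤-reflexive (≡.sym e))

  lev-tree : ∀ {x t} → lev (c x) ≡ i → t ≤ h → lev (anc t (c x)) + t ≡ i
  lev-tree {x} {t} l t≤h = trans (lev-anc+ (≤-trans t≤h (subst (h ≤_) (≡.sym l) h≤i))) l

  private
    tree≠apex : ∀ {x t} → lev (c x) ≡ i → t < h → anc t (c x) ≢ apex
    tree≠apex {x} {t} l t<h e = <⇒≢ t<h (+-cancelˡ-≡ (lev apex) t h (trans (cong (λ v → lev v + t) (≡.sym e)) (trans (lev-tree l (<⇒≤ t<h)) (≡.sym lev-apex))))

    nonempty : ∀ {q} (E : Ear q) → q ≢ apex → 1 ≤ length (Ear.zs E)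
    nonempty record { zs = [] ; walk = [] } ne = ⊥-elim (ne refl)
    nonempty record { zs = _ ∷ _ } _ = s≤s z≤n

    reverse-path : ∀ {a b ℓ} → ChordPath a b ℓ → ChordPath b a ℓ
    reverse-path {a} {b} p with reverseʷ sy (ChordPath.walk p)
    ... | ys , w , σ = record
      { fs = ys ; walk = w ; unique = Unique-tail uq ; end∉ = Unique-head uq
      ; range = λ m → in-range (∈-resp-↭ σ (there m))
      ; len = trans (ℕₚ.suc-injective (↭-length σ)) len }
      where
      open ChordPath p
      in-range : ∀ {v} → v ∈ c b ∷ fs → ∃ λ j → v ≡ c j
      in-range (here e) = b , e
      in-range (there k) = range k
      uq : Unique (c a ∷ ys)
      uq = Unique-resp-↭ (↭-sym σ) (Unique-∷ end∉ unique)

    up-tree : ∀ {y v} → lev (c y) ≡ i → v ∈ up h (c y) → ∃ λ t → t < h × v ≡ anc t (c y) × OnTree v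
    up-tree {y} l m with ∈-up h m
    ... | t , t<h , e = t , t<h , e , (y , t , l , <⇒≤ t<h , e)

    -- Levels separate the parts: the chorded cycle stays on levels at least `i`, the climb leaves
    -- level `i` at its first step, and the ear meets `InD` only in `apex`, which the climb omits
    -- and which `1 ≤ h` keeps off the cycle.
    path-ear : ∀ {a b ℓ q} (p : ChordPath a b ℓ) (E : Ear q) → lev (c b) ≡ i → 1 ≤ h →
      Walk (adj G) (c a) q (ChordPath.fs p ++ up h (c b) ++ Ear.zs E) × Unique (ChordPath.fs p ++ up h (c b) ++ Ear.zs E)
    path-ear {a} {b} {q = q} p E lb 1≤h =
      mapʷ H⊆G P.walk ++ʷ (subst (λ z → Walk (adj G) (c b) z (up h (c b))) (common b lb) (upʷ h h≤) ++ʷ E.walk) ,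
      Unique-++ P.unique (Unique-++ (up-Unique h h≤) E.unique up-zs) λ m k → [ fs-up m , fs-zs m ]′ (∈-++⁻ (up h (c b)) k)
      where
      module P = ChordPath p
      module E = Ear E
      h≤ : h ≤ lev (c b)
      h≤ = subst (h ≤_) (≡.sym lb) h≤i
      up-zs : ∀ {v} → v ∈ up h (c b) → v ∈ E.zs → ⊥
      up-zs m k with up-tree lb m
      ... | t , t<h , e , on = tree≠apex lb t<h (trans (≡.sym e) (E.inner k (inj₂ on)))
      fs-up : ∀ {v} → v ∈ P.fs → v ∈ up h (c b) → ⊥
      fs-up m k with P.range m | up-tree lb k
      ... | y , refl | zero , _ , e , _ = P.end∉ (subst (_∈ P.fs) e m)
      ... | y , refl | suc t , t<h , e , _ = <⇒≱ {lev (anc (suc t) (c b))} {i} (≤-trans (s≤s (m≤m+n _ t)) (≤-reflexive (trans (≡.sym (+-suc _ t)) (lev-tree lb (<⇒≤ t<h)))))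
        (≤-trans (lev-c≥ y) (≤-reflexive (cong lev e)))
      fs-zs : ∀ {v} → v ∈ P.fs → v ∈ E.zs → ⊥
      fs-zs m k with P.range m
      ... | y , refl = <⇒≱ (≤-trans (≤-reflexive (+-comm 1 (lev apex))) (≤-trans (+-monoʳ-≤ (lev apex) 1≤h) (≤-reflexive lev-apex)))
        (≤-trans (lev-c≥ y) (≤-reflexive (cong lev (E.inner k (inj₁ (y , refl))))))

  -- The descent from `q` to `c a` closes the cycle. It misses the climb from `c b`, since a common
  -- vertex would make `q` the ancestor of `c b` at height `t` as well. The length depends on the
  -- path only through `ℓ`.
  tree-cycle-through : ∀ {a b ℓ t q} (E : Ear q) → 1 ≤ ℓ → t < h → lev (c a) ≡ i → lev (c b) ≡ i → anc t (c a) ≡ q → anc t (c b) ≢ q →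
    ChordPath a b ℓ → HasCycle G (ℓ + (h + length (Ear.zs E)) + t)
  tree-cycle-through {a} {b} {ℓ} {t} {q} E 1≤ℓ t<h la lb ea eb p = subst (HasCycle G) len
    (cycle G (w ++ʷ subst (λ z → Walk (adj G) z (c a) (down t (c a))) ea (downʷ t t≤))
      (Unique-++ u (down-Unique t t≤) disj)
      (subst (3 ≤_) (≡.sym len) (≤-trans (+-mono-≤ 1≤ℓ (+-mono-≤ (≤-trans (s≤s z≤n) t<h) (nonempty E (λ e → tree≠apex la t<h (trans ea e))))) (m≤m+n _ t))))
    where
    module P = ChordPath p
    module E = Ear E
    t≤ : t ≤ lev (c a)
    t≤ = ≤-trans (<⇒≤ t<h) (subst (h ≤_) (≡.sym la) h≤i)
    xs : List (Fin n)
    xs = P.fs ++ up h (c b) ++ E.zs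
    w : Walk (adj G) (c a) q xs
    w = proj₁ (path-ear p E lb (≤-trans (s≤s z≤n) t<h))
    u : Unique xs
    u = proj₂ (path-ear p E lb (≤-trans (s≤s z≤n) t<h))
    len : length (xs ++ down t (c a)) ≡ ℓ + (h + length E.zs) + t
    len = trans (length-++ xs) (cong₂ _+_ (trans (length-++ P.fs) (cong₂ _+_ P.len (trans (length-++ (up h (c b))) (cong (_+ length E.zs) (length-up h (c b)))))) (length-down t (c a)))
    disj : ∀ {v} → v ∈ xs → v ∈ down t (c a) → ⊥
    disj {v} m k with ∈-down t k
    ... | s , s<t , e = [ in-fs , (λ k → [ in-up , in-zs ]′ (∈-++⁻ (up h (c b)) k)) ]′ (∈-++⁻ P.fs m)
      where
      s<h : suc s < h
      s<h = ≤-trans (s≤s s<t) t<h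
      in-fs : v ∈ P.fs → ⊥
      in-fs m with P.range m
      ... | y , e′ = <⇒≱ {lev (anc (suc s) (c a))} {i} (≤-trans (s≤s (m≤m+n _ s)) (≤-reflexive (trans (≡.sym (+-suc _ s)) (lev-tree la (<⇒≤ s<h)))))
        (≤-trans (lev-c≥ y) (≤-reflexive (cong lev (trans (≡.sym e′) e))))
      in-up : v ∈ up h (c b) → ⊥
      in-up m with up-tree lb m
      ... | s′ , s′<h , e′ , _ with anc-level {s′} {suc s} (≤-trans (<⇒≤ s′<h) (subst (h ≤_) (≡.sym lb) h≤i)) (≤-trans s<t t≤) (trans lb (≡.sym la)) (trans (≡.sym e′) e)
      ...  | refl = eb (trans (climb b) (trans (cong (anc (t ∸ suc s)) (trans (≡.sym e′) e)) (trans (≡.sym (climb a)) ea)))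
        where
        climb : ∀ y → anc t (c y) ≡ anc (t ∸ suc s) (anc (suc s) (c y))
        climb y = trans (cong (λ k → anc k (c y)) (≡.sym (m+[n∸m]≡n s<t))) (anc-+ (suc s) (t ∸ suc s) (c y))
      in-zs : v ∈ E.zs → ⊥
      in-zs m = tree≠apex la s<h (trans (≡.sym e) (E.inner m (inj₂ (a , suc s , la , <⇒≤ s<h , e))))

  upper-cycle-through : ∀ {a b ℓ} (E : Ear (c a)) → 1 ≤ ℓ → 1 ≤ h → lev (c b) ≡ i →
    ChordPath a b ℓ → HasCycle G (ℓ + (h + length (Ear.zs E)))
  upper-cycle-through {a} {b} {ℓ} E 1≤ℓ 1≤h lb p = subst (HasCycle G) len
    (cycle G (proj₁ (path-ear p E lb 1≤h)) (proj₂ (path-ear p E lb 1≤h))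
      (subst (3 ≤_) (≡.sym len) (+-mono-≤ 1≤ℓ (+-mono-≤ 1≤h (nonempty E c≠apex)))))
    where
    module P = ChordPath p
    c≠apex : c a ≢ apex
    c≠apex e = <⇒≱ (≤-trans (≤-reflexive (+-comm 1 (lev apex))) (≤-trans (+-monoʳ-≤ (lev apex) 1≤h) (≤-reflexive lev-apex)))
        (≤-trans (lev-c≥ a) (≤-reflexive (cong lev e)))
    len : length (P.fs ++ up h (c b) ++ Ear.zs E) ≡ ℓ + (h + length (Ear.zs E))
    len = trans (length-++ P.fs) (cong₂ _+_ P.len (trans (length-++ (up h (c b))) (cong (_+ length (Ear.zs E)) (length-up h (c b)))))

  private
    equal-colours : ∀ {a b} → (a ≡ true → b ≢ true → ⊥) → (b ≡ true → a ≢ true → ⊥) → a ≡ b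
    equal-colours {true} {true} _ _ = refl
    equal-colours {true} {false} f _ = ⊥-elim (f refl λ ())
    equal-colours {false} {true} _ g = ⊥-elim (g refl λ ())
    equal-colours {false} {false} _ _ = refl

    iterate : ∀ (χ : ℕ → Bool) {p} → (∀ x → χ (x + p) ≡ χ x) → ∀ s x → χ (x + s * p) ≡ χ x
    iterate χ q zero x = cong χ (+-identityʳ x)
    iterate χ {p} q (suc s) x = trans (cong χ (trans (cong (x +_) (+-comm p (s * p))) (≡.sym (+-assoc x (s * p) p)))) (trans (q (x + s * p)) (iterate χ q s x))

    constant : ∀ (χ : ℕ → Bool) → (∀ x → χ (x + 1) ≡ χ x) → ∀ x y → χ x ≡ χ y
    constant χ p x y = trans (to-0 x) (≡.sym (to-0 y))
      where
      to-0 : ∀ x → χ x ≡ χ 0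
      to-0 x = trans (cong χ (≡.sym (*-identityʳ x))) (iterate χ p x 0)

  -- Under this condition a colouring of period 2 is constant on level `i`.
  Alternating : Set
  Alternating = ∀ x s → lev (c x) ≡ i → lev (c (x + s)) ≡ i → ∃ λ t → s ≡ t * 2

  -- If the cycle were missing, no path of length `ℓ` could join a descendant of `q` on level `i` to
  -- another vertex of that level. The colouring `χ` would have period 2, and period 1 for odd `ℓ`;
  -- either alternative makes it constant on level `i`, against `last`.
  tree-cycles : ∀ {a t q} (E : Ear q) → t < h → lev (c a) ≡ i → anc t (c a) ≡ q → ∀ ℓ → 1 ≤ ℓ → ℓ < ν →
    (∀ {x y} → ChordPath x y ℓ → lev (c x) ≡ i → lev (c y) ≡ i) → Odd ℓ ⊎ Alternating →
    HasCycle G (ℓ + (h + length (Ear.zs E)) + t)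
  tree-cycles {a} {t} {q} E t<h la ea ℓ 1≤ℓ ℓ<ν keep parity with hasCycle? G (ℓ + (h + length (Ear.zs E)) + t)
  ... | yes cyc = cyc
  ... | no none = ⊥-elim (differ-at parity)
    where
    χ? : ∀ x → Dec (lev (c x) ≡ i × anc t (c x) ≡ q)
    χ? x = (lev (c x) ℕₚ.≟ i) ×-dec (anc t (c x) Fin.≟ q)
    χ : ℕ → Bool
    χ x = ⌊ χ? x ⌋
    clash : ∀ {x y} → ChordPath x y ℓ → χ x ≡ true → χ y ≢ true → ⊥
    clash {x} {y} p e ne with ⌊⌋-sound (χ? x) e
    ... | lx , ex = none (tree-cycle-through E 1≤ℓ t<h lx (keep p lx) ex (λ ey → ne (⌊⌋-complete (χ? y) (keep p lx , ey))) p)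
    periods = PathColours.colour-periods sy C χ (λ x → cong (λ v → ⌊ (lev v ℕₚ.≟ i) ×-dec (anc t v Fin.≟ q) ⌋) (per x)) 1≤ℓ ℓ<ν
      λ p → equal-colours (clash p) (clash (reverse-path p))
    b : ℕ
    b = proj₁ (last t<h q)
    lb : lev (c b) ≡ i
    lb = proj₁ (proj₂ (last t<h q))
    χa : χ a ≡ true
    χa = ⌊⌋-complete (χ? a) (la , ea)
    χb : χ b ≢ true
    χb e = proj₂ (proj₂ (last t<h q)) (proj₂ (⌊⌋-sound (χ? b) e))
    far : ∀ {x y} → Alternating → x ≤ y → lev (c x) ≡ i → lev (c y) ≡ i → χ x ≡ χ y
    far {x} {y} alt x≤y lx ly with alt x (y ∸ x) lx (subst (λ z → lev (c z) ≡ i) (≡.sym (m+[n∸m]≡n x≤y)) ly)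
    ... | s , e = trans (≡.sym (iterate χ (proj₁ periods) s x)) (cong χ (trans (cong (x +_) (≡.sym e)) (m+[n∸m]≡n x≤y)))
    differ-at : Odd ℓ ⊎ Alternating → ⊥
    differ-at (inj₁ odd) = χb (trans (constant χ (proj₂ periods odd) b a) χa)
    differ-at (inj₂ alt) with ≤-total a b
    ... | inj₁ a≤b = χb (trans (≡.sym (far alt a≤b la lb)) χa)
    ... | inj₂ b≤a = χb (trans (far alt b≤a lb la) χa)

  -- Any path of length `ℓ` from `c a` closes up. If there were none, the colouring that singles out
  -- the vertex `c a` would have no path of odd length `ℓ` between its colours and would be
  -- constant, although level `i` is occupied too.
  upper-cycles : ∀ {a} (E : Ear (c a)) → 1 ≤ h → lev (c a) ≡ suc i → ∀ ℓ → 1 ≤ ℓ → ℓ < ν → Odd ℓ →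
    (∀ {x y} → ChordPath x y ℓ → lev (c x) ≡ suc i → lev (c y) ≡ i) → HasCycle G (ℓ + (h + length (Ear.zs E)))
  upper-cycles {a} E 1≤h la ℓ 1≤ℓ ℓ<ν odd keep with hasCycle? G (ℓ + (h + length (Ear.zs E)))
  ... | yes cyc = cyc
  ... | no none = ⊥-elim (1+n≢n (trans (≡.sym la) (trans (cong lev (≡.sym cb)) (proj₂ base))))
    where
    χ : ℕ → Bool
    χ x = ⌊ c x Fin.≟ c a ⌋
    clash : ∀ {x y} → ChordPath x y ℓ → χ x ≡ true → χ y ≢ true → ⊥
    clash {x} {y} p e _ with ⌊⌋-sound (c x Fin.≟ c a) e
    ... | ex = none (upper-cycle-through E 1≤ℓ 1≤h (keep p (trans (cong lev ex) la)) (start ex p))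
      where
      start : c x ≡ c a → ChordPath x y ℓ → ChordPath a y ℓ
      start ex p = record { fs = fs ; walk = subst (λ z → Walk H z (c y) fs) ex walk ; unique = unique ; end∉ = end∉ ; range = range ; len = len }
        where open ChordPath p
    periods = PathColours.colour-periods sy C χ (λ x → cong (λ v → ⌊ v Fin.≟ c a ⌋) (per x)) 1≤ℓ ℓ<ν
      λ p → equal-colours (clash p) (clash (reverse-path p))
    cb : c (proj₁ base) ≡ c a
    cb = ⌊⌋-sound (c (proj₁ base) Fin.≟ c a) (trans (constant χ (proj₂ periods odd) (proj₁ base) a) (⌊⌋-complete (c a Fin.≟ c a) refl))

-- Ears

start-∈ : ∀ {n} {A : BRel n} {u v xs} → Walk A u v xs → u ≡ v ⊎ u ∈ xs
start-∈ [] = inj₁ refl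
start-∈ (_ ∷ _) = inj₂ (here refl)

first-hit : ∀ {n} (G : Graph n) {bad Q : Fin n → Set} → Decidable Q → ∀ {u v} → WalkAvoid G bad u v → Q v →
  ∃ λ e → Σ (List (Fin n)) λ xs → Walk (adj G) u e xs × Q e × ¬ bad e × (∀ {y} → y ∈ xs → ¬ Q y × ¬ bad y)
first-hit G Q? (WalkAvoid.here ¬b) q = _ , [] , [] , q , ¬b , λ ()
first-hit G {bad} {Q} Q? {u} (WalkAvoid.step ¬b a w) qv with Q? u
... | yes q = u , [] , [] , q , ¬b , λ ()
... | no ¬q with first-hit G Q? w qv
...  | e , xs , p , qe , be , out = e , u ∷ xs , a ∷ p , qe , be , λ { (here refl) → ¬q , ¬b ; (there m) → out m }

split-first : {V : Set} {P : V → Set} → Decidable P → ∀ {x xs} → x ∈ xs → P x →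
  ∃ λ as → ∃ λ f → ∃ λ bs → xs ≡ as ++ f ∷ bs × P f × (∀ {v} → v ∈ as → ¬ P v)
split-first P? {xs = y ∷ xs} m p with P? y
split-first P? {xs = y ∷ xs} m p | yes py = [] , y , xs , refl , py , λ ()
split-first P? {xs = y ∷ xs} (here refl) p | no ¬py = ⊥-elim (¬py p)
split-first P? {xs = y ∷ xs} (there m) p | no ¬py with split-first P? m p
... | as , f , bs , refl , pf , none = y ∷ as , f , bs , refl , pf , λ { (here refl) → ¬py ; (there k) → none k }

split-last : {V : Set} {P : V → Set} → Decidable P → ∀ {x xs} → x ∈ xs → P x →
  ∃ λ as → ∃ λ l → ∃ λ bs → xs ≡ as ++ l ∷ bs × P l × (∀ {v} → v ∈ bs → ¬ P v)
split-last {P = P} P? {xs = y ∷ xs} m p with anyL? P? xs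
... | yes later with find later
...  | _ , m′ , p′ with split-last P? m′ p′
...  | as , l , bs , refl , pl , none = y ∷ as , l , bs , refl , pl , none
split-last P? {xs = y ∷ xs} (here refl) p | no never = [] , y , xs , refl , p , λ m q → never (lose m q)
split-last P? {xs = y ∷ xs} (there m) p | no never = ⊥-elim (never (lose m p))

record Arc {n} (A : BRel n) (cs : List (Fin n)) (f l : Fin n) : Set where
  field
    vs  : List (Fin n)
    walk  : Walk A f l vs
    unique : Unique vs
    end∉  : l ∉ vs
    sub  : ∀ {v} → v ∈ vs → v ∈ cs

-- Rotate the cycle to start at `f`, cut it at `l` and reverse the second half. In an odd cycle the
-- total forces the arcs to differ in parity.
arcs : ∀ {n} {A : BRel n} → Symmetricᵇ A → ∀ {u cs} → Walk A u u cs → Unique cs → ∀ {f l} → f ∈ cs → l ∈ cs → f ≢ l →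
  Σ (Arc A cs f l) λ α → Σ (Arc A cs f l) λ β → length (Arc.vs α) + length (Arc.vs β) ≡ length cs
arcs {A = A} sy w uq {f} {l} mf ml f≢l with ∈-∃++ mf
... | us , vs , refl = rotated (∈-∃++ l∈)
  where
  cs = us ++ f ∷ vs
  ro : f ∷ vs ++ us ↭ cs
  ro = ++-comm (f ∷ vs) us
  w′ : Walk A f f (f ∷ vs ++ us)
  w′ with splitʷ us w
  ... | p , q = q ++ʷ p
  uq′ : Unique (f ∷ vs ++ us)
  uq′ = Unique-resp-↭ (↭-sym ro) uq
  drop-head : l ∈ f ∷ vs ++ us → l ∈ vs ++ us
  drop-head (here e) = ⊥-elim (f≢l (≡.sym e))
  drop-head (there m) = m
  l∈ : l ∈ vs ++ us
  l∈ = drop-head (∈-resp-↭ (↭-sym ro) ml)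
  rotated : (∃ λ ps → ∃ λ qs → vs ++ us ≡ ps ++ l ∷ qs) →
    Σ (Arc A cs f l) λ α → Σ (Arc A cs f l) λ β → length (Arc.vs α) + length (Arc.vs β) ≡ length cs
  rotated (ps , qs , eq) with splitʷ (f ∷ ps) (subst (Walk A f f) (cong (f ∷_) eq) w′) | Unique-++⁻ (f ∷ ps) (subst Unique (cong (f ∷_) eq) uq′)
  ... | p , q | up , uq , d with reverseʷ sy q
  ... | ys , q′ , σ = record { vs = f ∷ ps ; walk = p ; unique = up ; end∉ = λ m → d m (here refl) ; sub = λ m → into (∈-++⁺ˡ m) } ,
      record { vs = ys ; walk = q′ ; unique = Unique-tail ulys ; end∉ = Unique-head ulys ; sub = λ m → sub-β (∈-resp-↭ σ (there m)) } ,
      trans (cong (length (f ∷ ps) +_) (ℕₚ.suc-injective (↭-length σ))) (trans (≡.sym (length-++ (f ∷ ps)))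
        (trans (cong (suc ∘ length) (≡.sym eq)) (↭-length ro)))
    where
    into : ∀ {v} → v ∈ f ∷ ps ++ l ∷ qs → v ∈ cs
    into {v} m = ∈-resp-↭ ro (subst (v ∈_) (cong (f ∷_) (≡.sym eq)) m)
    ulys : Unique (l ∷ ys)
    ulys = Unique-resp-↭ (↭-sym σ) (Unique-∷ (λ m → d (here refl) m) uq)
    sub-β : ∀ {v} → v ∈ f ∷ l ∷ qs → v ∈ cs
    sub-β (here e) = into (here e)
    sub-β (there m) = into (∈-++⁺ʳ (f ∷ ps) m)

module Ears {n} (G : Graph n) (asym : Symmetricᵇ (adj G)) (airr : ∀ {u v} → adj G u v ≡ true → u ≢ v)
  (conn : ∀ x → ConnectedWithout G x) {D : Fin n → Set} (D? : Decidable D) {a : Fin n} (Da : D a) where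

  private
    Edge : BRel n
    Edge = adj G

  OpenEar : Set
  OpenEar = ∃ λ q → D q × q ≢ a × EarAt G D a q

  list : OpenEar → List (Fin n)
  list (_ , _ , _ , E) = EarAt.zs E

  apex-∈ : (E : OpenEar) → a ∈ list E
  apex-∈ (_ , _ , q≢a , E) with start-∈ (EarAt.walk E)
  ... | inj₁ e = ⊥-elim (q≢a (≡.sym e))
  ... | inj₂ m = m

  -- By 2-connectivity `p′` reaches `D` without passing `p`. Let `e` be the first vertex on that
  -- walk which lies in `D` or on the ear; the detour through `p`, `p′` and `e` is spliced in
  -- according to the place of `e`.
  extend : (E : OpenEar) → ∀ {p p′} → p ∈ list E → Edge p p′ ≡ true → ¬ D p′ → Σ OpenEar λ E′ → p ∈ list E′ × p′ ∈ list E′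
  extend E₀@(q , Dq , q≢a , E) {p} {p′} p∈ pp′ ¬Dp′ with p′ ∈? EarAt.zs E
  ... | yes m = E₀ , p∈ , m
  ... | no p′∉ with first-hit G (λ y → D? y ⊎-dec (y ∈? EarAt.zs E)) (conn p p′ target (λ e → airr pp′ (≡.sym e)) target≢p) (inj₁ D-target)
    where
    -- The walk needs a target in `D` other than `p`; `a` or `q` will do.
    choice : ∃ λ t → t ≢ p × D t
    choice with a Fin.≟ p
    ... | yes refl = q , q≢a , Dq
    ... | no ne = a , ne , Da
    target = proj₁ choice
    target≢p = proj₁ (proj₂ choice)
    D-target = proj₂ (proj₂ choice)
  ... | e , _ , w , Qe , e≢p , out with simplify w
  ... | rs , ρ , uρ , sub = build (∈-∃++ p∈) (e ∈? EarAt.zs E)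
    where
    open EarAt E
    off : ∀ {y} → y ∈ rs → ¬ D y × y ∉ zs × y ≢ p
    off m with out (sub m)
    ... | nq , np = (λ d → nq (inj₁ d)) , (λ k → nq (inj₂ k)) , np
    p′∈rs : p′ ∈ rs
    p′∈rs with start-∈ ρ
    ... | inj₂ m = m
    ... | inj₁ p′≡e = ⊥-elim ([ (λ d → ¬Dp′ (subst D (≡.sym p′≡e) d)) , (λ m → p′∉ (subst (_∈ zs) (≡.sym p′≡e) m)) ]′ Qe)
    build : (∃ λ xs → ∃ λ ys → zs ≡ xs ++ p ∷ ys) → Dec (e ∈ zs) → Σ OpenEar λ E′ → p ∈ list E′ × p′ ∈ list E′
    build (xs , ys , eq) e∈? with subst (Walk Edge a q) eq walk | subst Unique eq unique
    ... | wz | uz with splitʷ xs wz | Unique-++⁻ xs uz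
    ... | w₁ , w₂ | u₁ , u₂ , d₁₂ = cases e∈?
      where
      in-zs : ∀ {y} → y ∈ xs ++ p ∷ ys → y ∈ zs
      in-zs m = subst (_ ∈_) (≡.sym eq) m
      cases : Dec (e ∈ zs) → Σ OpenEar λ E′ → p ∈ list E′ × p′ ∈ list E′
      -- `e` lies in `D` and is not listed: the ear now ends at `e`, which may be `q` again.
      cases (no e∉) = (e , De Qe , e≢a , record
          { zs = xs ++ p ∷ rs ; walk = w₁ ++ʷ (pp′ ∷ ρ)
          ; unique = Unique-++ u₁ (Unique-∷ (λ m → proj₂ (proj₂ (off m)) refl) (Unique-tail uρ))
              (λ { m (here refl) → d₁₂ m (here refl) ; m (there k) → proj₁ (proj₂ (off k)) (in-zs (∈-++⁺ˡ m)) })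
          ; inner = λ m d → inn m d }) , ∈-insert xs , ∈-++⁺ʳ xs (there p′∈rs)
        where
        De : D e ⊎ e ∈ zs → D e
        De (inj₁ d) = d
        De (inj₂ m) = ⊥-elim (e∉ m)
        e≢a : e ≢ a
        e≢a refl = e∉ (apex-∈ E₀)
        inn : ∀ {v} → v ∈ xs ++ p ∷ rs → D v → v ≡ a
        inn m d with ∈-++⁻ xs m
        ... | inj₁ k = inner (in-zs (∈-++⁺ˡ k)) d
        ... | inj₂ (here refl) = inner p∈ d
        ... | inj₂ (there k) = ⊥-elim (proj₁ (off k) d)
      cases (yes e∈) with ∈-++⁻ xs (subst (e ∈_) eq e∈)
      ... | inj₂ (here e≡p) = ⊥-elim (e≢p e≡p)
      -- `e` comes after `p`: the detour replaces the segment between them.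
      ... | inj₂ (there m) with ∈-∃++ m
      ...  | ys₁ , ys₂ , refl with splitʷ (p ∷ ys₁) w₂ | Unique-++⁻ (p ∷ ys₁) u₂
      ...  | _ , w₃ | _ , u₃ , d₃ = (q , Dq , q≢a , record
          { zs = xs ++ p ∷ rs ++ e ∷ ys₂ ; walk = w₁ ++ʷ (pp′ ∷ (ρ ++ʷ w₃))
          ; unique = Unique-++ u₁ (Unique-∷ p-new (Unique-++ (Unique-tail uρ) u₃ λ k k′ → proj₁ (proj₂ (off k)) (in-zs (tail-in k′)))) dis
          ; inner = λ m d → inn m d }) , ∈-insert xs , ∈-++⁺ʳ xs (there (∈-++⁺ˡ p′∈rs))
        where
        tail-in : ∀ {y} → y ∈ e ∷ ys₂ → y ∈ xs ++ p ∷ ys₁ ++ e ∷ ys₂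
        tail-in k = ∈-++⁺ʳ xs (there (∈-++⁺ʳ ys₁ k))
        p-new : p ∉ rs ++ e ∷ ys₂
        p-new k = [ (λ k → proj₂ (proj₂ (off k)) refl) , (λ k → d₃ (here refl) k) ]′ (∈-++⁻ rs k)
        dis : ∀ {y} → y ∈ xs → y ∈ p ∷ rs ++ e ∷ ys₂ → ⊥
        dis k (here refl) = d₁₂ k (here refl)
        dis k (there k′) = [ (λ k′ → proj₁ (proj₂ (off k′)) (in-zs (∈-++⁺ˡ k))) , (λ k′ → d₁₂ k (there (∈-++⁺ʳ ys₁ k′))) ]′ (∈-++⁻ rs k′)
        inn : ∀ {v} → v ∈ xs ++ p ∷ rs ++ e ∷ ys₂ → D v → v ≡ a
        inn m d with ∈-++⁻ xs m
        ... | inj₁ k = inner (in-zs (∈-++⁺ˡ k)) d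
        ... | inj₂ (here refl) = inner p∈ d
        ... | inj₂ (there k) = [ (λ k → ⊥-elim (proj₁ (off k) d)) , (λ k → inner (in-zs (tail-in k)) d) ]′ (∈-++⁻ rs k)
      -- `e` comes before `p`: turn off at `e`, follow the detour backwards to `p′` and rejoin the
      -- ear at `p`.
      cases (yes e∈) | inj₁ m with ∈-∃++ m
      ...  | xs₁ , xs₂ , refl with splitʷ xs₁ w₁ | Unique-++⁻ xs₁ u₁ | reverseʷ asym ρ
      ...  | w₃ , _ | u₃ , _ , d₃ | rs′ , ρ′ , σ = (q , Dq , q≢a , record
          { zs = xs₁ ++ rs′ ++ p′ ∷ p ∷ ys ; walk = w₃ ++ʷ (ρ′ ++ʷ (asym pp′ ∷ w₂))
          ; unique = Unique-++ u₃ (Unique-++ (Unique-tail uσ) (Unique-∷ (λ { (here eq′) → airr pp′ (≡.sym eq′) ; (there k) → p′∉ (in-zs (∈-++⁺ʳ _ (there k))) }) u₂) d₄) d₅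
          ; inner = λ m d → inn m d }) , ∈-++⁺ʳ xs₁ (∈-++⁺ʳ rs′ (there (here refl))) , ∈-++⁺ʳ xs₁ (∈-++⁺ʳ rs′ (here refl))
        where
        uσ : Unique (p′ ∷ rs′)
        uσ = Unique-resp-↭ (↭-sym σ) uρ
        back : ∀ {y} → y ∈ p′ ∷ rs′ → y ≡ e ⊎ y ∈ rs
        back k with ∈-resp-↭ σ k
        ... | here eq′ = inj₁ eq′
        ... | there k′ = inj₂ k′
        d₄ : ∀ {y} → y ∈ rs′ → y ∈ p′ ∷ p ∷ ys → ⊥
        d₄ k (here refl) = Unique-head uσ k
        d₄ k (there k′) with back (there k)
        ... | inj₁ refl = d₁₂ (∈-insert xs₁) k′
        ... | inj₂ k″ = proj₁ (proj₂ (off k″)) (in-zs (∈-++⁺ʳ _ k′))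
        d₅ : ∀ {y} → y ∈ xs₁ → y ∈ rs′ ++ p′ ∷ p ∷ ys → ⊥
        d₅ k k′ with ∈-++⁻ rs′ k′
        ... | inj₂ (here refl) = p′∉ (in-zs (∈-++⁺ˡ (∈-++⁺ˡ k)))
        ... | inj₂ (there k″) = d₁₂ (∈-++⁺ˡ k) k″
        ... | inj₁ k″ with back (there k″)
        ...  | inj₁ refl = d₃ k (here refl)
        ...  | inj₂ k‴ = proj₁ (proj₂ (off k‴)) (in-zs (∈-++⁺ˡ (∈-++⁺ˡ k)))
        inn : ∀ {v} → v ∈ xs₁ ++ rs′ ++ p′ ∷ p ∷ ys → D v → v ≡ a
        inn m d with ∈-++⁻ xs₁ m
        ... | inj₁ k = inner (in-zs (∈-++⁺ˡ (∈-++⁺ˡ k))) d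
        ... | inj₂ k with ∈-++⁻ rs′ k
        ...  | inj₂ (here refl) = ⊥-elim (¬Dp′ d)
        ...  | inj₂ (there k′) = inner (in-zs (∈-++⁺ʳ _ k′)) d
        ...  | inj₁ k′ with back (there k′)
        ...  | inj₁ refl = inner e∈ d
        ...  | inj₂ k″ = ⊥-elim (proj₁ (off k″) d)

  -- Going round the odd cycle cs either way gives ears of both parities.
  reroute : (E : OpenEar) → ∀ {u cs} → Walk Edge u u cs → Unique cs → odd? (length cs) ≡ true → (∀ {v} → v ∈ cs → D v → v ≡ a) →
    ∀ {f₀ l₀} → f₀ ≢ l₀ → f₀ ∈ list E → l₀ ∈ list E → f₀ ∈ cs → l₀ ∈ cs → ∀ b →
    Σ (EarAt G D a (proj₁ E)) λ E′ → odd? (length (EarAt.zs E′)) ≡ b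
  -- Between its first vertex `f` and its last vertex `l` on `cs` the ear is replaced by an arc of
  -- `cs`. The parts that are kept meet `cs` only in `l`, so nothing repeats.
  reroute (q , Dq , q≢a , E) {u} {cs} wc uc odd cs∩D {f₀} {l₀} ne mf ml cf cl b with split-first (_∈? cs) mf cf
  ... | as , f , bs , eq , f∈ , none₁ = go (other (subst (f₀ ∈_) eq mf) (subst (l₀ ∈_) eq ml))
    where
    open EarAt E
    later : ∀ {y} → y ∈ as ++ f ∷ bs → y ∈ cs → y ≢ f → y ∈ bs
    later m c y≢f with ∈-++⁻ as m
    ... | inj₁ k = ⊥-elim (none₁ k c)
    ... | inj₂ (here e) = ⊥-elim (y≢f e)
    ... | inj₂ (there k) = k
    other : f₀ ∈ as ++ f ∷ bs → l₀ ∈ as ++ f ∷ bs → ∃ λ y → y ∈ bs × y ∈ cs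
    other m m′ with f₀ Fin.≟ f
    ... | yes refl = l₀ , later m′ cl (λ e → ne (≡.sym e)) , cl
    ... | no e = f₀ , later m cf e , cf
    go : (∃ λ y → y ∈ bs × y ∈ cs) → Σ (EarAt G D a q) λ E′ → odd? (length (EarAt.zs E′)) ≡ b
    go (y , y∈ , y∈c) with split-last (_∈? cs) y∈ y∈c
    ... | ds , l , es , refl , l∈ , none₂ with splitʷ as (subst (Walk Edge a q) eq walk) | Unique-++⁻ as (subst Unique eq unique)
    ... | w₁ , w₂ | u₁ , u₂ , d₁ with splitʷ (f ∷ ds) w₂ | Unique-++⁻ (f ∷ ds) u₂
    ... | _ , w₃ | _ , u₃ , d₃ with arcs asym wc uc f∈ l∈ (λ e → d₃ (here refl) (here e))
    ... | α , β , total = pick (odd? (length (EarAt.zs (via α))) ≟ᵇ b)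
      where
      via : Arc Edge cs f l → EarAt G D a q
      via γ = record
        { zs = as ++ Γ.vs ++ l ∷ es ; walk = w₁ ++ʷ (Γ.walk ++ʷ w₃)
        ; unique = Unique-++ u₁ (Unique-++ Γ.unique u₃ (λ { m (here refl) → Γ.end∉ m ; m (there k) → none₂ k (Γ.sub m) }))
            (λ m k → [ (λ k → none₁ m (Γ.sub k)) , (λ k → d₁ m (there (∈-++⁺ʳ ds k))) ]′ (∈-++⁻ Γ.vs k))
        ; inner = λ m d → [ (λ k → inner (subst (_ ∈_) (≡.sym eq) (∈-++⁺ˡ k)) d) ,
            (λ k → [ (λ k → cs∩D (Γ.sub k) d) , (λ k → inner (subst (_ ∈_) (≡.sym eq) (∈-++⁺ʳ as (there (∈-++⁺ʳ ds k)))) d) ]′ (∈-++⁻ Γ.vs k)) ]′ (∈-++⁻ as m) }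
        where module Γ = Arc γ
      parity : ∀ γ → odd? (length (EarAt.zs (via γ))) ≡ odd? (length as) xor (odd? (length (Arc.vs γ)) xor odd? (length (l ∷ es)))
      parity γ = trans (cong odd? (trans (length-++ as) (cong (length as +_) (length-++ (Arc.vs γ)))))
        (trans (odd?-+ (length as) _) (cong (odd? (length as) xor_) (odd?-+ (length (Arc.vs γ)) _)))
      differ : odd? (length (Arc.vs α)) xor odd? (length (Arc.vs β)) ≡ true
      differ = trans (≡.sym (odd?-+ (length (Arc.vs α)) _)) (trans (cong odd? total) odd)
      flip : ∀ x y z w → y xor z ≡ true → (x xor (y xor w)) ≢ b → (x xor (z xor w)) ≡ b
      flip x y z w e ne = trans (swap-arc x y z w e) (≡.sym (¬-not λ eq → ne (≡.sym eq)))
        where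
        swap-arc : ∀ x y z w → y xor z ≡ true → x xor (z xor w) ≡ not (x xor (y xor w))
        swap-arc true true false w _ = ≡.sym (cong not (not-not w))
        swap-arc true false true w _ = refl
        swap-arc false true false w _ = ≡.sym (not-not w)
        swap-arc false false true w _ = refl
      pick : Dec (odd? (length (EarAt.zs (via α))) ≡ b) → Σ (EarAt G D a q) λ E′ → odd? (length (EarAt.zs E′)) ≡ b
      pick (yes e) = via α , e
      pick (no ne) = via β , trans (parity β) (flip (odd? (length as)) (odd? (length (Arc.vs α))) (odd? (length (Arc.vs β))) (odd? (length (l ∷ es))) differ (λ e → ne (trans (parity α) e)))

-- Tree steps change the level by one, so an odd sum of the length and the levels of both ends marks
-- the wrong parity. `off′` keeps `D` off the side of `z′` except perhaps at the root; by `above`,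
-- the vertices of `D` on the side of `z` other than `apex` are descendants of `apex`.
module OddEar {n} (G : Graph n) (asym : Symmetricᵇ (adj G)) (airr : ∀ {u v} → adj G u v ≡ true → u ≢ v)
  (conn : ∀ x → ConnectedWithout G x) {x₀} (T : BFS (adj G) (λ _ → true) x₀)
  {D : Fin n → Set} (D? : Decidable D) {apex : Fin n} (Da : D apex)
  (below : ∀ {v} → D v → BFS.lev T apex ≤ BFS.lev T v)
  {child : Fin n} (Dc : D child) (child≢ : child ≢ apex) (apex-child : adj G apex child ≡ true)
  {j} (1≤j : 1 ≤ j) {z z′ : Fin n} (lz : BFS.lev T z ≡ j) (lz′ : BFS.lev T z′ ≡ j) (zz′ : adj G z′ z ≡ true)
  (meet : ∀ {a b} → a ≤ j → b ≤ j → Tree.anc asym T a z ≡ Tree.anc asym T b z′ → a ≡ j)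
  (off′ : ∀ {b} → b < j → ¬ D (Tree.anc asym T b z′))
  (above : ∀ {a} → a ≤ j → D (Tree.anc asym T a z) → Tree.anc asym T a z ≢ apex →
           ∃ λ b → a < b × b ≤ j × Tree.anc asym T b z ≡ apex) where
  open Tree asym T
  open Ears G asym airr conn D? Da

  private
    Edge : BRel n
    Edge = adj G

    ≤z : ∀ {a} → a ≤ j → a ≤ lev z
    ≤z l = subst (_ ≤_) (≡.sym lz) l
    ≤z′ : ∀ {a} → a ≤ j → a ≤ lev z′
    ≤z′ l = subst (_ ≤_) (≡.sym lz′) l

    anc-j-z : anc j z ≡ x₀
    anc-j-z = anc-root j refl lz
    anc-j-z′ : anc j z′ ≡ x₀
    anc-j-z′ = anc-root j refl lz′

    x₀-apex : D x₀ → x₀ ≡ apex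
    x₀-apex d = ≡.sym (lev-zero refl (n≤0⇒n≡0 (≤-trans (below d) (≤-reflexive lev-root))))

    higher : ∀ {t v} → 1 ≤ t → t ≤ lev v → lev (anc t v) < lev v
    higher {t} {v} 1≤t t≤ = ≤-trans (≤-trans (≤-reflexive (+-comm 1 _)) (+-monoʳ-≤ (lev (anc t v)) 1≤t)) (≤-reflexive (lev-anc+ t≤))

    meet-level : ∀ {s t} → s ≤ j → t ≤ j → anc s z ≡ anc t z′ → s ≡ j × t ≡ j
    meet-level {s} {t} s≤ t≤ e = meet s≤ t≤ e ,
      trans (≡.sym (anc-level {s} {t} (≤z s≤) (≤z′ t≤) (trans lz (≡.sym lz′)) e)) (meet s≤ t≤ e)

    Odd-ear : Set
    Odd-ear = ∃ λ q → D q × q ≢ apex × Σ (EarAt G D apex q) λ E → odd? (length (EarAt.zs E) + lev q + lev apex) ≡ true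

    -- Here `D` meets the side of `z` outside `apex`, and `anc e z` is the vertex nearest to `z`
    -- where it does. The ear climbs from `apex` to the root, descends to `z′`, crosses to `z` and
    -- climbs to `anc e z`. As `lev (anc e z) + e` is `j`, the parity sum is 2k + 2j + 1.
    module Around {e b} (De : D (anc e z)) (e≢ : anc e z ≢ apex) (e<b : e < b) (b≤j : b ≤ j) (eb : anc b z ≡ apex)
      (first : ∀ {s} → s < e → D (anc s z) → anc s z ≡ apex) where
      k : ℕ
      k = lev apex
      k+b : k + b ≡ j
      k+b = trans (cong (λ v → lev v + b) (≡.sym eb)) (trans (lev-anc+ (≤z b≤j)) lz)
      e≤j : e ≤ j
      e≤j = ≤-trans (<⇒≤ e<b) b≤j
      zs₁ : List (Fin n)
      zs₁ = z′ ∷ up e z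
      zs : List (Fin n)
      zs = up k apex ++ down j z′ ++ zs₁
      walk : Walk Edge apex (anc e z) zs
      walk = subst (λ y → Walk Edge apex y (up k apex)) (anc-root k refl refl) (upʷ k ≤-refl) ++ʷ
        (subst (λ y → Walk Edge y z′ (down j z′)) anc-j-z′ (downʷ j (≤z′ ≤-refl)) ++ʷ (zz′ ∷ upʷ e (≤z e≤j)))
      up-apex : ∀ {v} → v ∈ up k apex → ∃ λ s → s < k × v ≡ anc s apex × v ≡ anc (b + s) z × b + s < j
      up-apex m with ∈-up k m
      ... | s , s<k , e′ = s , s<k , e′ , trans e′ (trans (cong (anc s) (≡.sym eb)) (≡.sym (anc-+ b s z))) ,
        ≤-trans (≤-reflexive (≡.sym (+-suc b s))) (≤-trans (+-monoʳ-≤ b s<k) (≤-reflexive (trans (+-comm b k) k+b)))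
      z′-up : z′ ∉ up e z
      z′-up m with ∈-up e m
      ... | s , s<e , e′ = <⇒≢ (≤-trans s<e e≤j) (proj₁ (meet-level {s} {0} (≤-trans (<⇒≤ s<e) e≤j) z≤n (≡.sym e′)))
      down-zs₁ : ∀ {v} → v ∈ down j z′ → v ∈ zs₁ → ⊥
      down-zs₁ m k′ with ∈-down j m
      down-zs₁ m (here refl) | s , s<j , e′ with anc-level {0} {suc s} z≤n (≤z′ s<j) refl e′
      ... | ()
      down-zs₁ m (there k′) | s , s<j , e′ with ∈-up e k′
      ... | s′ , s′<e , e″ = <⇒≢ (≤-trans s′<e e≤j) (proj₁ (meet-level {s′} {suc s} (≤-trans (<⇒≤ s′<e) e≤j) s<j (trans (≡.sym e″) e′)))
      up-rest : ∀ {v} → v ∈ up k apex → v ∈ down j z′ ++ zs₁ → ⊥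
      up-rest m k′ with up-apex m | ∈-++⁻ (down j z′) k′
      ... | s , _ , _ , e′ , l | inj₂ (here refl) = <⇒≢ l (proj₁ (meet-level {b + s} {0} (<⇒≤ l) z≤n (≡.sym e′)))
      ... | s , _ , _ , e′ , l | inj₁ m′ with ∈-down j m′
      ...  | s′ , s′<j , e″ = <⇒≢ l (proj₁ (meet-level {b + s} {suc s′} (<⇒≤ l) s′<j (trans (≡.sym e′) e″)))
      up-rest m k′ | s , _ , _ , e′ , l | inj₂ (there m′) with ∈-up e m′
      ... | s′ , s′<e , e″ = <⇒≢ (≤-trans (≤-trans s′<e (<⇒≤ e<b)) (m≤m+n b s))
        (anc-level {s′} {b + s} (≤z (≤-trans (<⇒≤ s′<e) e≤j)) (≤z (<⇒≤ l)) refl (trans (≡.sym e″) e′))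
      inner : ∀ {v} → v ∈ zs → D v → v ≡ apex
      inner m d with ∈-++⁻ (up k apex) m
      inner m d | inj₁ m′ with up-apex m′
      ... | zero , _ , e′ , _ = e′
      ... | suc s , s<k , e′ , _ = ⊥-elim (<⇒≱ (higher {suc s} {apex} (s≤s z≤n) (<⇒≤ s<k)) (≤-trans (below d) (≤-reflexive (cong lev e′))))
      inner m d | inj₂ m′ with ∈-++⁻ (down j z′) m′
      ... | inj₂ (here refl) = ⊥-elim (off′ 1≤j d)
      inner m d | inj₂ m′ | inj₂ (there m″) with ∈-up e m″
      ... | s , s<e , refl = first s<e d
      inner m d | inj₂ m′ | inj₁ m″ with ∈-down j m″
      ... | s , s<j , e′ with m≤n⇒m<n∨m≡n s<j
      ...  | inj₁ lt = ⊥-elim (off′ lt (subst D e′ d))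
      ...  | inj₂ refl = trans (trans e′ anc-j-z′) (x₀-apex (subst D (trans e′ anc-j-z′) d))
      length-zs : length zs ≡ k + (j + suc e)
      length-zs = trans (length-++ (up k apex)) (cong₂ _+_ (length-up k apex)
        (trans (length-++ (down j z′)) (cong₂ _+_ (length-down j z′) (cong suc (length-up e z)))))
      parity : odd? (length zs + lev (anc e z) + k) ≡ true
      parity = trans (cong odd? (trans (cong (λ l → l + lev (anc e z) + k) length-zs)
          (trans (solve 4 (λ k j e q → k :+ (j :+ (con 1 :+ e)) :+ q :+ k := con 1 :+ (j :+ (q :+ e)) :+ con 2 :* k) refl k j e (lev (anc e z)))
            (cong (λ y → 1 + (j + y) + 2 * k) (trans (lev-anc+ (≤z e≤j)) lz)))))
        (trans (odd?-shift (1 + (j + j)) k) (cong not (trans (cong odd? (cong (j +_) (≡.sym (+-identityʳ j)))) (odd?-double j))))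
        where open +-*-Solver
      ear : Odd-ear
      ear = anc e z , De , e≢ , record
        { zs = zs ; walk = walk
        ; unique = Unique-++ (up-Unique k ≤-refl) (Unique-++ (down-Unique j (≤z′ ≤-refl)) (Unique-∷ z′-up (up-Unique e (≤z e≤j))) down-zs₁) up-rest
        ; inner = inner } , parity

    -- Only `apex` can lie both in `D` and on the odd cycle `cs`. Ears are extended step by step
    -- along the tree path from `apex` to the root, then to the neighbour `x₁` of the root on `cs`.
    -- The ear then contains two vertices of `cs`, as `reroute` requires.
    module Through (trivial : ∀ {a} → a ≤ j → D (anc a z) → anc a z ≡ apex) where
      cs : List (Fin n)
      cs = up j z ++ down j z′ ++ [ z′ ]
      walk-cs : Walk Edge z z cs
      walk-cs = subst (λ y → Walk Edge z y (up j z)) anc-j-z (upʷ j (≤z ≤-refl)) ++ʷ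
        (subst (λ y → Walk Edge y z′ (down j z′)) anc-j-z′ (downʷ j (≤z′ ≤-refl)) ++ʷ (zz′ ∷ []))
      ∈-cs : ∀ {v} → v ∈ cs → (∃ λ s → s < j × v ≡ anc s z) ⊎ (∃ λ s → s ≤ j × v ≡ anc s z′)
      ∈-cs m with ∈-++⁻ (up j z) m
      ... | inj₁ m′ = inj₁ (∈-up j m′)
      ... | inj₂ m′ with ∈-++⁻ (down j z′) m′
      ...  | inj₂ (here e) = inj₂ (0 , z≤n , e)
      ...  | inj₁ m″ with ∈-down j m″
      ...  | s , l , e = inj₂ (suc s , l , e)
      unique-cs : Unique cs
      unique-cs = Unique-++ (up-Unique j (≤z ≤-refl)) (Unique-++ (down-Unique j (≤z′ ≤-refl)) (Unique-∷ (λ ()) []) d₁) d₂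
        where
        d₁ : ∀ {v} → v ∈ down j z′ → v ∈ [ z′ ] → ⊥
        d₁ m (here refl) with ∈-down j m
        ... | s , s<j , e with anc-level {0} {suc s} z≤n (≤z′ s<j) refl e
        ...  | ()
        d₂ : ∀ {v} → v ∈ up j z → v ∈ down j z′ ++ [ z′ ] → ⊥
        d₂ m k with ∈-up j m | ∈-++⁻ (down j z′) k
        ... | s , s<j , e | inj₂ (here refl) = <⇒≢ s<j (proj₁ (meet-level {s} {0} (<⇒≤ s<j) z≤n (≡.sym e)))
        ... | s , s<j , e | inj₁ k′ with ∈-down j k′
        ...  | s′ , s′<j , e′ = <⇒≢ s<j (proj₁ (meet-level {s} {suc s′} (<⇒≤ s<j) s′<j (trans (≡.sym e) e′)))
      odd-cs : odd? (length cs) ≡ true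
      odd-cs = trans (cong odd? (trans (length-++ (up j z)) (cong₂ _+_ (length-up j z) (trans (length-++ (down j z′)) (cong (_+ 1) (length-down j z′))))))
        (trans (cong odd? (trans (cong (j +_) (+-comm j 1)) (trans (+-suc j j) (cong (λ y → suc (j + y)) (≡.sym (+-identityʳ j)))))) (cong not (odd?-double j)))
      cs∩D : ∀ {v} → v ∈ cs → D v → v ≡ apex
      cs∩D m d with ∈-cs m
      ... | inj₁ (s , s<j , refl) = trivial (<⇒≤ s<j) d
      ... | inj₂ (s , s≤j , refl) with m≤n⇒m<n∨m≡n s≤j
      ...  | inj₁ lt = ⊥-elim (off′ lt d)
      ...  | inj₂ refl = trans anc-j-z′ (x₀-apex (subst D anc-j-z′ d))
      -- The tree edge from `apex` to its child in `D` serves as the first ear.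
      start : OpenEar
      start = child , Dc , child≢ , record
        { zs = [ apex ] ; walk = apex-child ∷ [] ; unique = Unique-∷ (λ ()) [] ; inner = λ { (here e) _ → e } }
      climb : ∀ t → t ≤ lev apex → Σ OpenEar λ E → anc t apex ∈ list E
      climb zero _ = start , here refl
      climb (suc t) l with climb t (<⇒≤ l)
      ... | E , m with extend E m (subst (λ y → Edge (anc t apex) y ≡ true) (≡.sym (anc-suc t apex)) (par-adj (trans (lev-anc≤ (<⇒≤ l)) (+-∸-assoc 1 l))))
                         (λ d → <⇒≱ (higher {suc t} {apex} (s≤s z≤n) l) (below d))
      ...  | E′ , _ , m′ = E′ , m′
      x₁ : Fin n
      x₁ = anc (j ∸ 1) z
      j-1 : suc (j ∸ 1) ≡ j
      j-1 = m+[n∸m]≡n 1≤j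
      lx₁ : lev x₁ ≡ 1
      lx₁ = +-cancelʳ-≡ (j ∸ 1) _ _ (trans (lev-anc+ (≤z (m∸n≤m j 1))) (trans lz (≡.sym j-1)))
      par-x₁ : par x₁ ≡ x₀
      par-x₁ = trans (≡.sym (anc-suc (j ∸ 1) z)) (trans (cong (λ t → anc t z) j-1) anc-j-z)
      both : Σ OpenEar λ E → x₀ ∈ list E × x₁ ∈ list E
      both with climb (lev apex) ≤-refl | D? x₁
      -- If `x₁` lies in `D`, it is `apex`, which is on every ear.
      ... | E , m | yes d = E , subst (_∈ list E) (anc-root (lev apex) refl refl) m , subst (_∈ list E) (≡.sym (trivial (m∸n≤m j 1) d)) (apex-∈ E)
      ... | E , m | no ¬d = extend E (subst (_∈ list E) (anc-root (lev apex) refl refl) m) (asym (subst (λ y → Edge x₁ y ≡ true) par-x₁ (par-adj lx₁))) ¬d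
      ear : Odd-ear
      ear = from both
        where
        x₀≢x₁ : x₀ ≢ x₁
        x₀≢x₁ e = 0≢1+n (trans (≡.sym lev-root) (trans (cong lev e) lx₁))
        ∈-down-last : ∀ t v → 1 ≤ t → anc t v ∈ down t v
        ∈-down-last (suc zero) v _ = here refl
        ∈-down-last (suc (suc t)) v _ = ∈-++⁺ˡ (∈-down-last (suc t) (par v) (s≤s z≤n))
        ∈-up-self : ∀ t s v → s < t → anc s v ∈ up t v
        ∈-up-self (suc t) zero v _ = here refl
        ∈-up-self (suc t) (suc s) v (s≤s l) = there (∈-up-self t s (par v) l)
        x₀∈ : x₀ ∈ cs
        x₀∈ = ∈-++⁺ʳ (up j z) (∈-++⁺ˡ (subst (_∈ down j z′) anc-j-z′ (∈-down-last j z′ 1≤j)))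
        x₁∈ : x₁ ∈ cs
        x₁∈ = ∈-++⁺ˡ (∈-up-self j (j ∸ 1) z (≤-reflexive j-1))
        not-xor : ∀ b → not b xor b ≡ true
        not-xor true = refl
        not-xor false = refl
        from : (Σ OpenEar λ E → x₀ ∈ list E × x₁ ∈ list E) → Odd-ear
        from (E@(q , Dq , q≢ , _) , m₀ , m₁) with reroute E walk-cs unique-cs odd-cs cs∩D x₀≢x₁ m₀ m₁ x₀∈ x₁∈ (not (odd? (lev q + lev apex)))
        ... | E′ , e = q , Dq , q≢ , E′ , trans (cong odd? (+-assoc (length (EarAt.zs E′)) (lev q) (lev apex)))
          (trans (odd?-+ (length (EarAt.zs E′)) (lev q + lev apex)) (trans (cong (_xor odd? (lev q + lev apex)) e) (not-xor (odd? (lev q + lev apex)))))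

  odd-ear : ∃ λ q → D q × q ≢ apex × Σ (EarAt G D apex q) λ E → odd? (length (EarAt.zs E) + lev q + lev apex) ≡ true
  odd-ear with any? {n = suc j} (λ a → D? (anc (toℕ a) z) ×-dec ¬? (anc (toℕ a) z Fin.≟ apex))
  ... | no none = Through.ear λ {a} a≤j d → decide a a≤j d (anc a z Fin.≟ apex)
    where
    decide : ∀ a → a ≤ j → D (anc a z) → Dec (anc a z ≡ apex) → anc a z ≡ apex
    decide a a≤j d (yes e) = e
    decide a a≤j d (no ne) = ⊥-elim (none (Fin.fromℕ< (s≤s a≤j) ,
      subst (λ k → D (anc k z) × anc k z ≢ apex) (≡.sym (Finₚ.toℕ-fromℕ< (s≤s a≤j))) (d , ne)))
  ... | yes (a , p) with least (λ k → D? (anc k z) ×-dec ¬? (anc k z Fin.≟ apex)) p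
  ...  | e , e≤a , (De , ne) , min with above (≤-trans e≤a (≤-pred (Finₚ.toℕ<n a))) De ne
  ...  | b , e<b , b≤j , eb = Around.ear De ne e<b b≤j eb λ {s} s<e d → decide s s<e d (anc s z Fin.≟ apex)
    where
    decide : ∀ s → s < e → D (anc s z) → Dec (anc s z ≡ apex) → anc s z ≡ apex
    decide s s<e d (yes eq) = eq
    decide s s<e d (no ne) = ⊥-elim (min s<e (d , ne))

-- Chorded cycles in the layers of a search tree

record LowestCommon {n} (G : Graph n) (asym : Symmetricᵇ (adj G)) {x₀} (T : BFS (adj G) (λ _ → true) x₀) (c : ℕ → Fin n) (i : ℕ) : Set where
  field
    h  : ℕ
    1≤h  : 1 ≤ h
    h≤i  : h ≤ i
    apex  : Fin n
    common : ∀ x → BFS.lev T (c x) ≡ i → Tree.anc asym T h (c x) ≡ apex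
    last  : ∀ {t} → t < h → ∀ q → ∃ λ y → BFS.lev T (c y) ≡ i × Tree.anc asym T t (c y) ≢ q

-- `h` is the least height at which all ancestors agree. Two distinct vertices make it positive, and
-- a common ancestor `q` at a smaller height would contradict minimality.
lowest-common : ∀ {n} (G : Graph n) (asym : Symmetricᵇ (adj G)) {x₀} (T : BFS (adj G) (λ _ → true) x₀)
  {H : BRel n} (sy : Symmetricᵇ H) {ν} (C : ChordedCycle H ν) {i} → let open ChordedCycle C; open BFS T in
  ∀ {x y} → lev (c x) ≡ i → lev (c y) ≡ i → c x ≢ c y → LowestCommon G asym T c i
lowest-common G asym T sy {ν} C {i} {x₁} {y₁} lx ly ne = build (least Agree? {i} λ x y l l′ → trans (anc-root i refl l) (≡.sym (anc-root i refl l′)))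
  where
  open ChordedCycle C
  open ChordPaths sy C using (c-mod)
  open Tree asym T
  instance
    ν-nonZero : NonZero ν
    ν-nonZero = >-nonZero (≤-trans (s≤s z≤n) (≤-trans (m≤n+m 2 r) r+2≤ν))
  index : ℕ → Fin ν
  index x = Fin.fromℕ< (m%n<n x ν)
  c-index : ∀ x → c x ≡ c (toℕ (index x))
  c-index x = trans (c-mod x) (cong c (≡.sym (Finₚ.toℕ-fromℕ< (m%n<n x ν))))
  Agree : ℕ → Set
  Agree h = ∀ (x y : Fin ν) → lev (c (toℕ x)) ≡ i → lev (c (toℕ y)) ≡ i → anc h (c (toℕ x)) ≡ anc h (c (toℕ y))
  Agree? : Decidable Agree
  Agree? h = all? λ x → all? λ y → (lev (c (toℕ x)) ℕₚ.≟ i) →-dec ((lev (c (toℕ y)) ℕₚ.≟ i) →-dec (anc h (c (toℕ x)) Fin.≟ anc h (c (toℕ y))))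
  at : ∀ {h} → Agree h → ∀ x y → lev (c x) ≡ i → lev (c y) ≡ i → anc h (c x) ≡ anc h (c y)
  at {h} p x y l l′ = trans (cong (anc h) (c-index x)) (trans (p (index x) (index y) (trans (cong lev (≡.sym (c-index x))) l) (trans (cong lev (≡.sym (c-index y))) l′))
    (cong (anc h) (≡.sym (c-index y))))
  build : (∃ λ h → h ≤ i × Agree h × (∀ {t} → t < h → ¬ Agree t)) → LowestCommon G asym T c i
  build (h , h≤i , p , min) = record
    { h = h ; 1≤h = positive h p ; h≤i = h≤i ; apex = anc h (c x₁)
    ; common = λ x l → at {h} p x x₁ l lx
    ; last = λ {t} t<h q → differs t t<h q }
    where
    positive : ∀ h → Agree h → 1 ≤ h
    positive zero p = ⊥-elim (ne (at {0} p x₁ y₁ lx ly))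
    positive (suc h) _ = s≤s z≤n
    differs : ∀ t → t < h → ∀ q → ∃ λ y → lev (c y) ≡ i × anc t (c y) ≢ q
    differs t t<h q with any? {n = ν} (λ y → (lev (c (toℕ y)) ℕₚ.≟ i) ×-dec ¬? (anc t (c (toℕ y)) Fin.≟ q))
    ... | yes (y , l , e) = toℕ y , l , e
    ... | no none = ⊥-elim (min t<h λ x y l l′ → trans (all-q x l) (≡.sym (all-q y l′)))
      where
      all-q : ∀ (x : Fin ν) → lev (c (toℕ x)) ≡ i → anc t (c (toℕ x)) ≡ q
      all-q x l with anc t (c (toℕ x)) Fin.≟ q
      ... | yes e = e
      ... | no e = ⊥-elim (none (x , l , e))

OddCycles : ∀ {n} → Graph n → ℕ → Set
OddCycles G N = Σ ℕ λ m → Odd m × (∀ i → i < N → HasCycle G (m + 2 * i))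

-- A chorded cycle inside one level: the tree paths to the apex and an odd path already close odd cycles.
horizontal-cycles : ∀ {n} (G : Graph n) (asym : Symmetricᵇ (adj G)) {x₀} (T : BFS (adj G) (λ _ → true) x₀)
  {H : BRel n} (sy : Symmetricᵇ H) → (∀ {u v} → H u v ≡ true → adj G u v ≡ true) →
  (∀ {u v} → H u v ≡ true → BFS.lev T u ≡ BFS.lev T v) →
  ∀ {ν} → ChordedCycle H ν → ∀ {N} → 2 * N + 2 ≤ ν → OddCycles G N
horizontal-cycles {n} G asym T {H} sy H⊆G flat {ν} C {N} large = 1 + 2 * suc h′ , (suc h′ , refl) , cycles
  where
  open ChordedCycle C
  open Tree asym T
  i : ℕ
  i = lev (c 0)
  level : ∀ x → lev (c x) ≡ i
  level zero = refl
  level (suc x) = trans (≡.sym (flat (edge x))) (level x)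
  c≢ : c 0 ≢ c 1
  c≢ e = 0≢1+n (inj (≤-trans (s≤s z≤n) 2≤ν) 2≤ν e)
    where
    2≤ν : 2 ≤ ν
    2≤ν = ≤-trans (m≤n+m 2 r) r+2≤ν
  L : LowestCommon G asym T c i
  L = lowest-common G asym T sy C {i} {0} {1} refl (level 1) c≢
  open LowestCommon L
  h′ : ℕ
  h′ = h ∸ 1
  h≡ : suc h′ ≡ h
  h≡ = m+[n∸m]≡n 1≤h
  open Apex G asym T sy H⊆G C (λ x → inj₁ (level x)) h≤i common last (0 , refl) using (Ear; tree-cycles)
  q : Fin n
  q = anc h′ (c 0)
  lev-q : lev q ≡ suc (i ∸ h)
  lev-q = trans (lev-anc≤ (≤-trans (n≤1+n h′) (≤-trans (≤-reflexive h≡) h≤i))) (trans (+-∸-assoc 1 {i} {suc h′} (subst (_≤ i) (≡.sym h≡) h≤i)) (cong (λ k → suc (i ∸ k)) h≡))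
  apex≡ : par q ≡ apex
  apex≡ = trans (≡.sym (anc-suc h′ (c 0))) (trans (cong (λ k → anc k (c 0)) h≡) (common 0 refl))
  -- The single tree edge from `apex` to its child above `c 0`. A path of length `ℓ` then closes to
  -- a cycle of length `ℓ + 2 * h`, odd for odd `ℓ`.
  E : Ear q
  E = record { zs = [ apex ] ; walk = asym (subst (λ y → adj G q y ≡ true) apex≡ (par-adj lev-q)) ∷ []
             ; unique = Unique-∷ (λ ()) [] ; inner = λ { (here e) _ → e } }
  cycles : ∀ k → k < N → HasCycle G (1 + 2 * suc h′ + 2 * k)
  cycles k k<N = subst (HasCycle G) (trans (cong (λ y → 1 + 2 * k + (y + 1) + h′) (≡.sym h≡))
      (solve 2 (λ k h → con 1 :+ con 2 :* k :+ (con 1 :+ h :+ con 1) :+ h := con 1 :+ con 2 :* (con 1 :+ h) :+ con 2 :* k) refl k h′))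
    (tree-cycles {a = 0} E (≤-reflexive h≡) refl refl (1 + 2 * k) (s≤s z≤n) ℓ<ν (λ {_} {y} _ _ → level y) (inj₁ (k , refl)))
    where
    open +-*-Solver
    ℓ<ν : 1 + 2 * k < ν
    ℓ<ν = ≤-trans (≤-trans (≤-reflexive (+-comm 2 (2 * k))) (+-monoˡ-≤ 2 (*-monoʳ-≤ 2 (<⇒≤ k<N)))) large

-- The odd cycle K consists of the tree paths from x₀ to z and to z′ and the edge z′z; H joins level i to level i + 1.
module Crossing {n} (G : Graph n) (asym : Symmetricᵇ (adj G)) (airr : ∀ {u v} → adj G u v ≡ true → u ≢ v)
  (conn : ∀ x → ConnectedWithout G x) {x₀} (T : BFS (adj G) (λ _ → true) x₀)
  {j} (1≤j : 1 ≤ j) {z z′ : Fin n} (lz : BFS.lev T z ≡ j) (lz′ : BFS.lev T z′ ≡ j) (zz′ : adj G z′ z ≡ true)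
  (meet : ∀ {a b} → a ≤ j → b ≤ j → Tree.anc asym T a z ≡ Tree.anc asym T b z′ → a ≡ j)
  {H : BRel n} (sy : Symmetricᵇ H) (H⊆G : ∀ {u v} → H u v ≡ true → adj G u v ≡ true) {ν} (C : ChordedCycle H ν) {i}
  (levels : ∀ x → BFS.lev T (ChordedCycle.c C x) ≡ i ⊎ BFS.lev T (ChordedCycle.c C x) ≡ suc i)
  (flip : ∀ {u v} → H u v ≡ true → odd? (BFS.lev T v) ≡ not (odd? (BFS.lev T u)))
  (branch : ∀ x → BFS.lev T (ChordedCycle.c C x) ≡ i →
    Tree.anc asym T (BFS.lev T (ChordedCycle.c C x) ∸ 1) (ChordedCycle.c C x) ≢ Tree.anc asym T (j ∸ 1) z′)
  (upper-off : ∀ x → BFS.lev T (ChordedCycle.c C x) ≡ suc i → ∀ {t} → t ≤ j →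
    ChordedCycle.c C x ≢ Tree.anc asym T t z × ChordedCycle.c C x ≢ Tree.anc asym T t z′) where
  open ChordedCycle C
  open ChordPaths sy C using (ChordPath; c-mod)
  open Tree asym T

  private
    instance
      ν-nonZero : NonZero ν
      ν-nonZero = >-nonZero (≤-trans (s≤s z≤n) (≤-trans (m≤n+m 2 r) r+2≤ν))

    i≢si : ∀ {b} → not b ≢ b
    i≢si {true} ()
    i≢si {false} ()

    by-parity-low : ∀ x → odd? (lev (c x)) ≡ odd? i → lev (c x) ≡ i
    by-parity-low x e with levels x
    ... | inj₁ l = l
    ... | inj₂ l = ⊥-elim (i≢si (trans (cong odd? (≡.sym l)) e))

    by-parity-high : ∀ x → odd? (lev (c x)) ≡ not (odd? i) → lev (c x) ≡ suc i
    by-parity-high x e with levels x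
    ... | inj₂ l = l
    ... | inj₁ l = ⊥-elim (i≢si (≡.sym (trans (cong odd? (≡.sym l)) e)))

    low-next : ∀ x → lev (c x) ≡ i → lev (c (suc x)) ≡ suc i
    low-next x l = by-parity-high (suc x) (trans (flip (edge x)) (cong (not ∘ odd?) l))

    high-next : ∀ x → lev (c x) ≡ suc i → lev (c (suc x)) ≡ i
    high-next x l = by-parity-low (suc x) (trans (flip (edge x)) (trans (cong (not ∘ odd?) l) (not-not (odd? i))))

    walk-parity : ∀ {u v xs} → Walk H u v xs → odd? (lev v) ≡ odd? (lev u) xor odd? (length xs)
    walk-parity {u} [] = xor-false (odd? (lev u))
      where
      xor-false : ∀ b → b ≡ b xor false
      xor-false true = refl
      xor-false false = refl
    walk-parity {u} {v} {_ ∷ xs} (e ∷ p) = trans (walk-parity p) (trans (cong (_xor odd? (length xs)) (flip e)) (move (odd? (lev u)) (odd? (length xs))))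
      where
      move : ∀ a b → not a xor b ≡ a xor not b
      move true b = ≡.sym (not-not b)
      move false b = refl

    keep-even : ∀ {x y ℓ} → odd? ℓ ≡ false → ChordPath x y ℓ → lev (c x) ≡ i → lev (c y) ≡ i
    keep-even {x} {y} even p l = by-parity-low y (trans (walk-parity walk) (trans (cong₂ _xor_ (cong odd? l) (trans (cong odd? len) even)) (xor-false (odd? i))))
      where
      open ChordPath p
      xor-false : ∀ b → b xor false ≡ b
      xor-false true = refl
      xor-false false = refl

    keep-odd : ∀ {x y ℓ} → odd? ℓ ≡ true → ChordPath x y ℓ → lev (c x) ≡ suc i → lev (c y) ≡ i
    keep-odd {x} {y} odd p l = by-parity-low y (trans (walk-parity walk) (trans (cong₂ _xor_ (cong odd? l) (trans (cong odd? len) odd)) (xor-true (odd? i))))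
      where
      open ChordPath p
      xor-true : ∀ b → not b xor true ≡ b
      xor-true true = refl
      xor-true false = refl

    alternating : ∀ x s → lev (c x) ≡ i → lev (c (x + s)) ≡ i → ∃ λ t → s ≡ t * 2
    alternating x zero _ _ = 0 , refl
    alternating x (suc zero) l l′ = ⊥-elim (1+n≢n (trans (≡.sym (low-next x l)) (trans (cong (lev ∘ c) (+-comm 1 x)) l′)))
    alternating x (suc (suc s)) l l′ with alternating (suc (suc x)) s (high-next (suc x) (low-next x l))
        (trans (cong (lev ∘ c) (trans (cong suc (≡.sym (+-suc x s))) (≡.sym (+-suc x (suc s))))) l′)
    ... | t , e = suc t , cong (2 +_) e

    two-low : ∃ λ x → ∃ λ y → lev (c x) ≡ i × lev (c y) ≡ i × c x ≢ c y
    two-low with levels 0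
    ... | inj₁ l = 0 , 2 , l , high-next 1 (low-next 0 l) , λ e → 0≢1+n (inj (≤-trans (s≤s z≤n) 4≤ν) (≤-trans (s≤s (s≤s (s≤s z≤n))) 4≤ν) e)
      where
      4≤ν : 4 ≤ ν
      4≤ν = ≤-trans (+-monoˡ-≤ 2 2≤r) r+2≤ν
    ... | inj₂ l = 1 , 3 , high-next 0 l , high-next 2 (low-next 1 (high-next 0 l)) , λ e → 0≢1+n (suc-injective (inj (≤-trans (s≤s (s≤s z≤n)) 4≤ν) 4≤ν e))
      where
      4≤ν : 4 ≤ ν
      4≤ν = ≤-trans (+-monoˡ-≤ 2 2≤r) r+2≤ν

    b₀ : ℕ
    b₀ = proj₁ two-low
    lb₀ : lev (c b₀) ≡ i
    lb₀ = proj₁ (proj₂ (proj₂ two-low))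

    L : LowestCommon G asym T c i
    L = lowest-common G asym T sy C {i} {b₀} lb₀ (proj₁ (proj₂ (proj₂ (proj₂ two-low)))) (proj₂ (proj₂ (proj₂ (proj₂ two-low))))

  open LowestCommon L
  open Apex G asym T sy H⊆G C levels h≤i common last (b₀ , lb₀)

  private
    InD? : Decidable InD
    InD? v = map′ to from ((any? λ (x : Fin ν) → v Fin.≟ c (toℕ x)) ⊎-dec
        (any? λ (x : Fin ν) → any? λ (t : Fin (suc h)) → (lev (c (toℕ x)) ℕₚ.≟ i) ×-dec (v Fin.≟ anc (toℕ t) (c (toℕ x)))))
      where
      c-index : ∀ x → c x ≡ c (toℕ (Fin.fromℕ< (m%n<n x ν)))
      c-index x = trans (c-mod x) (cong c (≡.sym (Finₚ.toℕ-fromℕ< (m%n<n x ν))))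
      Bounded : Set
      Bounded = (∃ λ (x : Fin ν) → v ≡ c (toℕ x)) ⊎ (∃ λ (x : Fin ν) → ∃ λ (t : Fin (suc h)) → lev (c (toℕ x)) ≡ i × v ≡ anc (toℕ t) (c (toℕ x)))
      to : Bounded → InD v
      to (inj₁ (x , e)) = inj₁ (toℕ x , e)
      to (inj₂ (x , t , l , e)) = inj₂ (toℕ x , toℕ t , l , ≤-pred (Finₚ.toℕ<n t) , e)
      from : InD v → Bounded
      from (inj₁ (x , e)) = inj₁ (_ , trans e (c-index x))
      from (inj₂ (x , t , l , t≤h , e)) = inj₂ (_ , Fin.fromℕ< (s≤s t≤h) , trans (cong lev (≡.sym (c-index x))) l ,
        trans e (cong₂ anc (≡.sym (Finₚ.toℕ-fromℕ< (s≤s t≤h))) (c-index x)))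

    -- By `upper-off` the vertices of the chorded cycle on level `suc i` are not on K, so `InD`
    -- meets K in tree vertices only.
    on-chain : ∀ {v t} → t ≤ j → v ≡ anc t z ⊎ v ≡ anc t z′ → InD v → OnTree v
    on-chain t≤j e (inj₂ tree) = tree
    on-chain t≤j e (inj₁ (x , e′)) with levels x
    ... | inj₁ l = x , 0 , l , z≤n , e′
    ... | inj₂ l = ⊥-elim ([ (λ e → proj₁ (upper-off x l t≤j) (trans (≡.sym e′) e)) , (λ e → proj₂ (upper-off x l t≤j) (trans (≡.sym e′) e)) ]′ e)

    -- A vertex and its ancestors other than the root have the same ancestor on level 1, which names
    -- their branch for the comparison with `branch`.
    top : ∀ {t v} → t < lev v → anc (lev (anc t v) ∸ 1) (anc t v) ≡ anc (lev v ∸ 1) v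
    top {t} {v} l = trans (≡.sym (anc-+ t (lev (anc t v) ∸ 1) v)) (cong (λ k → anc k v)
      (trans (cong (λ m → t + (m ∸ 1)) (lev-anc≤ (<⇒≤ l))) (trans (≡.sym (+-∸-assoc t (m<n⇒0<n∸m l))) (cong (_∸ 1) (m+[n∸m]≡n (<⇒≤ l))))))

    off′ : ∀ {b} → b < j → ¬ InD (anc b z′)
    off′ {b} b<j d with on-chain (<⇒≤ b<j) (inj₂ refl) d
    ... | x , t , l , t≤h , e = branch x l (trans (≡.sym (top t<)) (trans (≡.sym (cong (λ v → anc (lev v ∸ 1) v) e)) (trans (top b<) (cong (λ k → anc (k ∸ 1) z′) lz′))))
      where
      b< : b < lev z′
      b< = subst (b <_) (≡.sym lz′) b<j
      t< : t < lev (c x)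
      t< = ≤∧≢⇒< (≤-trans t≤h (subst (h ≤_) (≡.sym l) h≤i)) λ t≡ → <⇒≢ (subst (0 <_) (≡.sym (lev-anc≤ (<⇒≤ b<))) (m<n⇒0<n∸m b<))
        (≡.sym (trans (cong lev e) (trans (lev-anc≤ (≤-reflexive t≡)) (trans (cong (lev (c x) ∸_) t≡) (n∸n≡0 (lev (c x)))))))

    -- The vertex is some `anc t (c x)`, from which `h ∸ t` more steps lead to `apex`; these steps
    -- also belong to the chain of `z`.
    above : ∀ {a} → a ≤ j → InD (anc a z) → anc a z ≢ apex → ∃ λ b → a < b × b ≤ j × anc b z ≡ apex
    above {a} a≤j d ne with on-chain a≤j (inj₁ refl) d
    ... | x , t , l , t≤h , e = a + (h ∸ t) , ≤-trans (≤-reflexive (+-comm 1 a)) (+-monoʳ-≤ a (m<n⇒0<n∸m t<h)) ,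
        ≤-trans (+-monoʳ-≤ a bound) (≤-reflexive (trans (+-comm a _) (trans (lev-anc+ (subst (a ≤_) (≡.sym lz) a≤j)) lz))) ,
        trans (anc-+ a (h ∸ t) z) (trans (cong (anc (h ∸ t)) e) (trans (≡.sym (anc-+ t (h ∸ t) (c x))) (trans (cong (λ k → anc k (c x)) (m+[n∸m]≡n t≤h)) (common x l))))
      where
      t<h : t < h
      t<h = ≤∧≢⇒< t≤h λ { refl → ne (trans e (common x l)) }
      bound : h ∸ t ≤ lev (anc a z)
      bound = ≤-trans (∸-monoˡ-≤ t h≤i) (≤-reflexive (trans (cong (_∸ t) (≡.sym (trans (cong (λ v → lev v + t) e) (lev-tree l t≤h)))) (m+n∸n≡m _ t)))

    below : ∀ {v} → InD v → lev apex ≤ lev v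
    below (inj₁ (x , refl)) = ≤-trans (≤-trans (m≤m+n (lev apex) h) (≤-reflexive lev-apex)) (lev-c≥ x)
    below (inj₂ (x , t , l , t≤h , refl)) = +-cancelʳ-≤ t (lev apex) _ (≤-trans (+-monoʳ-≤ (lev apex) t≤h) (≤-reflexive (trans lev-apex (≡.sym (lev-tree l t≤h)))))

    h′ : ℕ
    h′ = h ∸ 1
    h≡ : suc h′ ≡ h
    h≡ = m+[n∸m]≡n 1≤h
    child : Fin n
    child = anc h′ (c b₀)
    par-child : par child ≡ apex
    par-child = trans (≡.sym (anc-suc h′ (c b₀))) (trans (cong (λ k → anc k (c b₀)) h≡) (common b₀ lb₀))
    lev-child : lev child ≡ suc (lev apex)
    lev-child = +-cancelʳ-≡ h′ _ _ (trans (lev-tree lb₀ (≤-trans (n≤1+n h′) (≤-reflexive h≡))) (trans (≡.sym lev-apex) (trans (cong (lev apex +_) (≡.sym h≡)) (+-suc (lev apex) h′))))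

    ear : ∃ λ q → InD q × q ≢ apex × Σ (Ear q) λ E → odd? (length (Ear.zs E) + lev q + lev apex) ≡ true
    ear = OddEar.odd-ear G asym airr conn T {D = InD} InD? (inj₂ (b₀ , h , lb₀ , ≤-refl , ≡.sym (common b₀ lb₀))) below
      (inj₂ (b₀ , h′ , lb₀ , ≤-trans (n≤1+n h′) (≤-reflexive h≡) , refl)) (λ e → 1+n≢n (trans (≡.sym lev-child) (cong lev e)))
      (asym (subst (λ y → adj G child y ≡ true) par-child (par-adj lev-child))) 1≤j lz lz′ zz′ meet off′ above

    module _ {N} (large : 2 * N + 2 ≤ ν) where
      open +-*-Solver

      -- Even paths preserve level `i`, and `m` is the cycle length for a path of length 2. Adding
      -- `2 * i`, once as `lev q + t` and once as `lev apex + h`, reduces its parity to that of the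
      -- ear.
      from-tree : ∀ {x t q} → lev (c x) ≡ i → t < h → q ≡ anc t (c x) → (E : Ear q) → odd? (length (Ear.zs E) + lev q + lev apex) ≡ true → OddCycles G N
      from-tree {x} {t} {q} l t<h e E odd = m , odd?⇒Odd m odd-m , λ k k<N →
          subst (HasCycle G) (solve 4 (λ k h w t → con 2 :* (con 1 :+ k) :+ (h :+ w) :+ t := con 2 :+ (h :+ w) :+ t :+ con 2 :* k) refl k h w t)
          (tree-cycles {a = x} E t<h l (≡.sym e) (2 * suc k) (s≤s z≤n) (ℓ<ν k<N) (keep-even (odd?-double (suc k))) (inj₂ alternating))
        where
        w : ℕ
        w = length (Ear.zs E)
        m : ℕ
        m = 2 + (h + w) + t
        ℓ<ν : ∀ {k} → k < N → 2 * suc k < ν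
        ℓ<ν k<N = ≤-trans (s≤s (*-monoʳ-≤ 2 k<N)) (≤-trans (≤-trans (≤-reflexive (+-comm 1 (2 * N))) (+-monoʳ-≤ (2 * N) (s≤s z≤n))) large)
        odd-m : odd? m ≡ true
        odd-m = trans (≡.sym (odd?-shift m i)) (trans (cong odd? (begin-equality
          m + 2 * i  ≡⟨ solve 4 (λ h w t i → con 2 :+ (h :+ w) :+ t :+ con 2 :* i := con 2 :+ (h :+ w) :+ t :+ (i :+ i)) refl h w t i ⟩
          2 + (h + w) + t + (i + i)  ≡⟨ cong₂ (λ a b → 2 + (h + w) + t + (a + b)) (≡.sym (trans (cong (λ v → lev v + t) e) (lev-tree l (<⇒≤ t<h)))) (≡.sym lev-apex) ⟩
          2 + (h + w) + t + (lev q + t + (lev apex + h))  ≡⟨ solve 5 (λ h w t q a → con 2 :+ (h :+ w) :+ t :+ (q :+ t :+ (a :+ h)) := w :+ q :+ a :+ con 2 :* (con 1 :+ h :+ t)) refl h w t (lev q) (lev apex) ⟩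
          w + lev q + lev apex + 2 * (1 + h + t)  ∎)) (trans (odd?-shift (w + lev q + lev apex) (1 + h + t)) odd))
          where open ≤-Reasoning

      -- The ear ends on level `suc i`, so paths must be odd to reach level `i`, from where the
      -- climb to `apex` starts; `m` belongs to a path of length 1.
      from-upper : ∀ {x} → lev (c x) ≡ suc i → (E : Ear (c x)) → odd? (length (Ear.zs E) + lev (c x) + lev apex) ≡ true → OddCycles G N
      from-upper {x} l E odd = m , odd?⇒Odd m odd-m , λ k k<N →
          subst (HasCycle G) (solve 3 (λ k h w → con 1 :+ con 2 :* k :+ (h :+ w) := con 1 :+ (h :+ w) :+ con 2 :* k) refl k h w)
          (upper-cycles {a = x} E 1≤h l (1 + 2 * k) (s≤s z≤n) (ℓ<ν k<N) (k , refl) (keep-odd (cong not (odd?-double k))))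
        where
        w : ℕ
        w = length (Ear.zs E)
        m : ℕ
        m = 1 + (h + w)
        ℓ<ν : ∀ {k} → k < N → 1 + 2 * k < ν
        ℓ<ν {k} k<N = ≤-trans (≤-trans (≤-reflexive (+-comm 2 (2 * k))) (+-monoˡ-≤ 2 (*-monoʳ-≤ 2 (<⇒≤ k<N)))) large
        odd-m : odd? m ≡ true
        odd-m = trans (≡.sym (odd?-shift m i)) (trans (cong odd? (begin-equality
          m + 2 * i  ≡⟨ solve 3 (λ h w i → con 1 :+ (h :+ w) :+ con 2 :* i := h :+ w :+ (con 1 :+ i :+ i)) refl h w i ⟩
          h + w + (suc i + i)  ≡⟨ cong₂ (λ a b → h + w + (a + b)) (≡.sym l) (≡.sym lev-apex) ⟩
          h + w + (lev (c x) + (lev apex + h))  ≡⟨ solve 4 (λ h w q a → h :+ w :+ (q :+ (a :+ h)) := w :+ q :+ a :+ con 2 :* h) refl h w (lev (c x)) (lev apex) ⟩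
          w + lev (c x) + lev apex + 2 * h  ∎)) (trans (odd?-shift (w + lev (c x) + lev apex) h) odd))
          where open ≤-Reasoning

  crossing-cycles : ∀ {N} → 2 * N + 2 ≤ ν → OddCycles G N
  crossing-cycles {N} large with ear
  ... | q , d , q≢ , E , odd = by-kind d
    where
    by-kind : InD q → OddCycles G N
    by-kind (inj₂ (x , t , l , t≤h , e)) = from-tree large l (≤∧≢⇒< t≤h λ { refl → q≢ (trans e (common x l)) }) e E odd
    by-kind (inj₁ (x , refl)) with levels x
    ... | inj₁ l = from-tree large {x} {0} l 1≤h refl E odd
    ... | inj₂ l = from-upper large l E odd

-- The shortest horizontal edge

walkAvoid⇒walk : ∀ {n} {G : Graph n} {bad : Fin n → Set} {u v} → WalkAvoid G bad u v → Σ (List (Fin n)) λ xs → Walk (adj G) u v xs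
walkAvoid⇒walk (WalkAvoid.here _) = [] , []
walkAvoid⇒walk (WalkAvoid.step _ a w) = _ , a ∷ proj₂ (walkAvoid⇒walk w)

count₂-cover : ∀ {n} (Rs : List (BRel n)) {R : BRel n} → (∀ i j → R i j ≡ true → Any (λ B → B i j ≡ true) Rs) →
  count₂ R ≤ sumL (mapL count₂ Rs)
count₂-cover {n} Rs {R} h = ≤-trans (sum-mono λ i → sum-mono λ j → pointwise Rs (R i j) (h i j)) (≤-reflexive (exchange Rs))
  where
  some : ∀ Rs {i j} → Any (λ B → B i j ≡ true) Rs → 1 ≤ sumL (mapL (λ B → ⟦ B i j ⟧) Rs)
  some (B ∷ Rs) {i} {j} (here e) = ≤-trans (⟦⟧-mono {true} {B i j} λ _ → e) (m≤m+n _ _)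
  some (B ∷ Rs) (there a) = ≤-trans (some Rs a) (m≤n+m _ _)
  pointwise : ∀ Rs {i j} b → (b ≡ true → Any (λ B → B i j ≡ true) Rs) → ⟦ b ⟧ ≤ sumL (mapL (λ B → ⟦ B i j ⟧) Rs)
  pointwise Rs false _ = z≤n
  pointwise Rs true f = some Rs (f refl)
  sum-cong : {f g : Fin n → ℕ} → (∀ i → f i ≡ g i) → sumFin f ≡ sumFin g
  sum-cong h = ≤-antisym (sum-mono λ i → ≤-reflexive (h i)) (sum-mono λ i → ≤-reflexive (≡.sym (h i)))
  exchange : ∀ Rs → (sumFin {n} λ i → sumFin {n} λ j → sumL (mapL (λ B → ⟦ B i j ⟧) Rs)) ≡ sumL (mapL count₂ Rs)
  exchange [] = trans (sum-cong λ i → sum-const n 0) (sum-const n 0)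
  exchange (B ∷ Rs) = trans (sum-cong λ i → sum-+ (λ j → ⟦ B i j ⟧) (λ j → sumL (mapL (λ B → ⟦ B i j ⟧) Rs)))
    (trans (sum-+ (λ i → count (B i)) (λ i → sumFin λ j → sumL (mapL (λ B → ⟦ B i j ⟧) Rs))) (cong (count₂ B +_) (exchange Rs)))

2*edgeCount≤ : ∀ {n} (G : Graph n) → 2 * edgeCount G ≤ count₂ (adj G)
2*edgeCount≤ {n} G = begin
  2 * count₂ L  ≡⟨ cong (count₂ L +_) (+-identityʳ (count₂ L)) ⟩
  count₂ L + count₂ L  ≡⟨ cong (count₂ L +_) (count₂-transpose L) ⟨
  count₂ L + count₂ (λ i j → L j i) ≡⟨ sum-+ (λ i → count (L i)) (λ i → count (λ j → L j i)) ⟨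
  sumFin (λ i → count (L i) + count (λ j → L j i)) ≤⟨ sum-mono (λ i → count-disjoint {P = L i} {Q = λ j → L j i}
    (λ j e → proj₂ (∧-elim e)) (λ j e → trans (Graph.sym G i j) (proj₂ (∧-elim e))) (λ j e e′ → disjoint i j (proj₁ (∧-elim e)) (proj₁ (∧-elim e′)))) ⟩
  count₂ (adj G)  ∎
  where
  open ≤-Reasoning
  L : BRel n
  L i j = (toℕ i <ᵇ toℕ j) ∧ adj G i j
  disjoint : ∀ i j → (toℕ i <ᵇ toℕ j) ≡ true → (toℕ j <ᵇ toℕ i) ≡ true → ⊥
  disjoint i j e e′ = <-asym (<ᵇ⇒< (toℕ i) (toℕ j) (≡true⇒T e)) (<ᵇ⇒< (toℕ j) (toℕ i) (≡true⇒T e′))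
    where
    ≡true⇒T : ∀ {b} → b ≡ true → T b
    ≡true⇒T refl = tt

adj-sym : ∀ {n} (G : Graph n) → Symmetricᵇ (adj G)
adj-sym G {i} {j} e = trans (Graph.sym G j i) e

bfs-trees : ∀ {n} (G : Graph n) → Connected G → ∀ x → BFS (adj G) (λ _ → true) x
bfs-trees G connected x = bfs (adj-sym G) (λ _ → true) x (λ _ _ → refl) (λ v _ → walkAvoid⇒walk (connected v x)) refl

-- The trees are a parameter so that distances do not unfold.
module Main {n} (G : Graph n) (twoConn : TwoConnected G) (¬bip : ¬ Bipartite G) (tree : ∀ x → BFS (adj G) (λ _ → true) x) where
  private
    Edge : BRel n
    Edge = adj G
    asym : Symmetricᵇ Edge
    asym = adj-sym G
    airr : ∀ {u v} → Edge u v ≡ true → u ≢ v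
    airr {u} e refl with trans (≡.sym e) (Graph.irrefl G u)
    ... | ()
    conn : ∀ x → ConnectedWithout G x
    conn = proj₂ (proj₂ twoConn)
    v₀ : Fin n
    v₀ = Fin.fromℕ< (≤-trans (s≤s z≤n) (proj₁ twoConn))

    dist : Fin n → Fin n → ℕ
    dist x = BFS.lev (tree x)

    Horizontal : ℕ → Set
    Horizontal j = ∃ λ x → ∃ λ s → ∃ λ t → Edge t s ≡ true × dist x s ≡ j × dist x t ≡ j

    -- Without a horizontal edge the parity of the distance from `v₀` would be a proper 2-colouring.
    some-horizontal : ∃ Horizontal
    some-horizontal with any? (λ s → any? λ t → (Edge t s ≟ᵇ true) ×-dec (dist v₀ s ℕₚ.≟ dist v₀ t))
    ... | yes (s , t , e , l) = dist v₀ s , v₀ , s , t , e , refl , ≡.sym l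
    ... | no none = ⊥-elim (¬bip ((λ v → odd? (dist v₀ v)) , proper))
      where
      not-fixed : ∀ b → b ≢ not b
      not-fixed true ()
      not-fixed false ()
      proper : ∀ i j → Adj G i j → odd? (dist v₀ i) ≢ odd? (dist v₀ j)
      proper i j e eq with <-cmp (dist v₀ i) (dist v₀ j)
      ... | tri≈ _ l _ = none (i , j , asym e , l)
      ... | tri< l _ _ = not-fixed (odd? (dist v₀ i)) (trans eq (cong odd? (≤-antisym (BFS.lip (tree v₀) e) l)))
      ... | tri> _ _ l = not-fixed (odd? (dist v₀ j)) (trans (≡.sym eq) (cong odd? (≤-antisym (BFS.lip (tree v₀) (asym e)) l)))

    shortest : ∃ λ j → Horizontal j × (∀ {j′} → j′ < j → ¬ Horizontal j′)
    shortest with least (λ j → any? λ x → any? λ s → any? λ t → (Edge t s ≟ᵇ true) ×-dec (dist x s ℕₚ.≟ j) ×-dec (dist x t ℕₚ.≟ j)) (proj₂ some-horizontal)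
    ... | j , _ , h , min = j , h , min

  module _ {j} (min : ∀ {j′} → j′ < j → ¬ Horizontal j′) {x s t} (ts : Edge t s ≡ true) (ls : dist x s ≡ j) (lt : dist x t ≡ j) where
    open Tree asym (tree x)

    private
      dist-anc : ∀ {y} t v → t ≤ lev v → dist y v ≤ dist y (anc t v) + t
      dist-anc zero v _ = ≤-reflexive (≡.sym (+-identityʳ _))
      dist-anc {y} (suc t) v l = ≤-trans (BFS.lip (tree y) (asym (par-adj {m = lev v ∸ 1} lv)))
        (≤-trans (s≤s (dist-anc {y} t (par v) (subst (t ≤_) (≡.sym (par-lev lv)) (∸-monoˡ-≤ 1 l)))) (≤-reflexive (≡.sym (+-suc _ t))))
        where
        lv : lev v ≡ suc (lev v ∸ 1)
        lv = ≡.sym (m+[n∸m]≡n {1} (≤-trans (s≤s z≤n) l))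

      triangle : ∀ y m v → dist y v ≡ m → lev v ≤ lev y + m
      triangle y zero v e = ≤-trans (≤-reflexive (cong lev (BFS.lev-zero (tree y) refl e))) (m≤m+n _ 0)
      triangle y (suc m) v e = ≤-trans (lip (asym (BFS.par-adj (tree y) e)))
        (≤-trans (s≤s (triangle y m (BFS.par (tree y) v) (BFS.par-lev (tree y) e))) (≤-reflexive (≡.sym (+-suc _ m))))

      -- The tree path gives the upper bound; the triangle inequality through `anc a v` gives the
      -- lower one, because `lev` is the distance from `x`.
      dist-to-anc : ∀ a v → lev v ≡ j → a ≤ j → dist (anc a v) v ≡ a
      dist-to-anc a v l a≤ = ≤-antisym
        (≤-trans (dist-anc {anc a v} a v a≤′) (≤-reflexive (cong (_+ a) (BFS.lev-root (tree (anc a v))))))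
        (+-cancelˡ-≤ (lev (anc a v)) a _ (≤-trans (≤-reflexive (lev-anc+ a≤′)) (triangle (anc a v) _ v refl)))
        where
        a≤′ : a ≤ lev v
        a≤′ = subst (a ≤_) (≡.sym l) a≤

    -- A common ancestor at height `a < j`, taken as root instead of `x`, would make the same edge
    -- horizontal at distance `a`.
    meet : ∀ {a b} → a ≤ j → b ≤ j → anc a s ≡ anc b t → a ≡ j
    meet {a} {b} a≤ b≤ e with anc-level {a} {b} (subst (a ≤_) (≡.sym ls) a≤) (subst (b ≤_) (≡.sym lt) b≤) (trans ls (≡.sym lt)) e
    ... | refl with m≤n⇒m<n∨m≡n a≤
    ...  | inj₂ eq = eq
    ...  | inj₁ a<j = ⊥-elim (min a<j (anc a s , s , t , ts , dist-to-anc a s ls a≤ , subst (λ y → dist y t ≡ a) (≡.sym e) (dist-to-anc a t lt b≤)))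

    private
      1≤j : 1 ≤ j
      1≤j = positive j refl
        where
        positive : ∀ k → k ≡ j → 1 ≤ k
        positive (suc k) _ = s≤s z≤n
        positive zero e = ⊥-elim (airr ts (trans (lev-zero refl (trans lt (≡.sym e))) (≡.sym (lev-zero refl (trans ls (≡.sym e))))))

      -- Ancestors indexed by level. For `m > j` truncation yields `z` itself; `s` and `t` are not
      -- on such a level, so `w ≢ chain s (lev w)` and its analogue for `t` exclude nothing there.
      chain : Fin n → ℕ → Fin n
      chain z m = anc (j ∸ m) z

      on-chain : ∀ {z a} → lev z ≡ j → a ≤ j → anc a z ≡ chain z (lev (anc a z))
      on-chain {z} {a} l a≤ = cong (λ k → anc k z) (≡.sym (trans (cong (j ∸_) (trans (lev-anc≤ (subst (a ≤_) (≡.sym l) a≤)) (cong (_∸ a) l))) (m∸[m∸n]≡n a≤)))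

      -- Whether `u` hangs off the branch of `s`. At the root the comparison is with the root itself
      -- and fails.
      group : Fin n → Bool
      group u = ⌊ anc (lev u ∸ 1) u Fin.≟ anc (j ∸ 1) s ⌋

      flat? : ∀ u v → Dec (Edge u v ≡ true × lev u ≡ lev v)
      flat? u v = (Edge u v ≟ᵇ true) ×-dec (lev u ℕₚ.≟ lev v)
      flat : BRel n
      flat u v = ⌊ flat? u v ⌋

      Up : Bool → Bool → Fin n → Fin n → Set
      Up π γ u w = Edge u w ≡ true × lev w ≡ suc (lev u) × odd? (lev u) ≡ π × group u ≡ γ × w ≢ chain s (lev w) × w ≢ chain t (lev w)
      up? : ∀ π γ u w → Dec (Up π γ u w)
      up? π γ u w = (Edge u w ≟ᵇ true) ×-dec (lev w ℕₚ.≟ suc (lev u)) ×-dec (odd? (lev u) ≟ᵇ π) ×-dec (group u ≟ᵇ γ)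
        ×-dec ¬? (w Fin.≟ chain s (lev w)) ×-dec ¬? (w Fin.≟ chain t (lev w))
      cross? : ∀ π γ u w → Dec (Up π γ u w ⊎ Up π γ w u)
      cross? π γ u w = up? π γ u w ⊎-dec up? π γ w u
      cross : Bool → Bool → BRel n
      cross π γ u w = ⌊ cross? π γ u w ⌋

      -- Covers the edges whose upper end is on the chain of `z`. Each `u` has exactly one such `w`,
      -- which bounds the pairs by `n` whether or not they are edges.
      onto : Fin n → BRel n
      onto z u w = ⌊ w Fin.≟ chain z (suc (lev u)) ⌋
      onto′ : Fin n → BRel n
      onto′ z u w = onto z w u

      onto-count : ∀ z → count₂ (onto z) ≤ n
      onto-count z = ≤-trans (sum-mono λ u → count-unique λ i k a b → trans (⌊⌋-sound (i Fin.≟ chain z (suc (lev u))) a) (≡.sym (⌊⌋-sound (k Fin.≟ chain z (suc (lev u))) b)))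
        (≤-reflexive (trans (sum-const n 1) (*-identityˡ n)))

      main-classes exceptional : List (BRel n)
      main-classes = flat ∷ cross true true ∷ cross true false ∷ cross false true ∷ cross false false ∷ []
      exceptional = onto s ∷ onto t ∷ onto′ s ∷ onto′ t ∷ []

      upward : ∀ u w → Edge u w ≡ true → lev w ≡ suc (lev u) → (Up (odd? (lev u)) (group u) u w) ⊎ (onto s u w ≡ true) ⊎ (onto t u w ≡ true)
      upward u w e l with w Fin.≟ chain s (suc (lev u)) | w Fin.≟ chain t (suc (lev u))
      ... | yes p | _ = inj₂ (inj₁ refl)
      ... | no _ | yes q = inj₂ (inj₂ refl)
      ... | no p | no q = inj₁ (e , l , refl , refl , subst (λ k → w ≢ chain s k) (≡.sym l) p , subst (λ k → w ≢ chain t k) (≡.sym l) q)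

      choose : ∀ {u w} π γ → cross π γ u w ≡ true → Any (λ B → B u w ≡ true) main-classes
      choose true true e = there (here e)
      choose true false e = there (there (here e))
      choose false true e = there (there (there (here e)))
      choose false false e = there (there (there (there (here e))))

      cover : ∀ u w → Edge u w ≡ true → Any (λ B → B u w ≡ true) (main-classes ++ exceptional)
      cover u w e with <-cmp (lev u) (lev w)
      ... | tri≈ _ l _ = here (⌊⌋-complete (flat? u w) (e , l))
      ... | tri< l _ _ = [ (λ p → Anyₚ.++⁺ˡ (choose (odd? (lev u)) (group u) (⌊⌋-complete (cross? (odd? (lev u)) (group u) u w) (inj₁ p)))) ,
                           (λ p → Anyₚ.++⁺ʳ main-classes ([ here , (λ q → there (here q)) ]′ p)) ]′ (upward u w e (≤-antisym (lip e) l))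
      ... | tri> _ _ l = [ (λ p → Anyₚ.++⁺ˡ (choose (odd? (lev w)) (group w) (⌊⌋-complete (cross? (odd? (lev w)) (group w) u w) (inj₂ p)))) ,
                           (λ p → Anyₚ.++⁺ʳ main-classes ([ (λ q → there (there (here q))) , (λ q → there (there (there (here q)))) ]′ p)) ]′ (upward w u (asym e) (≤-antisym (lip (asym e)) l))

      dense-class : ∀ {k} → 1 ≤ k → 1200 * k * n ≤ 2 * edgeCount G → Any (λ B → 224 * k * n ≤ count₂ B) main-classes
      dense-class {k} 1≤k dense with anyL? (λ B → 224 * k * n ≤? count₂ B) main-classes
      ... | yes a = a
      ... | no none = ⊥-elim (<⇒≱ arithmetic (≤-trans dense (≤-trans (2*edgeCount≤ G) (≤-trans (count₂-cover (main-classes ++ exceptional) cover)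
          (+-mono-≤ (sparse flat λ l → none (here l)) (+-mono-≤ (sparse (cross true true) λ l → none (there (here l))) (+-mono-≤ (sparse (cross true false) λ l → none (there (there (here l))))
          (+-mono-≤ (sparse (cross false true) λ l → none (there (there (there (here l))))) (+-mono-≤ (sparse (cross false false) λ l → none (there (there (there (there (here l))))))
          (+-mono-≤ (onto-count s) (+-mono-≤ (onto-count t) (+-mono-≤ (onto′-count s) (+-monoˡ-≤ 0 (onto′-count t))))))))))))))
        where
        M : ℕ
        M = k * n
        onto′-count : ∀ z → count₂ (onto′ z) ≤ n
        onto′-count z = ≤-trans (≤-reflexive (count₂-transpose (onto z))) (onto-count z)
        sparse : ∀ B → ¬ (224 * k * n ≤ count₂ B) → count₂ B ≤ 224 * k * n
        sparse B ¬l = <⇒≤ (≰⇒> ¬l)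
        1≤n : 1 ≤ n
        1≤n = ≤-trans (s≤s z≤n) (proj₁ twoConn)
        n≤M : n ≤ M
        n≤M = ≤-trans (≤-reflexive (≡.sym (*-identityˡ n))) (*-monoˡ-≤ n 1≤k)
        -- 5 · 224 + 4 = 1124 accounts for the five classes and the four exceptional relations; 1200
        -- leaves slack.
        bound : ∀ x m l → x ≡ 224 * m → l ≤ m → 1 ≤ m → x + (x + (x + (x + (x + (l + (l + (l + (l + 0)))))))) < 1200 * m
        bound x m l e l≤m 1≤m = begin-strict
          x + (x + (x + (x + (x + (l + (l + (l + (l + 0))))))))  ≡⟨ solve 2 (λ x l → x :+ (x :+ (x :+ (x :+ (x :+ (l :+ (l :+ (l :+ (l :+ con 0)))))))) := con 5 :* x :+ con 4 :* l) refl x l ⟩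
          5 * x + 4 * l  ≤⟨ +-monoʳ-≤ (5 * x) (*-monoʳ-≤ 4 l≤m) ⟩
          5 * x + 4 * m  ≡⟨ cong (λ y → 5 * y + 4 * m) e ⟩
          5 * (224 * m) + 4 * m  ≡⟨ cong (_+ 4 * m) (*-assoc 5 224 m) ⟨
          1120 * m + 4 * m  ≡⟨ *-distribʳ-+ m 1120 4 ⟨
          1124 * m  <⟨ *-monoˡ-< m {{>-nonZero 1≤m}} (m≤m+n 1125 75) ⟩
          1200 * m  ∎
          where
          open ≤-Reasoning
          open +-*-Solver
        x₁ : ℕ
        x₁ = 224 * k * n
        arithmetic : x₁ + (x₁ + (x₁ + (x₁ + (x₁ + (n + (n + (n + (n + 0)))))))) < 1200 * k * n
        arithmetic = ≤-trans (bound x₁ M n (*-assoc 224 k n) n≤M (≤-trans 1≤n n≤M)) (≤-reflexive (≡.sym (*-assoc 1200 k n)))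

      meet′ : ∀ {a b} → a ≤ j → b ≤ j → anc a t ≡ anc b s → a ≡ j
      meet′ {a} {b} a≤ b≤ e = trans (anc-level {a} {b} (subst (a ≤_) (≡.sym lt) a≤) (subst (b ≤_) (≡.sym ls) b≤) (trans lt (≡.sym ls)) e) (meet b≤ a≤ (≡.sym e))

      cross-sym : ∀ π γ → Symmetricᵇ (cross π γ)
      cross-sym π γ {u} {w} e = ⌊⌋-complete (cross? π γ w u) ([ inj₂ , inj₁ ]′ (⌊⌋-sound (cross? π γ u w) e))

      cross⊆ : ∀ π γ {u w} → cross π γ u w ≡ true → Edge u w ≡ true
      cross⊆ π γ {u} {w} e = [ proj₁ , (λ p → asym (proj₁ p)) ]′ (⌊⌋-sound (cross? π γ u w) e)

      -- The parity `π` of lower ends pins the chorded cycle to two levels: an edge going further up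
      -- from level `i + 1`, or down from level `i`, would have a lower end of the wrong parity.
      module Class (π γ : Bool) {ν} (C : ChordedCycle (cross π γ) ν) where
        open ChordedCycle C
        ends : ∀ {u w} → cross π γ u w ≡ true → Up π γ u w ⊎ Up π γ w u
        ends {u} {w} = ⌊⌋-sound (cross? π γ u w)
        bottom : Σ ℕ λ i → odd? i ≡ π × (lev (c 0) ≡ i ⊎ lev (c 0) ≡ suc i)
        bottom with ends (edge 0)
        ... | inj₁ (_ , l , o , _) = lev (c 0) , o , inj₁ refl
        ... | inj₂ (_ , l , o , _) = lev (c 1) , o , inj₂ l
        module _ {i} (oi : odd? i ≡ π) (init : lev (c 0) ≡ i ⊎ lev (c 0) ≡ suc i) where
          absurd : ∀ {b} → b ≡ π → not b ≢ π
          absurd {true} refl ()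
          absurd {false} refl ()
          low : ∀ x → lev (c x) ≡ i → Up π γ (c x) (c (suc x))
          low x l with ends (edge x)
          ... | inj₁ p = p
          ... | inj₂ (_ , l′ , o , _) = ⊥-elim (absurd o (trans (cong odd? (trans (≡.sym l′) l)) oi))
          high : ∀ x → lev (c x) ≡ suc i → Up π γ (c (suc x)) (c x)
          high x l with ends (edge x)
          ... | inj₂ p = p
          ... | inj₁ (_ , _ , o , _) = ⊥-elim (absurd oi (trans (cong odd? (≡.sym l)) o))
          levels : ∀ x → lev (c x) ≡ i ⊎ lev (c x) ≡ suc i
          levels zero = init
          levels (suc x) with levels x
          ... | inj₁ l = inj₂ (trans (proj₁ (proj₂ (low x l))) (cong suc l))
          ... | inj₂ l = inj₁ (ℕₚ.suc-injective (trans (≡.sym (proj₁ (proj₂ (high x l)))) l))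
          flip : ∀ {u v} → cross π γ u v ≡ true → odd? (lev v) ≡ not (odd? (lev u))
          flip e with ends e
          ... | inj₁ (_ , l , _) = cong odd? l
          ... | inj₂ (_ , l , _) = trans (≡.sym (not-not _)) (cong (not ∘ odd?) (≡.sym l))
          in-group : ∀ x → lev (c x) ≡ i → group (c x) ≡ γ
          in-group x l = proj₁ (proj₂ (proj₂ (proj₂ (low x l))))
          off-chain : ∀ x → lev (c x) ≡ suc i → ∀ {a} → a ≤ j → c x ≢ anc a s × c x ≢ anc a t
          off-chain x l {a} a≤ with high x l
          ... | _ , _ , _ , _ , ps , pt = (λ e → ps (trans e (trans (on-chain ls a≤) (cong (chain s ∘ lev) (≡.sym e))))) ,
                                          (λ e → pt (trans e (trans (on-chain lt a≤) (cong (chain t ∘ lev) (≡.sym e)))))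
          j∸1≢j : j ∸ 1 ≢ j
          j∸1≢j e = 1+n≢n (trans (m+[n∸m]≡n 1≤j) (≡.sym e))
          cycles : ∀ {N} → 2 * N + 2 ≤ ν → OddCycles G N
          cycles = by-group γ refl
            where
            by-group : ∀ b → b ≡ γ → ∀ {N} → 2 * N + 2 ≤ ν → OddCycles G N
            -- Lower ends in the branch of `s` are off the branch of `t`, so `t` plays the part of
            -- `z′`; for the other group `s` does.
            by-group true refl = Crossing.crossing-cycles G asym airr conn (tree x) 1≤j {s} {t} ls lt ts meet (cross-sym π γ) (cross⊆ π γ) C levels flip
              (λ y l e → j∸1≢j (meet (m∸n≤m j 1) (m∸n≤m j 1) (trans (≡.sym (⌊⌋-sound (anc (lev (c y) ∸ 1) (c y) Fin.≟ anc (j ∸ 1) s) (in-group y l))) e)))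
              off-chain
            by-group false refl = Crossing.crossing-cycles G asym airr conn (tree x) 1≤j {t} {s} lt ls (asym ts) meet′ (cross-sym π γ) (cross⊆ π γ) C levels flip
              (λ y l e → case (trans (≡.sym (in-group y l)) (⌊⌋-complete (anc (lev (c y) ∸ 1) (c y) Fin.≟ anc (j ∸ 1) s) e)))
              (λ y l a≤ → proj₂ (off-chain y l a≤) , proj₁ (off-chain y l a≤))
              where
              case : false ≢ true
              case ()

        all-cycles : ∀ {N} → 2 * N + 2 ≤ ν → OddCycles G N
        all-cycles = cycles (proj₁ (proj₂ bottom)) (proj₂ (proj₂ bottom))

    flat-sym : Symmetricᵇ flat
    flat-sym {u} {v} e with ⌊⌋-sound (flat? u v) e
    ... | a , l = ⌊⌋-complete (flat? v u) (asym a , ≡.sym l)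

    flat⊆ : ∀ {u v} → flat u v ≡ true → Edge u v ≡ true
    flat⊆ {u} {v} e = proj₁ (⌊⌋-sound (flat? u v) e)

    LongChordedCycle : BRel n → ℕ → Set
    LongChordedCycle B N = Σ ℕ λ ν → 2 * N + 2 ≤ ν × ChordedCycle B ν

    from-cross : ∀ π γ {N} → LongChordedCycle (cross π γ) N → OddCycles G N
    from-cross π γ {N} (ν , large , C) = Class.all-cycles π γ C {N} large

    from-flat : ∀ {N} → LongChordedCycle flat N → OddCycles G N
    from-flat {N} (ν , large , C) = horizontal-cycles G asym (tree x) flat-sym flat⊆ (λ {u} {v} e → proj₂ (⌊⌋-sound (flat? u v) e)) C {N} large

    by-class : ∀ {N} {Q : BRel n → Set} → (∀ {B} → Symmetricᵇ B → (∀ {u v} → B u v ≡ true → Edge u v ≡ true) → Q B → LongChordedCycle B N) →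
      Any Q main-classes → OddCycles G N
    by-class f (here h) = from-flat (f flat-sym flat⊆ h)
    by-class f (there (here h)) = from-cross true true (f (cross-sym true true) (cross⊆ true true) h)
    by-class f (there (there (here h))) = from-cross true false (f (cross-sym true false) (cross⊆ true false) h)
    by-class f (there (there (there (here h)))) = from-cross false true (f (cross-sym false true) (cross⊆ false true) h)
    by-class f (there (there (there (there (here h))))) = from-cross false false (f (cross-sym false false) (cross⊆ false false) h)

    odd-cycles : ∀ {g d k} → GirthAtLeast g Edge → 2 * suc d < g → 1 ≤ k → 1200 * k * n ≤ 2 * edgeCount G → OddCycles G (k ^ suc d)
    odd-cycles {g} {d} {k} girth 2d<g 1≤k dense = by-class {k ^ suc d} {λ B → 224 * k * n ≤ count₂ B}
      (λ {B} sB B⊆ h → long-chorded-cycle {A = B} sB (λ e → airr (B⊆ e)) v₀ {g} {d} {k} (λ w → girth (mapʷ B⊆ w)) 2d<g 1≤k h)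
      (dense-class {k} 1≤k dense)

  consecutive-odd-cycles : ∀ {g d k} → GirthAtLeast g Edge → 2 * suc d < g → 1 ≤ k → 1200 * k * n ≤ 2 * edgeCount G → OddCycles G (k ^ suc d)
  consecutive-odd-cycles {g} {d} {k} = go shortest
    where
    go : (∃ λ j → Horizontal j × (∀ {j′} → j′ < j → ¬ Horizontal j′)) →
      GirthAtLeast g Edge → 2 * suc d < g → 1 ≤ k → 1200 * k * n ≤ 2 * edgeCount G → OddCycles G (k ^ suc d)
    go (j , (x , s , t , ts , ls , lt) , min) = odd-cycles min ts ls lt {g} {d} {k}

theorem1 : Σ ℕ λ c → (0 < c) ×
    (∀ (k n : ℕ) (G : Graph n) (g : ℕ) →
    TwoConnected G → ¬ Bipartite G →
    c * k * n ≤ 2 * edgeCount G →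
    Girth G g →
    Σ ℕ λ m → Odd m ×
    (∀ i → i < k ^ ((g ∸ 1) / 2) → HasCycle G (m + 2 * i)))
theorem1 = 1200 , s≤s z≤n , λ k n G g two ¬bip dense girth →
    cases G two ¬bip k ((g ∸ 1) / 2) {g} (girth≥3 girth) (small girth) (λ w u l → proj₂ girth _ (cycle G w u l)) dense
  where
  -- Cycles have at least three vertices, so the exponent is positive and has the form `suc d` that
  -- the expansion argument needs.
  girth≥3 : ∀ {n} {G : Graph n} {g} → Girth G g → 1 ≤ (g ∸ 1) / 2
  girth≥3 ((m , refl , _) , _) = /-monoˡ-≤ {2} {2 + m} 2 (s≤s (s≤s z≤n))
  small : ∀ {n} {G : Graph n} {g} → Girth G g → 2 * ((g ∸ 1) / 2) < g
  small ((m , refl , _) , _) = s≤s (≤-trans (≤-reflexive (*-comm 2 ((2 + m) / 2))) (m/n*n≤m (2 + m) 2))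
  cases : ∀ {n} (G : Graph n) → TwoConnected G → ¬ Bipartite G → ∀ k e {g} → 1 ≤ e → 2 * e < g → GirthAtLeast g (adj G) →
    1200 * k * n ≤ 2 * edgeCount G → OddCycles G (k ^ e)
  -- A positive power of 0 is 0, so no cycle is asked for and 1 is an arbitrary odd number.
  cases G two ¬bip zero (suc d) _ _ _ _ = 1 , (0 , refl) , λ i ()
  cases G two ¬bip (suc k) (suc d) {g} _ l girth dense = Main.consecutive-odd-cycles G two ¬bip (bfs-trees G (proj₁ (proj₂ two))) {g} {d} {suc k} girth l (s≤s z≤n) dense
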